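{- Let $s,t\geq 1$ be integers and let $p,q,l$ be three distinct primes with $p,q$ odd, $p\equiv 3 \pmod 4$, $\mathrm{ord}_{p^s}(l)=\phi(p^s)/2$, $\mathrm{ord}_{q^t}(l)=\phi(q^t)$ and $\gcd(\phi(p^s),\phi(q^t))=2$. Let $0\leq i\leq s-1$ and $0\leq j\leq t-1$. Then in the ring $\mathbb{F}_l[x]/\langle x^{p^sq^t}-1\rangle$: \[\begin{aligned}\chi_{ij}\chi_{ij}^*=&\frac{p-3}{4}p^{s-i-1}(q-2)q^{t-j-1}(\chi_{ij}+\chi_{ij}^*)+\frac{p-3}{4}p^{s-i-1}\phi(q^{t-j})\sum_{j<m\leq t}(\chi_{im}+\chi_{im}^*)\\& +\frac{\phi(p^{s-i})}{2}\phi(q^{t-j})\sum_{\substack{i<k\leq s-1\\ j<m\leq t}}(\chi_{km}+\chi_{km}^*)+\frac{\phi(p^{s-i})}{2}(q-2)q^{t-j-1}\chi_{sj}\\& +\frac{\phi(p^{s-i})}{2}\phi(q^{t-j})\sum_{j<m\leq t}\chi_{sm}+\frac{\phi(p^{s-i})}{2}(q-2)q^{t-j-1}\sum_{i<k\leq s-1}(\chi_{kj}+\chi_{kj}^*). \end{aligned}\]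
   Context: Here $\phi$ is Euler's phi function (with $\phi(1)=1$) and $\mathrm{ord}_m(k)$ is the multiplicative order of $k$ modulo $m$. Put $n=p^sq^t$. Fix an integer $g$ that is a primitive root both modulo $p^s$ and modulo $q^t$. For an integer $\gamma$, $C_\gamma=\{\gamma l^r \bmod n: r\geq 0\}\subseteq \mathbb{Z}_n$ is the $l$-cyclotomic coset modulo $n$ containing $\gamma$. For $0\leq i\leq s$, $0\leq j\leq t$ set $C_{ij}=C_{p^iq^j}$ and $C_{ij}^*=C_{p^iq^jg}$; in particular $C_{sj}=C_{sj}^*$ and $C_{st}=C_0=\{0\}$. Define elements of $\mathbb{F}_l[x]/\langle x^{n}-1\rangle$ by $\chi_{ij}=\sum_{\alpha\in C_{ij}}x^\alpha$ and $\chi_{ij}^*=\sum_{\alpha\in C_{ij}^*}x^\alpha$; in particular $\chi_{sj}=\chi_{sj}^*$ and $\chi_{st}=1$. Integer coefficients are read in $\mathbb{F}_l$, and empty sums are $0$. -}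

module Defs where

open import Algebra.Bundles using (CommutativeRing; Semiring)
import Algebra.Definitions.RawMagma as RawMagmaDefinitions
import Algebra.Definitions.RawSemiring as RawSemiringDefinitions
import Algebra.Properties.AbelianGroup as AbelianGroupProperties
import Algebra.Properties.CommutativeSemigroup as CommutativeSemigroupProperties
import Algebra.Properties.Ring as RingProperties
import Algebra.Properties.Semiring.Divisibility as SemiringDivisibility
open import Data.Bool.Base using (if_then_else_)
open import Data.Fin.Base using (Fin; toℕ; fromℕ<)
open import Data.Fin.Properties using (pigeonhole; toℕ-fromℕ<; toℕ<n)
open import Data.Integer.Base as ℤ using (ℤ; +_)
import Data.Integer.DivMod as ℤ
import Data.Integer.Divisibility.Signed as Signed
import Data.Integer.Properties as ℤ
open import Data.List.Base using (List; []; _∷_; length; filter; map; upTo)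
open import Data.Nat.Base as ℕ using (ℕ; zero; suc)
open import Data.Nat.Coprimality using (coprime?)
open import Data.Nat.Induction using (<-rec)
import Data.Nat.Properties as ℕ
open import Data.Product.Base using (∃; _×_; _,_)
open import Level using (Level; _⊔_; 0ℓ)
open import Relation.Binary.PropositionalEquality as ≡ using (_≡_)
import Relation.Binary.Reasoning.Setoid as SetoidReasoning
open import Relation.Nullary.Decidable using (Dec; yes; no; does; map′)

private
  variable
    c ℓ : Level

-- R / ⟨ f ⟩ keeps the carrier of R; only its equality becomes congruence
-- modulo f.
module Quotient (R : CommutativeRing c ℓ) (f : CommutativeRing.Carrier R) where
  open CommutativeRing R
  open RawSemiringDefinitions (Semiring.rawSemiring semiring) using (_∣_)
  open SemiringDivisibility semiring using (_,_; ∣ʳ-respʳ-≈; x∣ʳy⇒x∣ʳzy; _∣0)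
  open RingProperties ring using (x[y-z]≈xy-xz; [y-z]x≈yx-zx; -‿distribˡ-*)
  open AbelianGroupProperties +-abelianGroup using (⁻¹-anti-homo‿-; ⁻¹-∙-comm)
  open CommutativeSemigroupProperties +-commutativeSemigroup using (interchange)
  open SetoidReasoning setoid

  infix 4 _≈ᶠ_

  record _≈ᶠ_ (a b : Carrier) : Set (c ⊔ ℓ) where
    constructor mod
    field
      divides : f ∣ a - b

  private
    ∣-+ : ∀ {x y} → f ∣ x → f ∣ y → f ∣ x + y
    ∣-+ {x} {y} (u , uf≈x) (v , vf≈y) =
      u + v , trans (distribʳ f u v) (+-cong uf≈x vf≈y)

    ∣-neg : ∀ {x} → f ∣ x → f ∣ - x
    ∣-neg (u , uf≈x) = - u , trans (sym (-‿distribˡ-* u f)) (-‿cong uf≈x)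

    telescope : ∀ a b d → (a - b) + (b - d) ≈ a - d
    telescope a b d = begin
      (a - b) + (b - d)    ≈⟨ +-assoc a (- b) (b - d) ⟩
      a + (- b + (b - d))  ≈⟨ +-congˡ (+-assoc (- b) b (- d)) ⟨
      a + ((- b + b) - d)  ≈⟨ +-congˡ (+-congʳ (-‿inverseˡ b)) ⟩
      a + (0# - d)         ≈⟨ +-congˡ (+-identityˡ (- d)) ⟩
      a - d                ∎

  ≈⇒≈ᶠ : ∀ {a b} → a ≈ b → a ≈ᶠ b
  ≈⇒≈ᶠ {a} {b} a≈b =
    mod (∣ʳ-respʳ-≈ (sym (trans (+-congʳ a≈b) (-‿inverseʳ b))) (f ∣0))

  private
    ≈ᶠ-sym : ∀ {a b} → a ≈ᶠ b → b ≈ᶠ a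
    ≈ᶠ-sym {a} {b} (mod p) = mod (∣ʳ-respʳ-≈ (⁻¹-anti-homo‿- a b) (∣-neg p))

    ≈ᶠ-trans : ∀ {a b d} → a ≈ᶠ b → b ≈ᶠ d → a ≈ᶠ d
    ≈ᶠ-trans {a} {b} {d} (mod p) (mod q) = mod (∣ʳ-respʳ-≈ (telescope a b d) (∣-+ p q))

    ≈ᶠ-+ : ∀ {a a′ b b′} → a ≈ᶠ a′ → b ≈ᶠ b′ → a + b ≈ᶠ a′ + b′
    ≈ᶠ-+ {a} {a′} {b} {b′} (mod p) (mod q) = mod (∣ʳ-respʳ-≈ eq (∣-+ p q))
      where
      eq : (a - a′) + (b - b′) ≈ (a + b) - (a′ + b′)
      eq = trans (interchange a (- a′) b (- b′)) (+-congˡ (⁻¹-∙-comm a′ b′))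

    ≈ᶠ-neg : ∀ {a a′} → a ≈ᶠ a′ → - a ≈ᶠ - a′
    ≈ᶠ-neg {a} {a′} (mod p) = mod (∣ʳ-respʳ-≈ (sym (⁻¹-∙-comm a (- a′))) (∣-neg p))

    ≈ᶠ-* : ∀ {a a′ b b′} → a ≈ᶠ a′ → b ≈ᶠ b′ → a * b ≈ᶠ a′ * b′
    ≈ᶠ-* {a} {a′} {b} {b′} (mod p) (mod q) = mod (∣ʳ-respʳ-≈ eq
      (∣-+ (x∣ʳy⇒x∣ʳzy b p) (x∣ʳy⇒x∣ʳzy a′ q)))
      where
      eq : b * (a - a′) + a′ * (b - b′) ≈ a * b - a′ * b′
      eq = begin
        b * (a - a′) + a′ * (b - b′)
          ≈⟨ +-cong (*-comm b (a - a′)) (x[y-z]≈xy-xz a′ b b′) ⟩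
        (a - a′) * b + (a′ * b - a′ * b′)
          ≈⟨ +-congʳ ([y-z]x≈yx-zx b a a′) ⟩
        (a * b - a′ * b) + (a′ * b - a′ * b′)
          ≈⟨ telescope (a * b) (a′ * b) (a′ * b′) ⟩
        a * b - a′ * b′ ∎

  commutativeRing : CommutativeRing c (c ⊔ ℓ)
  commutativeRing = record
    { Carrier = Carrier
    ; _≈_ = _≈ᶠ_
    ; _+_ = _+_
    ; _*_ = _*_
    ; -_ = -_
    ; 0# = 0#
    ; 1# = 1#
    ; isCommutativeRing = record
      { isRing = record
        { +-isAbelianGroup = record
          { isGroup = record
            { isMonoid = record
              { isSemigroup = record
                { isMagma = record
                  { isEquivalence = record
                    { refl = ≈⇒≈ᶠ refl ; sym = ≈ᶠ-sym ; trans = ≈ᶠ-trans }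
                  ; ∙-cong = ≈ᶠ-+
                  }
                ; assoc = λ x y z → ≈⇒≈ᶠ (+-assoc x y z)
                }
              ; identity = (λ x → ≈⇒≈ᶠ (+-identityˡ x)) , (λ x → ≈⇒≈ᶠ (+-identityʳ x))
              }
            ; inverse = (λ x → ≈⇒≈ᶠ (-‿inverseˡ x)) , (λ x → ≈⇒≈ᶠ (-‿inverseʳ x))
            ; ⁻¹-cong = ≈ᶠ-neg
            }
          ; comm = λ x y → ≈⇒≈ᶠ (+-comm x y)
          }
        ; *-cong = ≈ᶠ-*
        ; *-assoc = λ x y z → ≈⇒≈ᶠ (*-assoc x y z)
        ; *-identity = (λ x → ≈⇒≈ᶠ (*-identityˡ x)) , (λ x → ≈⇒≈ᶠ (*-identityʳ x))
        ; distrib = (λ x y z → ≈⇒≈ᶠ (distribˡ x y z)) , (λ x y z → ≈⇒≈ᶠ (distribʳ x y z))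
        }
      ; *-comm = λ x y → ≈⇒≈ᶠ (*-comm x y)
      }
    }

infixl 8 _/⟨_⟩

_/⟨_⟩ : (R : CommutativeRing c ℓ) → CommutativeRing.Carrier R → CommutativeRing c (c ⊔ ℓ)
R /⟨ f ⟩ = Quotient.commutativeRing R f

φ : ℕ → ℕ
φ m = length (filter (λ a → coprime? a m) (map suc (upTo m)))

ℤ/_ℤ : ℕ → CommutativeRing 0ℓ 0ℓ
ℤ/ m ℤ = ℤ.+-*-commutativeRing /⟨ + m ⟩

infix 4 _≡_[mod_]

_≡_[mod_] : ℤ → ℤ → ℕ → Set
a ≡ b [mod m ] = CommutativeRing._≈_ (ℤ/ m ℤ) a b

≡[mod]? : ∀ a b m → Dec (a ≡ b [mod m ])
≡[mod]? a b m = map′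
  (λ { (Signed.divides k e) → Quotient.mod (k RawMagmaDefinitions., ≡.sym e) })
  (λ { (Quotient.mod (k RawMagmaDefinitions., e)) → Signed.divides k (≡.sym e) })
  ((+ m) Signed.∣? (a ℤ.- b))

-- ord_m(k) = d.  Existence of a positive exponent with k^d ≡ 1 already
-- forces gcd(k , m) = 1.
record HasOrder (m : ℕ) (k : ℤ) (d : ℕ) : Set where
  field
    positive : 0 ℕ.< d
    power≡1  : k ℤ.^ d ≡ ℤ.1ℤ [mod m ]
    minimal  : ∀ e → 0 ℕ.< e → k ℤ.^ e ≡ ℤ.1ℤ [mod m ] → d ℕ.≤ e

IsPrimitiveRoot : ℕ → ℤ → Set
IsPrimitiveRoot m g = HasOrder m g (φ m)

-- α ∈ C_γ, with Fin n standing for ℤ_n.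
InCoset : ℕ → (n : ℕ) → ℤ → Fin n → Set
InCoset l n γ α = ∃ λ r → γ ℤ.* (+ l) ℤ.^ r ≡ + toℕ α [mod n ]

-- The exponent r may be taken below n + 1, since the sequence γ l^r mod n
-- is eventually periodic; this makes membership decidable.
module _ (l m : ℕ) (γ : ℤ) where
  private
    n : ℕ
    n = suc m

    module ℤₙ = CommutativeRing (ℤ/ n ℤ)

    L : ℤ
    L = + l

    seq : ℕ → ℤ
    seq r = γ ℤ.* L ℤ.^ r

    residue : ℕ → Fin n
    residue r = fromℕ< (ℤ.n%ℕd<d (seq r) n)

    residue-≡ : ∀ r → seq r ≡ + toℕ (residue r) [mod n ]
    residue-≡ r = Quotient.mod (k RawMagmaDefinitions., ≡.sym eq)
      where
      k = seq r ℤ./ℕ n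
      eq : seq r ℤ.- + toℕ (residue r) ≡ k ℤ.* + n
      eq = begin
        seq r ℤ.- + toℕ (residue r)
          ≡⟨ ≡.cong (λ z → seq r ℤ.- + z) (toℕ-fromℕ< (ℤ.n%ℕd<d (seq r) n)) ⟩
        seq r ℤ.- ρ
          ≡⟨ ≡.cong (ℤ._- ρ) (ℤ.a≡a%ℕn+[a/ℕn]*n (seq r) n) ⟩
        (ρ ℤ.+ k ℤ.* + n) ℤ.- ρ
          ≡⟨ AbelianGroupProperties.xyx⁻¹≈y ℤ.+-0-abelianGroup ρ (k ℤ.* + n) ⟩
        k ℤ.* + n ∎
        where
        open ≡.≡-Reasoning
        ρ = + (seq r ℤ.%ℕ n)

    seq-+ : ∀ r k → seq r ℤ.* L ℤ.^ k ≡ seq (r ℕ.+ k)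
    seq-+ r k = ≡.trans (ℤ.*-assoc γ (L ℤ.^ r) (L ℤ.^ k))
      (≡.cong (γ ℤ.*_) (≡.sym (ℤ.^-distribˡ-+-* L r k)))

    Bounded : Fin n → Set
    Bounded α = ∃ λ r → r ℕ.< suc n × seq r ≡ + toℕ α [mod n ]

    bound : ∀ α r → seq r ≡ + toℕ α [mod n ] → Bounded α
    bound α = <-rec (λ r → seq r ≡ + toℕ α [mod n ] → Bounded α) step
      where
      step : ∀ r → (∀ {r′} → r′ ℕ.< r → seq r′ ≡ + toℕ α [mod n ] → Bounded α) →
             seq r ≡ + toℕ α [mod n ] → Bounded α
      step r rec h with r ℕ.<? suc n
      ... | yes r<1+n = r , r<1+n , h
      ... | no  r≮1+n
        with i , j , i<j , same ← pigeonhole (ℕ.n<1+n n) (λ (i : Fin (suc n)) → residue (toℕ i))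
        = rec {i′ ℕ.+ (r ℕ.∸ j′)} shorter (ℤₙ.trans earlier h)
        where
        i′ = toℕ i
        j′ = toℕ j

        j≤r : j′ ℕ.≤ r
        j≤r = ℕ.≤-trans (ℕ.<⇒≤ (toℕ<n j)) (ℕ.≮⇒≥ r≮1+n)

        shorter : i′ ℕ.+ (r ℕ.∸ j′) ℕ.< r
        shorter = ≡.subst (i′ ℕ.+ (r ℕ.∸ j′) ℕ.<_) (ℕ.m+[n∸m]≡n j≤r)
          (ℕ.+-monoˡ-< (r ℕ.∸ j′) i<j)

        i≡j : seq i′ ≡ seq j′ [mod n ]
        i≡j = ℤₙ.trans (residue-≡ i′)
          (≡.subst (λ ρ → + toℕ ρ ≡ seq j′ [mod n ]) (≡.sym same) (ℤₙ.sym (residue-≡ j′)))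

        earlier : seq (i′ ℕ.+ (r ℕ.∸ j′)) ≡ seq r [mod n ]
        earlier = ≡.subst₂ (λ a b → a ≡ b [mod n ])
          (seq-+ i′ (r ℕ.∸ j′))
          (≡.trans (seq-+ j′ (r ℕ.∸ j′)) (≡.cong seq (ℕ.m+[n∸m]≡n j≤r)))
          (ℤₙ.*-congʳ i≡j)

  inCoset-suc? : ∀ α → Dec (InCoset l n γ α)
  inCoset-suc? α = map′
    (λ (r , _ , h) → r , h)
    (λ (r , h) → bound α r h)
    (ℕ.anyUpTo? (λ r → ≡[mod]? (seq r) (+ toℕ α) n) (suc n))

inCoset? : ∀ l n γ (α : Fin n) → Dec (InCoset l n γ α)
inCoset? l (suc m) γ α = inCoset-suc? l m γ α

-- Coefficient lists, lowest degree first, compared coefficientwise, so that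
-- trailing zeros are irrelevant.
module Polynomial (R : CommutativeRing c ℓ) where
  open CommutativeRing R renaming (Carrier to A)
  open SetoidReasoning setoid
  open RingProperties ring using (-0#≈0#)
  open CommutativeSemigroupProperties +-commutativeSemigroup
    using (interchange)

  Poly : Set c
  Poly = List A

  coeff : Poly → ℕ → A
  coeff []      _       = 0#
  coeff (a ∷ p) zero    = a
  coeff (a ∷ p) (suc k) = coeff p k

  infix 4 _≋_
  infixl 6 _⊕_
  infixl 7 _⊛_
  infixr 7 _∙_

  record _≋_ (p q : Poly) : Set ℓ where
    constructor coeffwise
    field
      coeff-≈ : ∀ k → coeff p k ≈ coeff q k
  open _≋_

  _⊕_ : Poly → Poly → Poly
  []      ⊕ q       = q
  (a ∷ p) ⊕ []      = a ∷ p
  (a ∷ p) ⊕ (b ∷ q) = (a + b) ∷ (p ⊕ q)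

  ⊖_ : Poly → Poly
  ⊖_ = map (-_)

  _∙_ : A → Poly → Poly
  a ∙ p = map (a *_) p

  _⊛_ : Poly → Poly → Poly
  []      ⊛ q = []
  (a ∷ p) ⊛ q = a ∙ q ⊕ (0# ∷ p ⊛ q)

  X : Poly
  X = 0# ∷ 1# ∷ []

  coeff-⊕ : ∀ p q k → coeff (p ⊕ q) k ≈ coeff p k + coeff q k
  coeff-⊕ []      q       k       = sym (+-identityˡ (coeff q k))
  coeff-⊕ (a ∷ p) []      k       = sym (+-identityʳ (coeff (a ∷ p) k))
  coeff-⊕ (a ∷ p) (b ∷ q) zero    = refl
  coeff-⊕ (a ∷ p) (b ∷ q) (suc k) = coeff-⊕ p q k

  coeff-⊖ : ∀ p k → coeff (⊖ p) k ≈ - coeff p k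
  coeff-⊖ []      k       = sym -0#≈0#
  coeff-⊖ (a ∷ p) zero    = refl
  coeff-⊖ (a ∷ p) (suc k) = coeff-⊖ p k

  coeff-∙ : ∀ a p k → coeff (a ∙ p) k ≈ a * coeff p k
  coeff-∙ a []      k       = sym (zeroʳ a)
  coeff-∙ a (b ∷ p) zero    = refl
  coeff-∙ a (b ∷ p) (suc k) = coeff-∙ a p k

  private
    ≋-refl : ∀ {p} → p ≋ p
    ≋-refl = coeffwise λ _ → refl

    ≋-sym : ∀ {p q} → p ≋ q → q ≋ p
    ≋-sym e = coeffwise λ k → sym (coeff-≈ e k)

    ≋-trans : ∀ {p q r} → p ≋ q → q ≋ r → p ≋ r
    ≋-trans e e′ = coeffwise λ k → trans (coeff-≈ e k) (coeff-≈ e′ k)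

    ⊕-cong : ∀ {p p′ q q′} → p ≋ p′ → q ≋ q′ → p ⊕ q ≋ p′ ⊕ q′
    ⊕-cong {p} {p′} {q} {q′} e e′ = coeffwise λ k → begin
      coeff (p ⊕ q) k          ≈⟨ coeff-⊕ p q k ⟩
      coeff p k + coeff q k    ≈⟨ +-cong (coeff-≈ e k) (coeff-≈ e′ k) ⟩
      coeff p′ k + coeff q′ k  ≈⟨ coeff-⊕ p′ q′ k ⟨
      coeff (p′ ⊕ q′) k        ∎

    ⊕-assoc : ∀ p q r → (p ⊕ q) ⊕ r ≋ p ⊕ (q ⊕ r)
    ⊕-assoc p q r = coeffwise λ k → begin
      coeff ((p ⊕ q) ⊕ r) k                ≈⟨ coeff-⊕ (p ⊕ q) r k ⟩
      coeff (p ⊕ q) k + coeff r k          ≈⟨ +-congʳ (coeff-⊕ p q k) ⟩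
      (coeff p k + coeff q k) + coeff r k  ≈⟨ +-assoc _ _ _ ⟩
      coeff p k + (coeff q k + coeff r k)  ≈⟨ +-congˡ (coeff-⊕ q r k) ⟨
      coeff p k + coeff (q ⊕ r) k          ≈⟨ coeff-⊕ p (q ⊕ r) k ⟨
      coeff (p ⊕ (q ⊕ r)) k                ∎

    ⊕-comm : ∀ p q → p ⊕ q ≋ q ⊕ p
    ⊕-comm p q = coeffwise λ k →
      trans (coeff-⊕ p q k) (trans (+-comm _ _) (sym (coeff-⊕ q p k)))

    ⊕-identityʳ : ∀ p → p ⊕ [] ≋ p
    ⊕-identityʳ p = ⊕-comm p []

    ⊖-cong : ∀ {p q} → p ≋ q → ⊖ p ≋ ⊖ q
    ⊖-cong {p} {q} e = coeffwise λ k →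
      trans (coeff-⊖ p k) (trans (-‿cong (coeff-≈ e k)) (sym (coeff-⊖ q k)))

    ⊖-inverseˡ : ∀ p → ⊖ p ⊕ p ≋ []
    ⊖-inverseˡ p = coeffwise λ k → begin
      coeff (⊖ p ⊕ p) k            ≈⟨ coeff-⊕ (⊖ p) p k ⟩
      coeff (⊖ p) k + coeff p k    ≈⟨ +-congʳ (coeff-⊖ p k) ⟩
      - coeff p k + coeff p k      ≈⟨ -‿inverseˡ (coeff p k) ⟩
      0#                           ∎

    ⊖-inverseʳ : ∀ p → p ⊕ ⊖ p ≋ []
    ⊖-inverseʳ p = ≋-trans (⊕-comm p (⊖ p)) (⊖-inverseˡ p)

    ⊕-interchange : ∀ p q r s → (p ⊕ q) ⊕ (r ⊕ s) ≋ (p ⊕ r) ⊕ (q ⊕ s)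
    ⊕-interchange p q r s = coeffwise λ k → trans (expand p q r s k)
      (trans (interchange _ _ _ _) (sym (expand p r q s k)))
      where
      expand : ∀ p q r s k → coeff ((p ⊕ q) ⊕ (r ⊕ s)) k
                           ≈ (coeff p k + coeff q k) + (coeff r k + coeff s k)
      expand p q r s k =
        trans (coeff-⊕ (p ⊕ q) (r ⊕ s) k) (+-cong (coeff-⊕ p q k) (coeff-⊕ r s k))

    ∷-cong : ∀ {a b p q} → a ≈ b → p ≋ q → a ∷ p ≋ b ∷ q
    ∷-cong a≈b e = coeffwise λ { zero → a≈b ; (suc k) → coeff-≈ e k }

    0∷[] : 0# ∷ [] ≋ []
    0∷[] = coeffwise λ { zero → refl ; (suc k) → refl }

    ∙-congˡ : ∀ a {p q} → p ≋ q → a ∙ p ≋ a ∙ q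
    ∙-congˡ a {p} {q} e = coeffwise λ k →
      trans (coeff-∙ a p k) (trans (*-congˡ (coeff-≈ e k)) (sym (coeff-∙ a q k)))

    ∙-distrib-⊕ : ∀ a p q → a ∙ (p ⊕ q) ≋ a ∙ p ⊕ a ∙ q
    ∙-distrib-⊕ a p q = coeffwise λ k → begin
      coeff (a ∙ (p ⊕ q)) k                ≈⟨ coeff-∙ a (p ⊕ q) k ⟩
      a * coeff (p ⊕ q) k                  ≈⟨ *-congˡ (coeff-⊕ p q k) ⟩
      a * (coeff p k + coeff q k)          ≈⟨ distribˡ a _ _ ⟩
      a * coeff p k + a * coeff q k        ≈⟨ +-cong (coeff-∙ a p k) (coeff-∙ a q k) ⟨
      coeff (a ∙ p) k + coeff (a ∙ q) k    ≈⟨ coeff-⊕ (a ∙ p) (a ∙ q) k ⟨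
      coeff (a ∙ p ⊕ a ∙ q) k              ∎

    ∙-∙ : ∀ a b p → a ∙ (b ∙ p) ≋ (a * b) ∙ p
    ∙-∙ a b p = coeffwise λ k → begin
      coeff (a ∙ (b ∙ p)) k  ≈⟨ coeff-∙ a (b ∙ p) k ⟩
      a * coeff (b ∙ p) k    ≈⟨ *-congˡ (coeff-∙ b p k) ⟩
      a * (b * coeff p k)    ≈⟨ *-assoc a b _ ⟨
      (a * b) * coeff p k    ≈⟨ coeff-∙ (a * b) p k ⟨
      coeff ((a * b) ∙ p) k  ∎

    0∙ : ∀ p → 0# ∙ p ≋ []
    0∙ p = coeffwise λ k → trans (coeff-∙ 0# p k) (zeroˡ _)

    1∙ : ∀ p → 1# ∙ p ≋ p
    1∙ p = coeffwise λ k → trans (coeff-∙ 1# p k) (*-identityˡ _)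

    shift-⊕ : ∀ p q → 0# ∷ (p ⊕ q) ≋ (0# ∷ p) ⊕ (0# ∷ q)
    shift-⊕ p q = ∷-cong (sym (+-identityʳ 0#)) ≋-refl

    ∙-shift : ∀ a p → a ∙ (0# ∷ p) ≋ 0# ∷ a ∙ p
    ∙-shift a p = ∷-cong (zeroʳ a) ≋-refl

    ⊛-congˡ : ∀ p {q q′} → q ≋ q′ → p ⊛ q ≋ p ⊛ q′
    ⊛-congˡ []      e = ≋-refl
    ⊛-congˡ (a ∷ p) e = ⊕-cong (∙-congˡ a e) (∷-cong refl (⊛-congˡ p e))

    ⊛-zeroʳ : ∀ p → p ⊛ [] ≋ []
    ⊛-zeroʳ []      = ≋-refl
    ⊛-zeroʳ (a ∷ p) = ≋-trans (∷-cong refl (⊛-zeroʳ p)) 0∷[]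

    ⊛-∷ : ∀ p b q → p ⊛ (b ∷ q) ≋ b ∙ p ⊕ (0# ∷ p ⊛ q)
    ⊛-∷ []      b q = ≋-sym 0∷[]
    ⊛-∷ (a ∷ p) b q = ∷-cong (+-congʳ (*-comm a b)) tail
      where
      swap : ∀ u v w → u ⊕ (v ⊕ w) ≋ v ⊕ (u ⊕ w)
      swap u v w = ≋-trans (≋-sym (⊕-assoc u v w))
        (≋-trans (⊕-cong (⊕-comm u v) ≋-refl) (⊕-assoc v u w))
      tail : a ∙ q ⊕ p ⊛ (b ∷ q) ≋ b ∙ p ⊕ (a ∙ q ⊕ (0# ∷ p ⊛ q))
      tail = ≋-trans (⊕-cong ≋-refl (⊛-∷ p b q)) (swap (a ∙ q) (b ∙ p) (0# ∷ p ⊛ q))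

    ⊛-comm : ∀ p q → p ⊛ q ≋ q ⊛ p
    ⊛-comm []      q = ≋-sym (⊛-zeroʳ q)
    ⊛-comm (a ∷ p) q = ≋-trans
      (⊕-cong ≋-refl (∷-cong refl (⊛-comm p q))) (≋-sym (⊛-∷ q a p))

    ⊛-cong : ∀ {p p′ q q′} → p ≋ p′ → q ≋ q′ → p ⊛ q ≋ p′ ⊛ q′
    ⊛-cong {p} {p′} {q} {q′} e e′ = ≋-trans (⊛-congˡ p e′)
      (≋-trans (⊛-comm p q′) (≋-trans (⊛-congˡ q′ e) (⊛-comm q′ p′)))

    ⊛-distribˡ : ∀ p q r → p ⊛ (q ⊕ r) ≋ p ⊛ q ⊕ p ⊛ r
    ⊛-distribˡ []      q r = ≋-refl
    ⊛-distribˡ (a ∷ p) q r = ≋-trans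
      (⊕-cong (∙-distrib-⊕ a q r)
        (≋-trans (∷-cong refl (⊛-distribˡ p q r)) (shift-⊕ (p ⊛ q) (p ⊛ r))))
      (⊕-interchange (a ∙ q) (a ∙ r) (0# ∷ p ⊛ q) (0# ∷ p ⊛ r))

    ⊛-distribʳ : ∀ p q r → (q ⊕ r) ⊛ p ≋ q ⊛ p ⊕ r ⊛ p
    ⊛-distribʳ p q r = ≋-trans (⊛-comm (q ⊕ r) p)
      (≋-trans (⊛-distribˡ p q r) (⊕-cong (⊛-comm p q) (⊛-comm p r)))

    shift-⊛ : ∀ p q → (0# ∷ p) ⊛ q ≋ 0# ∷ p ⊛ q
    shift-⊛ p q = ⊕-cong (0∙ q) ≋-refl

    ∙-⊛ : ∀ a p q → (a ∙ p) ⊛ q ≋ a ∙ (p ⊛ q)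
    ∙-⊛ a []      q = ≋-refl
    ∙-⊛ a (b ∷ p) q = ≋-trans
      (⊕-cong (≋-sym (∙-∙ a b q))
        (≋-trans (∷-cong refl (∙-⊛ a p q)) (≋-sym (∙-shift a (p ⊛ q)))))
      (≋-sym (∙-distrib-⊕ a (b ∙ q) (0# ∷ p ⊛ q)))

    ⊛-assoc : ∀ p q r → (p ⊛ q) ⊛ r ≋ p ⊛ (q ⊛ r)
    ⊛-assoc []      q r = ≋-refl
    ⊛-assoc (a ∷ p) q r = ≋-trans (⊛-distribʳ r (a ∙ q) (0# ∷ p ⊛ q))
      (⊕-cong (∙-⊛ a q r)
        (≋-trans (shift-⊛ (p ⊛ q) r) (∷-cong refl (⊛-assoc p q r))))

    ⊛-identityˡ : ∀ p → (1# ∷ []) ⊛ p ≋ p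
    ⊛-identityˡ p = ≋-trans (⊕-cong (1∙ p) 0∷[]) (⊕-identityʳ p)

    ⊛-identityʳ : ∀ p → p ⊛ (1# ∷ []) ≋ p
    ⊛-identityʳ p = ≋-trans (⊛-comm p (1# ∷ [])) (⊛-identityˡ p)

  commutativeRing : CommutativeRing c ℓ
  commutativeRing = record
    { Carrier = Poly
    ; _≈_ = _≋_
    ; _+_ = _⊕_
    ; _*_ = _⊛_
    ; -_ = ⊖_
    ; 0# = []
    ; 1# = 1# ∷ []
    ; isCommutativeRing = record
      { isRing = record
        { +-isAbelianGroup = record
          { isGroup = record
            { isMonoid = record
              { isSemigroup = record
                { isMagma = record
                  { isEquivalence = record
                    { refl = ≋-refl ; sym = ≋-sym ; trans = ≋-trans }
                  ; ∙-cong = ⊕-cong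
                  }
                ; assoc = ⊕-assoc
                }
              ; identity = (λ _ → ≋-refl) , ⊕-identityʳ
              }
            ; inverse = ⊖-inverseˡ , ⊖-inverseʳ
            ; ⁻¹-cong = ⊖-cong
            }
          ; comm = ⊕-comm
          }
        ; *-cong = ⊛-cong
        ; *-assoc = ⊛-assoc
        ; *-identity = ⊛-identityˡ , ⊛-identityʳ
        ; distrib = ⊛-distribˡ , ⊛-distribʳ
        }
      ; *-comm = ⊛-comm
      }
    }

-- A field when l is prime.
𝔽 : ℕ → CommutativeRing 0ℓ 0ℓ
𝔽 l = ℤ/ l ℤ

module CyclicAlgebra (l n : ℕ) where
  private
    module 𝔽[X] where
      open Polynomial (𝔽 l) public using (X)
      open CommutativeRing (Polynomial.commutativeRing (𝔽 l)) public
      open RawSemiringDefinitions (Semiring.rawSemiring semiring) public using (_^_)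

  ring : CommutativeRing 0ℓ 0ℓ
  ring = Polynomial.commutativeRing (𝔽 l) /⟨ 𝔽[X].X 𝔽[X].^ n 𝔽[X].- 𝔽[X].1# ⟩

  open CommutativeRing ring public
    using (Carrier; semiring; 0#)
    renaming (_≈_ to infix 4 _≈ᴿ_; _+_ to infixl 6 _+ᴿ_; _*_ to infixl 7 _*ᴿ_)

  open RawSemiringDefinitions (Semiring.rawSemiring semiring) public
    using (sum)
    renaming (_^_ to infixr 8 _^ᴿ_; _×_ to infixr 7 _·_)

  x : Carrier
  x = 𝔽[X].X

  -- ∑_{α ∈ C_γ} x^α
  cosetSum : ℤ → Carrier
  cosetSum γ = sum {n} λ α → if does (inCoset? l n γ α) then x ^ᴿ toℕ α else 0#

  -- ∑_{a < k ≤ b} f k, empty when b ≤ a.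
  sumOver : ℕ → ℕ → (ℕ → Carrier) → Carrier
  sumOver a b f = sum {b ℕ.∸ a} λ k → f (suc a ℕ.+ toℕ k)

  infix 6 sumOver
  syntax sumOver a b (λ k → e) = ∑[ a < k ≤ b ] e

{-# OPTIONS --safe #-}
-- Write n = p^s q^t.  Since h = ord(l) mod p^s = φ(p^s)/2 is odd, - l is a
-- primitive root mod p^s and g ≡ - l^k for some k, so the p-component of
-- C*_{ij} is the negative of that of C_{ij}, and together they exhaust the
-- residues of p-adic valuation i.  On the q-side l generates all units, so
-- both q-components are the residues of q-adic valuation j.  As h and φ(q^t)
-- are coprime, C_{ij} is the product of its components under
-- ℤ_n ≅ ℤ_{p^s} × ℤ_{q^t}.
--
-- Hence the coefficient of x^c in χ_{ij} χ*_{ij} is a product of two counts of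
-- representations c ≡ u + v, one in ℤ_{p^s} and one in ℤ_{q^t}.  The q-count
-- is inclusion–exclusion.  The p-count is invariant under c ↦ l c and c ↦ - c,
-- hence constant on valuation i; the constant follows from counting all pairs
-- (u , v), with no appeal to cyclotomic numbers.  Expanding
-- (K [v_p = i] + H [v_p > i]) (L [v_q = j] + F [v_q > j]) and decomposing the
-- events v_p > i and v_q > j by exact valuation gives the right-hand side.
module Submission where

open import Defs
open import Algebra.Bundles using (CommutativeRing; Semiring)
import Algebra.Definitions.RawMagma as RawMagma
import Algebra.Definitions.RawSemiring as RawSemiringDefinitions
import Algebra.Properties.CommutativeMonoid.Mult as CommutativeMonoidMult
import Algebra.Properties.Semiring.Exp as SemiringExp
import Algebra.Properties.Semiring.Mult as SemiringMult
import Algebra.Properties.Semiring.Sum as SemiringSum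
open import Data.Bool.Base using (Bool; true; false; if_then_else_)
open import Data.Fin.Base as Fin using (Fin; toℕ; fromℕ<; combine; _↑ˡ_; _↑ʳ_)
open import Data.Fin.Permutation using (Permutation′; permutation)
open import Data.Fin.Properties using (toℕ-fromℕ<; toℕ<n; toℕ-injective; toℕ-combine; suc-injective)
open import Data.Integer.Base as ℤ using (ℤ; +_; 0ℤ; 1ℤ; -1ℤ)
import Data.Integer.DivMod as ℤ
import Data.Integer.Divisibility.Signed as Signed
import Data.Integer.Properties as ℤ
open import Data.Integer.Tactic.RingSolver using (solve-∀)
open import Data.List.Base using (length; filter; applyUpTo)
open import Data.List.Properties using (map-applyUpTo)
open import Data.Nat.Base using
  (ℕ; zero; suc; NonZero; >-nonZero; nonTrivial⇒n>1; _+_; _*_; _∸_; _^_; _/_; _%_; _≤_; _<_; z≤n; s≤s)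
open import Data.Nat.Coprimality using (Coprime; coprime?; coprime-divisor; coprime-Bézout)
open import Data.Nat.DivMod using (m≡m%n+[m/n]*n; m%n<n; m*n/n≡m)
open import Data.Nat.Divisibility as ℕ∣ using (_∤_; _∣_; divides)
open import Data.Nat.GCD using (gcd; gcd-greatest; module Bézout)
open import Data.Nat.Primality using (Prime; prime⇒nonZero; prime⇒nonTrivial; prime⇒irreducible; euclidsLemma)
import Data.Nat.Properties as ℕ
import Data.Nat.Tactic.RingSolver as ℕ-Solver
open import Data.Product.Base using (∃; ∃₂; _×_; _,_; proj₁; proj₂)
open import Data.Sum.Base using (_⊎_; inj₁; inj₂; [_,_]′)
open import Function.Base using (_∘_; id)
open import Relation.Binary.Definitions using (tri<; tri≈; tri>)
open import Relation.Binary.PropositionalEquality as ≡ using (_≡_; _≢_; refl; sym; trans; cong; cong₂; subst; subst₂)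
import Relation.Binary.Reasoning.Setoid as SetoidReasoning
open import Relation.Nullary using (Dec; yes; no; does; contradiction; ¬_; ¬?)
open import Relation.Nullary.Decidable using (dec-true; dec-false; map′; _×-dec_; _⊎-dec_)
open import Relation.Unary using (Decidable)

-- Counting all pairs yields one equation only. It settles the p-count because the symmetry c ↦ - c
-- leaves one unknown. Write p = 3 + 4w, let H = (1 + 2w) e be the size of a half layer, where e is
-- the number of residues of larger valuation, and let N be the count at a c in the layer. The H²
-- pairs are then distributed as 2H N + H e, so 2N + e = H and N = w e; this is the origin of (p -
-- 3)/4. Solving for N cancels H and 2, which may vanish in 𝔽_l, so every count is made in ℕ,
-- coefficient by coefficient, and is read in the ring only as a scalar multiple.
--
-- The two primes are not treated alike at the top index. For c ≡ 0 mod p^s there is one coset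
-- instead of two opposite ones, so the p-sums stop at s - 1 and the terms χ_{sm} stand apart; on
-- the q-side the residue 0 is one more layer, and the sums run up to t.

private
  module Mod {m : ℕ} = CommutativeRing (ℤ/ m ℤ)

-- Congruences as equality in ℤ/m.

module _ {m : ℕ} where

  +ˡ-mod : ∀ c {a b} → a ≡ b [mod m ] → c ℤ.+ a ≡ c ℤ.+ b [mod m ]
  +ˡ-mod c = Mod.+-cong {x = c} Mod.refl

  +ʳ-mod : ∀ c {a b} → a ≡ b [mod m ] → a ℤ.+ c ≡ b ℤ.+ c [mod m ]
  +ʳ-mod c a≡b = Mod.+-cong {u = c} a≡b Mod.refl

  *ˡ-mod : ∀ c {a b} → a ≡ b [mod m ] → c ℤ.* a ≡ c ℤ.* b [mod m ]
  *ˡ-mod c = Mod.*-cong {x = c} Mod.refl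

  *ʳ-mod : ∀ c {a b} → a ≡ b [mod m ] → a ℤ.* c ≡ b ℤ.* c [mod m ]
  *ʳ-mod c a≡b = Mod.*-cong {u = c} a≡b Mod.refl

≡⇒≡[mod] : ∀ {m a b} → a ≡ b → a ≡ b [mod m ]
≡⇒≡[mod] refl = Mod.refl

+multiple⇒≡[mod] : ∀ {m a b} k → a ≡ b ℤ.+ k ℤ.* + m → a ≡ b [mod m ]
+multiple⇒≡[mod] {m} {a} {b} k refl = Quotient.mod (k RawMagma., lemma b (k ℤ.* + m))
  where
  lemma : ∀ b c → c ≡ (b ℤ.+ c) ℤ.- b
  lemma = solve-∀

≡[mod]⇒+multiple : ∀ {m a b} → a ≡ b [mod m ] → ∃ λ k → a ≡ b ℤ.+ k ℤ.* + m
≡[mod]⇒+multiple {m} {a} {b} (Quotient.mod (k RawMagma., e)) =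
  k , trans (lemma a b) (cong (λ z → b ℤ.+ z) (sym e))
  where
  lemma : ∀ a b → a ≡ b ℤ.+ (a ℤ.- b)
  lemma = solve-∀

close⇒≡ : ∀ {m a b} → ℤ.∣ a ℤ.- b ∣ < m → a ≡ b [mod m ] → a ≡ b
close⇒≡ {m} {a} {b} a-b<m (Quotient.mod (k RawMagma., e)) with ℤ.∣ a ℤ.- b ∣ in ∣a-b∣
  | Signed.∣⇒∣ᵤ (Signed.divides k (sym e))
... | zero  | _   = ℤ.i-j≡0⇒i≡j a b (ℤ.∣i∣≡0⇒i≡0 ∣a-b∣)
... | suc _ | m∣d = contradiction m∣d (ℕ∣.>⇒∤ a-b<m)

toℕ-mod-injective : ∀ {n} (i j : Fin n) → + toℕ i ≡ + toℕ j [mod n ] → i ≡ j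
toℕ-mod-injective {n} i j i≡j = toℕ-injective (ℤ.+-injective (close⇒≡ i-j<n i≡j))
  where
  i-j<n : ℤ.∣ + toℕ i ℤ.- + toℕ j ∣ < n
  i-j<n = subst (λ d → ℤ.∣ d ∣ < n) (sym (ℤ.m-n≡m⊖n (toℕ i) (toℕ j)))
    (ℕ.≤-<-trans (ℤ.∣m⊝n∣≤m⊔n (toℕ i) (toℕ j)) (ℕ.⊔-pres-<m (toℕ<n i) (toℕ<n j)))

module _ (n : ℕ) .{{_ : NonZero n}} where

  residue : ℤ → Fin n
  residue a = fromℕ< (ℤ.n%ℕd<d a n)

  residue-≡ : ∀ a → + toℕ (residue a) ≡ a [mod n ]
  residue-≡ a = Mod.sym (+multiple⇒≡[mod] (a ℤ./ℕ n) (trans (ℤ.a≡a%ℕn+[a/ℕn]*n a n)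
    (cong (λ r → + r ℤ.+ (a ℤ./ℕ n) ℤ.* + n) (sym (toℕ-fromℕ< (ℤ.n%ℕd<d a n))))))

  affinePermutation : ∀ {k k′} → k ℤ.* k′ ≡ 1ℤ [mod n ] → ℤ → Permutation′ n
  affinePermutation {k} {k′} kk′≡1 c = permutation
    (λ i → residue (k ℤ.* + toℕ i ℤ.+ c))
    (λ i → residue (k′ ℤ.* (+ toℕ i ℤ.- c)))
    (λ i → toℕ-mod-injective _ _ (begin
      + toℕ (residue (k ℤ.* + toℕ (residue (k′ ℤ.* (+ toℕ i ℤ.- c))) ℤ.+ c))
        ≈⟨ residue-≡ _ ⟩
      k ℤ.* + toℕ (residue (k′ ℤ.* (+ toℕ i ℤ.- c))) ℤ.+ c
        ≈⟨ +ʳ-mod c (*ˡ-mod k (residue-≡ (k′ ℤ.* (+ toℕ i ℤ.- c)))) ⟩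
      k ℤ.* (k′ ℤ.* (+ toℕ i ℤ.- c)) ℤ.+ c
        ≡⟨ cong (λ z → z ℤ.+ c) (ℤ.*-assoc k k′ _) ⟨
      (k ℤ.* k′) ℤ.* (+ toℕ i ℤ.- c) ℤ.+ c
        ≈⟨ +ʳ-mod c (*ʳ-mod (+ toℕ i ℤ.- c) kk′≡1) ⟩
      1ℤ ℤ.* (+ toℕ i ℤ.- c) ℤ.+ c
        ≡⟨ lemma₁ (+ toℕ i) c ⟩
      + toℕ i ∎))
    (λ i → toℕ-mod-injective _ _ (begin
      + toℕ (residue (k′ ℤ.* (+ toℕ (residue (k ℤ.* + toℕ i ℤ.+ c)) ℤ.- c)))
        ≈⟨ residue-≡ _ ⟩
      k′ ℤ.* (+ toℕ (residue (k ℤ.* + toℕ i ℤ.+ c)) ℤ.- c)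
        ≈⟨ *ˡ-mod k′ (+ʳ-mod (ℤ.- c) (residue-≡ (k ℤ.* + toℕ i ℤ.+ c))) ⟩
      k′ ℤ.* ((k ℤ.* + toℕ i ℤ.+ c) ℤ.- c)
        ≡⟨ lemma₂ k k′ (+ toℕ i) c ⟩
      (k ℤ.* k′) ℤ.* + toℕ i
        ≈⟨ *ʳ-mod (+ toℕ i) kk′≡1 ⟩
      1ℤ ℤ.* + toℕ i
        ≡⟨ ℤ.*-identityˡ _ ⟩
      + toℕ i ∎))
    where
    open SetoidReasoning (Mod.setoid {n})
    lemma₁ : ∀ i c → 1ℤ ℤ.* (i ℤ.- c) ℤ.+ c ≡ i
    lemma₁ = solve-∀
    lemma₂ : ∀ k k′ i c → k′ ℤ.* ((k ℤ.* i ℤ.+ c) ℤ.- c) ≡ (k ℤ.* k′) ℤ.* i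
    lemma₂ = solve-∀

-- Sums over ℤ_n with values in a semiring.

module CyclicSum {c ℓ} (S : Semiring c ℓ) where
  open Semiring S using (Carrier; _≈_; setoid; +-assoc; +-congˡ; +-identityˡ) renaming (_+_ to _⊕_; sym to ≈-sym; trans to ≈-trans; reflexive to ≈-reflexive)
  open SemiringSum S public
  open SetoidReasoning setoid

  Periodic : ℕ → (ℤ → Carrier) → Set ℓ
  Periodic n f = ∀ a b → a ≡ b [mod n ] → f a ≈ f b

  -- ∑ over ℤ_n, represented by 0, …, n - 1
  cyclicSum : ℕ → (ℤ → Carrier) → Carrier
  cyclicSum n f = sum {n} λ k → f (+ toℕ k)

  cyclicSum-cong : ∀ n {f g : ℤ → Carrier} → (∀ a → f a ≈ g a) → cyclicSum n f ≈ cyclicSum n g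
  cyclicSum-cong n f≈g = sum-cong-≋ {n} λ k → f≈g (+ toℕ k)

  -- Translations, reflections u ↦ c - u and scalings by a unit are the substitutions made in the
  -- counts below; all of them have this form.
  cyclicSum-affine : ∀ n .{{_ : NonZero n}} f {k k′} → k ℤ.* k′ ≡ 1ℤ [mod n ] → ∀ c → Periodic n f →
                     cyclicSum n (λ a → f (k ℤ.* a ℤ.+ c)) ≈ cyclicSum n f
  cyclicSum-affine n f {k} {k′} kk′≡1 c f-periodic = begin
    cyclicSum n (λ a → f (k ℤ.* a ℤ.+ c))
      ≈⟨ sum-cong-≋ {n} (λ i → f-periodic _ _ (residue-≡ n (k ℤ.* + toℕ i ℤ.+ c))) ⟨
    sum {n} (λ i → f (+ toℕ (residue n (k ℤ.* + toℕ i ℤ.+ c))))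
      ≈⟨ ∑-permute (λ i → f (+ toℕ i)) (affinePermutation n {k} {k′} kk′≡1 c) ⟨
    cyclicSum n f ∎

  sum-↑ : ∀ m {n} (f : Fin (m + n) → Carrier) → sum f ≈ sum (λ i → f (i ↑ˡ n)) ⊕ sum (λ i → f (m ↑ʳ i))
  sum-↑ zero    f = ≈-sym (+-identityˡ _)
  sum-↑ (suc m) f = ≈-trans (+-congˡ (sum-↑ m (f ∘ Fin.suc))) (≈-sym (+-assoc _ _ _))

  sum-combine : ∀ m {n} (f : Fin (m * n) → Carrier) → sum f ≈ sum λ i → sum λ j → f (combine {m} {n} i j)
  sum-combine zero    f = ≈-reflexive refl
  sum-combine (suc m) {n} f = ≈-trans (sum-↑ n f) (+-congˡ (sum-combine m (λ i → f (n ↑ʳ i))))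

  -- Division by n writes each residue uniquely as n a + b. The remainder b is the outer variable,
  -- so that a factor of period n is constant in the inner sum.
  cyclicSum-* : ∀ m n f → cyclicSum (m * n) f ≈ cyclicSum n λ b → cyclicSum m λ a → f (+ n ℤ.* a ℤ.+ b)
  cyclicSum-* m n f = begin
    cyclicSum (m * n) f
      ≈⟨ sum-combine m (λ i → f (+ toℕ i)) ⟩
    (sum {m} λ i → sum {n} λ j → f (+ toℕ (combine i j)))
      ≡⟨ sum-cong-≗ {m} (λ i → sum-cong-≗ {n} λ j → cong f (combine≡ i j)) ⟩
    (sum {m} λ i → sum {n} λ j → f (+ n ℤ.* + toℕ i ℤ.+ + toℕ j))
      ≈⟨ ∑-comm {m} {n} _ ⟩
    (cyclicSum n λ b → cyclicSum m λ a → f (+ n ℤ.* a ℤ.+ b)) ∎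
    where
    combine≡ : ∀ (i : Fin m) (j : Fin n) → + toℕ (combine i j) ≡ + n ℤ.* + toℕ i ℤ.+ + toℕ j
    combine≡ i j = trans (cong +_ (toℕ-combine i j)) (cong (λ z → z ℤ.+ + toℕ j) (ℤ.pos-* n (toℕ i)))

  cyclicSum-single : ∀ n .{{_ : NonZero n}} (f : ℤ → Carrier) → (∀ (k : Fin n) → toℕ k ≢ 0 → f (+ toℕ k) ≈ Semiring.0# S) → cyclicSum n f ≈ f 0ℤ
  cyclicSum-single (suc n) f f≈0 = ≈-trans (+-congˡ (≈-trans (sum-cong-≋ {n} (λ k → f≈0 (Fin.suc k) λ ())) (sum-replicate-zero n))) (Semiring.+-identityʳ S _)

module _ {m : ℕ} where

  -mod : ∀ {a b} → a ≡ b [mod m ] → ℤ.- a ≡ ℤ.- b [mod m ]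
  -mod = Mod.-‿cong

  mod-* : ∀ {d} {a b} → a ≡ b [mod m * d ] → a ≡ b [mod d ]
  mod-* {d} {a} {b} a≡b with k , refl ← ≡[mod]⇒+multiple a≡b =
    +multiple⇒≡[mod] (k ℤ.* + m) (cong (λ z → b ℤ.+ z)
      (trans (cong (λ z → k ℤ.* z) (ℤ.pos-* m d)) (sym (ℤ.*-assoc k (+ m) (+ d)))))

  scale-mod : ∀ k {a b} → a ≡ b [mod m ] → + k ℤ.* a ≡ + k ℤ.* b [mod k * m ]
  scale-mod k {a} {b} a≡b with c , refl ← ≡[mod]⇒+multiple a≡b =
    +multiple⇒≡[mod] c (trans (lemma (+ k) b c (+ m)) (cong (λ z → + k ℤ.* b ℤ.+ c ℤ.* z) (sym (ℤ.pos-* k m))))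
    where
    lemma : ∀ k b c m → k ℤ.* (b ℤ.+ c ℤ.* m) ≡ k ℤ.* b ℤ.+ c ℤ.* (k ℤ.* m)
    lemma = solve-∀

  unscale-mod : ∀ k .{{_ : NonZero k}} {a b} → + k ℤ.* a ≡ + k ℤ.* b [mod k * m ] → a ≡ b [mod m ]
  unscale-mod k@(suc _) {a} {b} ka≡kb with c , e ← ≡[mod]⇒+multiple ka≡kb =
    +multiple⇒≡[mod] c (ℤ.*-cancelˡ-≡ (+ k) a (b ℤ.+ c ℤ.* + m)
      (trans e (trans (cong (λ z → + k ℤ.* b ℤ.+ c ℤ.* z) (ℤ.pos-* k m)) (lemma (+ k) b c (+ m)))))
    where
    lemma : ∀ k b c m → k ℤ.* b ℤ.+ c ℤ.* (k ℤ.* m) ≡ k ℤ.* (b ℤ.+ c ℤ.* m)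
    lemma = solve-∀

  ≡0⇒multiple : ∀ {a} → a ≡ 0ℤ [mod m ] → ∃ λ k → a ≡ + m ℤ.* k
  ≡0⇒multiple a≡0 with k , refl ← ≡[mod]⇒+multiple a≡0 =
    k , trans (ℤ.+-identityˡ _) (ℤ.*-comm k (+ m))

  multiple≡0 : ∀ k → + m ℤ.* k ≡ 0ℤ [mod m ]
  multiple≡0 k = +multiple⇒≡[mod] k (trans (ℤ.*-comm (+ m) k) (sym (ℤ.+-identityˡ _)))

  ^-mod : ∀ {a b} n → a ≡ b [mod m ] → a ℤ.^ n ≡ b ℤ.^ n [mod m ]
  ^-mod zero    a≡b = Mod.refl
  ^-mod {a} {b} (suc n) a≡b = Mod.*-cong {x = a} {y = b} a≡b (^-mod n a≡b)

≡0-mod⇔∣ : ∀ {m n} → (+ n ≡ 0ℤ [mod m ] → m ∣ n) × (m ∣ n → + n ≡ 0ℤ [mod m ])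
≡0-mod⇔∣ {m} {n} =
  (λ { (Quotient.mod (k RawMagma., e)) → subst (m ∣_) (cong ℤ.∣_∣ (ℤ.+-identityʳ (+ n)))
       (Signed.∣⇒∣ᵤ (Signed.divides k (sym e))) }) ,
  λ { (divides k refl) → +multiple⇒≡[mod] (+ k) (trans (ℤ.pos-* k m) (sym (ℤ.+-identityˡ _))) }

module ℕ∑ = CyclicSum ℕ.+-*-semiring

ℕ-sumOver : ℕ → ℕ → (ℕ → ℕ) → ℕ
ℕ-sumOver a b f = ℕ∑.sum {b ∸ a} λ k → f (suc a + toℕ k)

-- Linear combinations of the powers of x when x^n = 1.

module PowerSums {c ℓ} (R : CommutativeRing c ℓ) (n : ℕ) .{{_ : NonZero n}} where
  open CommutativeRing R using
    (Carrier; _≈_; 1#; setoid; semiring; +-commutativeMonoid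
    ; +-cong; +-congˡ; +-identityˡ; *-cong; *-congˡ; *-identityˡ; *-identityʳ)
    renaming (_+_ to _⊕_; _*_ to _⊛_; refl to ≈-refl; sym to ≈-sym; trans to ≈-trans; reflexive to ≈-reflexive)
  open RawSemiringDefinitions (Semiring.rawSemiring semiring) using () renaming (_×_ to _·_; _^_ to _^ᴿ_)
  open CommutativeMonoidMult +-commutativeMonoid using (×-distrib-+)
  open SemiringMult semiring using (×-congʳ; ×-congˡ; ×-homo-+; ×-assocˡ; ×-comm-*; ×-assoc-*)
  open SemiringExp semiring using (^-homo-*; ^-assocʳ; ^-congˡ)
  private
    module R∑ = CyclicSum semiring
  open R∑ using (sum; sum-cong-≋; ∑-comm; ∑-distrib-+; *-distribˡ-sum; *-distribʳ-sum)
  open SetoidReasoning setoid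

  ×-distrib-sum : ∀ {m} k (f : Fin m → Carrier) → k · sum f ≈ sum (λ i → k · f i)
  ×-distrib-sum {zero}  zero    f = ≈-refl
  ×-distrib-sum {zero}  (suc k) f = ≈-trans (+-identityˡ _) (×-distrib-sum {zero} k f)
  ×-distrib-sum {suc m} k       f = ≈-trans (×-distrib-+ _ _ k) (+-congˡ (×-distrib-sum k (f ∘ Fin.suc)))

  sum-distrib-× : ∀ {m} (f : Fin m → ℕ) y → ℕ∑.sum f · y ≈ sum (λ i → f i · y)
  sum-distrib-× {zero}  f y = ≈-refl
  sum-distrib-× {suc m} f y = ≈-trans (×-homo-+ y (f Fin.zero) _) (+-congˡ (sum-distrib-× (f ∘ Fin.suc) y))

  -- Unfolds to the same sum as the `sumOver` of the statement, so that `product-expansion` matches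
  -- its right-hand side by computation.
  sumOver : ℕ → ℕ → (ℕ → Carrier) → Carrier
  sumOver a b f = sum {b ∸ a} λ k → f (suc a + toℕ k)

  module _ (x : Carrier) (xⁿ≈1 : x ^ᴿ n ≈ 1#) where

    -- Reducing the exponent first makes periodicity a propositional equality; the relation x^n = 1
    -- is then spent only on additivity.
    power : ℤ → Carrier
    power a = x ^ᴿ toℕ (residue n a)

    1^≈1 : ∀ k → 1# ^ᴿ k ≈ 1#
    1^≈1 zero    = ≈-refl
    1^≈1 (suc k) = ≈-trans (*-identityˡ _) (1^≈1 k)

    ^≈power : ∀ k → x ^ᴿ k ≈ power (+ k)
    ^≈power k = begin
      x ^ᴿ k                                     ≡⟨ cong (x ^ᴿ_) (trans (m≡m%n+[m/n]*n k n) (cong (λ z → k % n + z) (ℕ.*-comm (k / n) n))) ⟩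
      x ^ᴿ (k % n + n * (k / n))                 ≈⟨ ^-homo-* x (k % n) (n * (k / n)) ⟩
      x ^ᴿ (k % n) ⊛ x ^ᴿ (n * (k / n))          ≈⟨ *-congˡ (≈-trans (≈-sym (^-assocʳ x n (k / n))) (≈-trans (^-congˡ (k / n) xⁿ≈1) (1^≈1 (k / n)))) ⟩
      x ^ᴿ (k % n) ⊛ 1#                          ≈⟨ *-identityʳ _ ⟩
      x ^ᴿ (k % n)                               ≡⟨ cong (x ^ᴿ_) (toℕ-fromℕ< (ℤ.n%ℕd<d (+ k) n)) ⟨
      power (+ k)                                ∎

    power-periodic : ∀ a b → a ≡ b [mod n ] → power a ≡ power b
    power-periodic a b a≡b = cong (λ i → x ^ᴿ toℕ i) (toℕ-mod-injective _ _
      (Mod.trans (residue-≡ n a) (Mod.trans a≡b (Mod.sym (residue-≡ n b)))))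

    power-+ : ∀ a b → power a ⊛ power b ≈ power (a ℤ.+ b)
    power-+ a b = begin
      power a ⊛ power b                                    ≈⟨ ^-homo-* x (toℕ (residue n a)) (toℕ (residue n b)) ⟨
      x ^ᴿ (toℕ (residue n a) + toℕ (residue n b))         ≈⟨ ^≈power _ ⟩
      power (+ toℕ (residue n a) ℤ.+ + toℕ (residue n b))  ≡⟨ power-periodic (+ toℕ (residue n a) ℤ.+ + toℕ (residue n b)) (a ℤ.+ b)
                                                               (Mod.+-cong (residue-≡ n a) (residue-≡ n b)) ⟩
      power (a ℤ.+ b)                                      ∎

    combination : (ℤ → ℕ) → Carrier
    combination f = R∑.cyclicSum n λ a → f a · power a

    combination-cong : ∀ {f g : ℤ → ℕ} → (∀ a → f a ≡ g a) → combination f ≈ combination g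
    combination-cong {f} {g} f≡g = R∑.cyclicSum-cong n {λ a → f a · power a} {λ a → g a · power a} λ a → ×-congˡ (f≡g a)

    combination-+ : ∀ f g → combination f ⊕ combination g ≈ combination (λ a → f a + g a)
    combination-+ f g = ≈-trans (≈-sym (∑-distrib-+ {n} (λ k → f (+ toℕ k) · power (+ toℕ k)) (λ k → g (+ toℕ k) · power (+ toℕ k))))
      (R∑.cyclicSum-cong n {λ a → f a · power a ⊕ g a · power a} {λ a → (f a + g a) · power a} λ a → ≈-sym (×-homo-+ (power a) (f a) (g a)))

    combination-× : ∀ k f → k · combination f ≈ combination (λ a → k * f a)
    combination-× k f = ≈-trans (×-distrib-sum {n} k (λ i → f (+ toℕ i) · power (+ toℕ i)))
      (R∑.cyclicSum-cong n {λ a → k · (f a · power a)} {λ a → (k * f a) · power a} λ a → ×-assocˡ (power a) k (f a))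

    combination-sum : ∀ {m} (f : Fin m → ℤ → ℕ) → sum (λ i → combination (f i)) ≈ combination (λ a → ℕ∑.sum λ i → f i a)
    combination-sum {m} f = ≈-trans (∑-comm {m} {n} (λ i k → f i (+ toℕ k) · power (+ toℕ k)))
      (sum-cong-≋ {n} λ k → ≈-sym (sum-distrib-× {m} (λ i → f i (+ toℕ k)) (power (+ toℕ k))))

    -- For fixed u the substitution c = u + v is a translation of ℤ_n. Afterwards h is read at c -
    -- u, possibly outside 0, ..., n - 1, hence its periodicity.
    combination-* : ∀ f h → (∀ a b → a ≡ b [mod n ] → h a ≡ h b) →
                    combination f ⊛ combination h ≈ combination (λ c → ℕ∑.cyclicSum n λ u → f u * h (c ℤ.- u))
    combination-* f h h-periodic = begin
      combination f ⊛ combination h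
        ≈⟨ *-distribʳ-sum {n} (combination h) (λ k → f (+ toℕ k) · power (+ toℕ k)) ⟩
      (R∑.cyclicSum n λ u → (f u · power u) ⊛ combination h)
        ≈⟨ R∑.cyclicSum-cong n (λ u → *-distribˡ-sum {n} (f u · power u) (λ k → h (+ toℕ k) · power (+ toℕ k))) ⟩
      (R∑.cyclicSum n λ u → R∑.cyclicSum n λ v → (f u · power u) ⊛ (h v · power v))
        ≈⟨ R∑.cyclicSum-cong n (λ u → R∑.cyclicSum-cong n (λ v → term u v)) ⟩
      -- u + v is put in the affine form k v + u with k = 1 to suit `cyclicSum-affine`.
      (R∑.cyclicSum n λ u → R∑.cyclicSum n λ v → F u (1ℤ ℤ.* v ℤ.+ u))
        ≈⟨ R∑.cyclicSum-cong n (λ u → R∑.cyclicSum-affine n (F u) {1ℤ} {1ℤ} Mod.refl u (F-periodic u)) ⟩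
      (R∑.cyclicSum n λ u → R∑.cyclicSum n λ c → F u c)
        ≈⟨ ∑-comm {n} {n} (λ u c → F (+ toℕ u) (+ toℕ c)) ⟩
      (R∑.cyclicSum n λ c → R∑.cyclicSum n λ u → F u c)
        ≈⟨ R∑.cyclicSum-cong n (λ c → ≈-sym (sum-distrib-× {n} (λ u → f (+ toℕ u) * h (c ℤ.- + toℕ u)) (power c))) ⟩
      combination (λ c → ℕ∑.cyclicSum n λ u → f u * h (c ℤ.- u)) ∎
      where
      F : ℤ → ℤ → Carrier
      F u c = (f u * h (c ℤ.- u)) · power c
      F-periodic : ∀ u → R∑.Periodic n (F u)
      F-periodic u a b a≡b = ≈-reflexive (cong₂ (λ y z → (f u * y) · z) (h-periodic (a ℤ.- u) (b ℤ.- u) (+ʳ-mod (ℤ.- u) a≡b)) (power-periodic a b a≡b))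
      lemma₁ : ∀ u v → v ≡ 1ℤ ℤ.* v ℤ.+ u ℤ.- u
      lemma₁ = solve-∀
      lemma₂ : ∀ u v → u ℤ.+ v ≡ 1ℤ ℤ.* v ℤ.+ u
      lemma₂ = solve-∀
      term : ∀ u v → (f u · power u) ⊛ (h v · power v) ≈ F u (1ℤ ℤ.* v ℤ.+ u)
      term u v = begin
        (f u · power u) ⊛ (h v · power v)     ≈⟨ ×-assoc-* (f u) (power u) (h v · power v) ⟩
        f u · (power u ⊛ (h v · power v))     ≈⟨ ×-congʳ (f u) (×-comm-* (h v) (power u) (power v)) ⟩
        f u · (h v · (power u ⊛ power v))     ≈⟨ ×-assocˡ _ (f u) (h v) ⟩
        (f u * h v) · (power u ⊛ power v)     ≈⟨ ×-congʳ (f u * h v) (power-+ u v) ⟩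
        (f u * h v) · power (u ℤ.+ v)         ≡⟨ cong₂ (λ y z → (f u * h y) · power z) (lemma₁ u v) (lemma₂ u v) ⟩
        F u (1ℤ ℤ.* v ℤ.+ u)                  ∎

    module _ (χ χ* : ℕ → ℕ → Carrier) (X X* : ℕ → ℕ → ℤ → ℕ)
      (χ≈ : ∀ a b → χ a b ≈ combination (X a b)) (χ*≈ : ∀ a b → χ* a b ≈ combination (X* a b))
      (X*-periodic : ∀ a b u v → u ≡ v [mod n ] → X* a b u ≡ X* a b v) where

      private
        Y : ℕ → ℕ → ℤ → ℕ
        Y a b u = X a b u + X* a b u

        χ+χ*≈ : ∀ a b → χ a b ⊕ χ* a b ≈ combination (Y a b)
        χ+χ*≈ a b = ≈-trans (+-cong (χ≈ a b) (χ*≈ a b)) (combination-+ (X a b) (X* a b))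

        +-≈ : ∀ {y z} f g → y ≈ combination f → z ≈ combination g → y ⊕ z ≈ combination (λ u → f u + g u)
        +-≈ f g y≈ z≈ = ≈-trans (+-cong y≈ z≈) (combination-+ f g)

        ×-≈ : ∀ {y} k f → y ≈ combination f → k · y ≈ combination (λ u → k * f u)
        ×-≈ k f y≈ = ≈-trans (×-congʳ k y≈) (combination-× k f)

        sumOver-≈ : ∀ a b {y : ℕ → Carrier} (f : ℕ → ℤ → ℕ) → (∀ k → y k ≈ combination (f k)) →
                    sumOver a b y ≈ combination (λ u → ℕ-sumOver a b (λ k → f k u))
        sumOver-≈ a b f y≈ = ≈-trans (sum-cong-≋ {b ∸ a} (λ k → y≈ (suc a + toℕ k))) (combination-sum {b ∸ a} (λ k → f (suc a + toℕ k)))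

      -- Only linearity is at work here, so the six scalars stay arbitrary. All arithmetic is left
      -- to the hypothesis, an identity in ℕ for each c.
      product-expansion : ∀ s t i j k₁ k₂ k₃ k₄ k₅ k₆ →
        (∀ c → ℕ∑.cyclicSum n (λ u → X i j u * X* i j (c ℤ.- u)) ≡
          k₁ * Y i j c + k₂ * ℕ-sumOver j t (λ m → Y i m c)
          + k₃ * ℕ-sumOver i (s ∸ 1) (λ k → ℕ-sumOver j t (λ m → Y k m c))
          + k₄ * X s j c + k₅ * ℕ-sumOver j t (λ m → X s m c)
          + k₆ * ℕ-sumOver i (s ∸ 1) (λ k → Y k j c)) →
        χ i j ⊛ χ* i j ≈
          k₁ · (χ i j ⊕ χ* i j) ⊕ k₂ · sumOver j t (λ m → χ i m ⊕ χ* i m)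
          ⊕ k₃ · sumOver i (s ∸ 1) (λ k → sumOver j t (λ m → χ k m ⊕ χ* k m))
          ⊕ k₄ · χ s j ⊕ k₅ · sumOver j t (λ m → χ s m)
          ⊕ k₆ · sumOver i (s ∸ 1) (λ k → χ k j ⊕ χ* k j)
      product-expansion s t i j k₁ k₂ k₃ k₄ k₅ k₆ coefficients = ≈-trans
        (≈-trans (*-cong (χ≈ i j) (χ*≈ i j)) (≈-trans (combination-* (X i j) (X* i j) (X*-periodic i j)) (combination-cong coefficients)))
        (≈-sym (+-≈ (λ u → f₁ u + f₂ u + f₃ u + f₄ u + f₅ u) f₆
          (+-≈ (λ u → f₁ u + f₂ u + f₃ u + f₄ u) f₅
            (+-≈ (λ u → f₁ u + f₂ u + f₃ u) f₄
              (+-≈ (λ u → f₁ u + f₂ u) f₃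
                (+-≈ f₁ f₂
                  (×-≈ k₁ (Y i j) (χ+χ*≈ i j))
                  (×-≈ k₂ (λ u → ℕ-sumOver j t λ m → Y i m u) (sumOver-≈ j t (λ m → Y i m) (λ m → χ+χ*≈ i m))))
                (×-≈ k₃ (λ u → ℕ-sumOver i (s ∸ 1) λ k → ℕ-sumOver j t λ m → Y k m u)
                  (sumOver-≈ i (s ∸ 1) (λ k u → ℕ-sumOver j t λ m → Y k m u) λ k → sumOver-≈ j t (Y k) (χ+χ*≈ k))))
              (×-≈ k₄ (X s j) (χ≈ s j)))
            (×-≈ k₅ (λ u → ℕ-sumOver j t λ m → X s m u) (sumOver-≈ j t (X s) (χ≈ s))))
          (×-≈ k₆ (λ u → ℕ-sumOver i (s ∸ 1) λ k → Y k j u) (sumOver-≈ i (s ∸ 1) (λ k → Y k j) (λ k → χ+χ*≈ k j)))))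
        where
        f₁ f₂ f₃ f₄ f₅ f₆ : ℤ → ℕ
        f₁ u = k₁ * Y i j u
        f₂ u = k₂ * ℕ-sumOver j t (λ m → Y i m u)
        f₃ u = k₃ * ℕ-sumOver i (s ∸ 1) (λ k → ℕ-sumOver j t (λ m → Y k m u))
        f₄ u = k₄ * X s j u
        f₅ u = k₅ * ℕ-sumOver j t (λ m → X s m u)
        f₆ u = k₆ * ℕ-sumOver i (s ∸ 1) (λ k → Y k j u)

-- Indicators, and coset sums as linear combinations of powers of x.

𝟙 : ∀ {P : Set} → Dec P → ℕ
𝟙 P? = if does P? then 1 else 0

module _ {P : Set} (P? : Dec P) where

  𝟙-true : P → 𝟙 P? ≡ 1
  𝟙-true p = cong (if_then 1 else 0) (dec-true P? p)

  𝟙-false : ¬ P → 𝟙 P? ≡ 0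
  𝟙-false ¬p = cong (if_then 1 else 0) (dec-false P? ¬p)

  𝟙-cong : ∀ {Q : Set} (Q? : Dec Q) → (P → Q) → (Q → P) → 𝟙 P? ≡ 𝟙 Q?
  𝟙-cong (yes q) P→Q Q→P = 𝟙-true (Q→P q)
  𝟙-cong (no ¬q) P→Q Q→P = 𝟙-false (¬q ∘ P→Q)

𝟙-× : ∀ {P Q : Set} (P? : Dec P) (Q? : Dec Q) → 𝟙 (P? ×-dec Q?) ≡ 𝟙 P? * 𝟙 Q?
𝟙-× (yes _) (yes _) = refl
𝟙-× (yes _) (no _)  = refl
𝟙-× (no _)  _       = refl

𝟙-idem : ∀ {P : Set} (P? : Dec P) → 𝟙 P? * 𝟙 P? ≡ 𝟙 P?
𝟙-idem (yes _) = refl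
𝟙-idem (no  _) = refl

module CosetSums (l n : ℕ) .{{_ : NonZero n}} where
  open CyclicAlgebra l n hiding (semiring)
  private
    module R = CommutativeRing ring
    module R∑ = CyclicSum R.semiring

    module 𝔽[X] where
      open CommutativeRing (Polynomial.commutativeRing (𝔽 l)) public
      open RawSemiringDefinitions (Semiring.rawSemiring semiring) public using (_^_)

    ^ᴿ≡^ : ∀ k → x ^ᴿ k ≡ x 𝔽[X].^ k
    ^ᴿ≡^ zero    = refl
    ^ᴿ≡^ (suc k) = cong (x 𝔽[X].*_) (^ᴿ≡^ k)

  -- x^n - 1 is a multiple of itself with cofactor 1, once the power taken in the quotient is
  -- identified with the one taken in the polynomial ring.
  xⁿ≈1 : x ^ᴿ n ≈ᴿ R.1#
  xⁿ≈1 = R.trans (R.reflexive (^ᴿ≡^ n)) (Quotient.mod (𝔽[X].1# RawMagma., 𝔽[X].*-identityˡ _))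

  open PowerSums ring n using (combination; ^≈power; product-expansion)

  if-𝟙 : ∀ (b : Bool) y → (if b then y else 0#) ≈ᴿ (if b then 1 else 0) · y
  if-𝟙 true  y = R.sym (R.+-identityʳ y)
  if-𝟙 false y = R.refl

  cosetSum≈combination : ∀ γ X → (∀ k → 𝟙 (inCoset? l n γ k) ≡ X (+ toℕ k)) → cosetSum γ ≈ᴿ combination x xⁿ≈1 X
  cosetSum≈combination γ X indicator≡ = R∑.sum-cong-≋ {n} λ k →
    R.trans (if-𝟙 (does (inCoset? l n γ k)) (x ^ᴿ toℕ k))
      (SemiringMult.×-cong R.semiring (indicator≡ k) (^≈power x xⁿ≈1 (toℕ k)))

open ℕ∑ using
  (sum; sum-cong-≗; ∑-comm; ∑-distrib-+; *-distribˡ-sum; *-distribʳ-sum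
  ; cyclicSum; Periodic; cyclicSum-cong; cyclicSum-affine; cyclicSum-*)

-- Counting residues in ℕ, and the Chinese remainder theorem.

sum-const : ∀ n c → sum {n} (λ _ → c) ≡ n * c
sum-const zero    c = refl
sum-const (suc n) c = cong (λ z → c + z) (sum-const n c)

sum-mono : ∀ {n} {f g : Fin n → ℕ} → (∀ k → f k ≤ g k) → sum f ≤ sum g
sum-mono {zero}  f≤g = z≤n
sum-mono {suc n} f≤g = ℕ.+-mono-≤ (f≤g Fin.zero) (sum-mono (f≤g ∘ Fin.suc))

cyclicSum-+ : ∀ n (f g : ℤ → ℕ) → cyclicSum n (λ a → f a + g a) ≡ cyclicSum n f + cyclicSum n g
cyclicSum-+ n f g = ∑-distrib-+ {n} (λ k → f (+ toℕ k)) (λ k → g (+ toℕ k))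

cyclicSum-const*ˡ : ∀ n c (f : ℤ → ℕ) → cyclicSum n (λ a → c * f a) ≡ c * cyclicSum n f
cyclicSum-const*ˡ n c f = sym (*-distribˡ-sum {n} c (λ k → f (+ toℕ k)))

multiple : ℕ → ℤ → ℕ
multiple m a = 𝟙 (≡[mod]? a 0ℤ m)

multiple-periodic : ∀ m → Periodic m (multiple m)
multiple-periodic m a b a≡b = 𝟙-cong (≡[mod]? a 0ℤ m) (≡[mod]? b 0ℤ m) (Mod.trans (Mod.sym a≡b)) (Mod.trans a≡b)

multiple-self-sum : ∀ m .{{_ : NonZero m}} → cyclicSum m (multiple m) ≡ 1
multiple-self-sum m = trans
  (ℕ∑.cyclicSum-single m (multiple m) λ k k≢0 → 𝟙-false (≡[mod]? (+ toℕ k) 0ℤ m) λ k≡0 → k≢0 (ℤ.+-injective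
    (close⇒≡ (subst (λ z → ℤ.∣ z ∣ < m) (sym (ℤ.+-identityʳ (+ toℕ k))) (toℕ<n k)) k≡0)))
  (𝟙-true (≡[mod]? 0ℤ 0ℤ m) Mod.refl)

multiple-sum : ∀ m n .{{_ : NonZero n}} → cyclicSum (m * n) (multiple n) ≡ m
multiple-sum m n = begin
  cyclicSum (m * n) (multiple n)
    ≡⟨ cyclicSum-* m n (multiple n) ⟩
  (cyclicSum n λ b → cyclicSum m λ a → multiple n (+ n ℤ.* a ℤ.+ b))
    ≡⟨ (cyclicSum-cong n λ b → cyclicSum-cong m λ a → multiple-periodic n (+ n ℤ.* a ℤ.+ b) b (+multiple⇒≡[mod] a (lemma (+ n) a b))) ⟩
  (cyclicSum n λ b → cyclicSum m λ _ → multiple n b)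
    ≡⟨ (cyclicSum-cong n λ b → sum-const m (multiple n b)) ⟩
  (cyclicSum n λ b → m * multiple n b)
    ≡⟨ cyclicSum-const*ˡ n m (multiple n) ⟩
  m * cyclicSum n (multiple n)
    ≡⟨ cong (m *_) (multiple-self-sum n) ⟩
  m * 1
    ≡⟨ ℕ.*-identityʳ m ⟩
  m ∎
  where
  open ≡.≡-Reasoning
  lemma : ∀ n a b → n ℤ.* a ℤ.+ b ≡ b ℤ.+ a ℤ.* n
  lemma = solve-∀

-- Split residues as n a + b: H sees only b, and for each b the map a ↦ n a + b permutes ℤ_m because
-- n is invertible modulo m.
cyclicSum-crt : ∀ m n .{{_ : NonZero m}} {n′ F H} → + n ℤ.* n′ ≡ 1ℤ [mod m ] → Periodic m F → Periodic n H →
                cyclicSum (m * n) (λ a → F a * H a) ≡ cyclicSum m F * cyclicSum n H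
cyclicSum-crt m n {n′} {F} {H} nn′≡1 F-periodic H-periodic = begin
  cyclicSum (m * n) (λ a → F a * H a)
    ≡⟨ cyclicSum-* m n (λ a → F a * H a) ⟩
  (cyclicSum n λ b → cyclicSum m λ a → F (+ n ℤ.* a ℤ.+ b) * H (+ n ℤ.* a ℤ.+ b))
    ≡⟨ (cyclicSum-cong n λ b → cyclicSum-cong m λ a → cong (F (+ n ℤ.* a ℤ.+ b) *_)
         (H-periodic _ b (+multiple⇒≡[mod] a (lemma (+ n) a b)))) ⟩
  (cyclicSum n λ b → cyclicSum m λ a → F (+ n ℤ.* a ℤ.+ b) * H b)
    ≡⟨ (cyclicSum-cong n λ b → *-distribʳ-sum {m} (H b) λ k → F (+ n ℤ.* + toℕ k ℤ.+ b)) ⟨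
  (cyclicSum n λ b → cyclicSum m (λ a → F (+ n ℤ.* a ℤ.+ b)) * H b)
    ≡⟨ (cyclicSum-cong n λ b → cong (_* H b) (cyclicSum-affine m F {+ n} {n′} nn′≡1 b F-periodic)) ⟩
  (cyclicSum n λ b → cyclicSum m F * H b)
    ≡⟨ cyclicSum-const*ˡ n (cyclicSum m F) H ⟩
  cyclicSum m F * cyclicSum n H ∎
  where
  open ≡.≡-Reasoning
  lemma : ∀ n a b → n ℤ.* a ℤ.+ b ≡ b ℤ.+ a ℤ.* n
  lemma = solve-∀

-- With a = b + k m, the congruence modulo n says k m ≡ 0, and the inverse `m′` gives k ≡ 0 mod n.
crt : ∀ m n {m′ a b} → + m ℤ.* m′ ≡ 1ℤ [mod n ] → a ≡ b [mod m ] → a ≡ b [mod n ] → a ≡ b [mod m * n ]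
crt m n {m′} {a} {b} mm′≡1 a≡b a≡b′ with k , refl ← ≡[mod]⇒+multiple a≡b =
  Mod.trans (+ˡ-mod b (Mod.trans (≡⇒≡[mod] (ℤ.*-comm k (+ m))) (scale-mod m k≡0)))
    (≡⇒≡[mod] (trans (cong (λ z → b ℤ.+ z) (ℤ.*-zeroʳ (+ m))) (ℤ.+-identityʳ b)))
  where
  open SetoidReasoning (Mod.setoid {n})
  lemma₁ : ∀ k m m′ b → k ℤ.* (m ℤ.* m′) ≡ (b ℤ.+ k ℤ.* m ℤ.- b) ℤ.* m′
  lemma₁ = solve-∀
  lemma₂ : ∀ b m′ → (b ℤ.- b) ℤ.* m′ ≡ 0ℤ
  lemma₂ = solve-∀
  k≡0 : k ≡ 0ℤ [mod n ]
  k≡0 = begin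
    k                                   ≡⟨ ℤ.*-identityʳ k ⟨
    k ℤ.* 1ℤ                            ≈⟨ *ˡ-mod k mm′≡1 ⟨
    k ℤ.* (+ m ℤ.* m′)                  ≡⟨ lemma₁ k (+ m) m′ b ⟩
    (b ℤ.+ k ℤ.* + m ℤ.- b) ℤ.* m′      ≈⟨ *ʳ-mod m′ (+ʳ-mod (ℤ.- b) a≡b′) ⟩
    (b ℤ.- b) ℤ.* m′                    ≡⟨ lemma₂ b m′ ⟩
    0ℤ ∎

𝟙-sum-≤ : ∀ {n} {Q : Fin n → Set} {R : Set} (Q? : ∀ k → Dec (Q k)) (R? : Dec R) →
          (∀ {i j} → Q i → Q j → i ≡ j) → (∀ {k} → Q k → R) → sum (λ k → 𝟙 (Q? k)) ≤ 𝟙 R?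
𝟙-sum-≤ {zero}  Q? R? unique Q→R = z≤n
𝟙-sum-≤ {suc n} Q? R? unique Q→R with Q? Fin.zero
... | no ¬q = 𝟙-sum-≤ (Q? ∘ Fin.suc) R? (λ q q′ → suc-injective (unique q q′)) Q→R
... | yes q = ℕ.≤-reflexive (begin
  1 + sum (λ k → 𝟙 (Q? (Fin.suc k)))
    ≡⟨ cong suc (sum-cong-≗ {n} λ k → 𝟙-false (Q? (Fin.suc k)) λ q′ → contradiction (unique q q′) λ ()) ⟩
  1 + sum {n} (λ _ → 0)
    ≡⟨ cong suc (trans (sum-const n 0) (ℕ.*-zeroʳ n)) ⟩
  1
    ≡⟨ 𝟙-true R? (Q→R q) ⟨
  𝟙 R? ∎)
  where open ≡.≡-Reasoning

module _ (m : ℕ) .{{_ : NonZero m}} {U : ℤ → Set} (U? : Decidable U)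
         (U-resp : ∀ {a b} → a ≡ b [mod m ] → U a → U b) where

  -- Double counting of the pairs (j , u) with f j ≡ u mod m.
  injection⇒≤count : ∀ {k} (f : Fin k → ℤ) → (∀ i j → f i ≡ f j [mod m ] → i ≡ j) → (∀ j → U (f j)) →
                     k ≤ cyclicSum m λ u → 𝟙 (U? u)
  injection⇒≤count {k} f f-injective f∈U = begin
    k
      ≡⟨ trans (sum-const k 1) (ℕ.*-identityʳ k) ⟨
    sum {k} (λ _ → 1)
      ≡⟨ sum-cong-≗ {k} (λ j → trans (cyclicSum-affine m (multiple m) {1ℤ} {1ℤ} Mod.refl (ℤ.- f j) (multiple-periodic m)) (multiple-self-sum m)) ⟨
    (sum {k} λ j → cyclicSum m λ u → multiple m (1ℤ ℤ.* u ℤ.- f j))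
      ≡⟨ ∑-comm {k} {m} _ ⟩
    (cyclicSum m λ u → sum {k} λ j → multiple m (1ℤ ℤ.* u ℤ.- f j))
      ≤⟨ sum-mono {m} (λ u → 𝟙-sum-≤ (λ j → ≡[mod]? (1ℤ ℤ.* + toℕ u ℤ.- f j) 0ℤ m) (U? (+ toℕ u))
           (λ {i} {j} u≡fi u≡fj → f-injective i j (Mod.trans (zero⇒≡ (+ toℕ u) (f i) u≡fi) (Mod.sym (zero⇒≡ (+ toℕ u) (f j) u≡fj))))
           (λ {j} u≡fj → U-resp (zero⇒≡ (+ toℕ u) (f j) u≡fj) (f∈U j))) ⟩
    (cyclicSum m λ u → 𝟙 (U? u)) ∎
    where
    open ℕ.≤-Reasoning
    lemma₁ : ∀ u a → u ≡ (1ℤ ℤ.* u ℤ.- a) ℤ.+ a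
    lemma₁ = solve-∀
    zero⇒≡ : ∀ u a → 1ℤ ℤ.* u ℤ.- a ≡ 0ℤ [mod m ] → a ≡ u [mod m ]
    zero⇒≡ u a u-a≡0 = Mod.sym (Mod.trans (≡⇒≡[mod] (lemma₁ u a))
      (Mod.trans (+ʳ-mod a u-a≡0) (≡⇒≡[mod] (ℤ.+-identityˡ a))))

  -- Pigeonhole: an element of U missed by the first k values could be put in front of them, giving
  -- k + 1 distinct elements of a set of size k.
  injection⇒surjection : ∀ {k} (f : ℕ → ℤ) → (∀ i j → i < k → j < k → f i ≡ f j [mod m ] → i ≡ j) → (∀ j → U (f j)) →
                         cyclicSum m (λ u → 𝟙 (U? u)) ≡ k → ∀ a → U a → ∃ λ j → f j ≡ a [mod m ]
  injection⇒surjection {k} f f-injective f∈U count a a∈U with ℕ.anyUpTo? (λ j → ≡[mod]? (f j) a m) k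
  ... | yes (j , _ , fj≡a) = j , fj≡a
  ... | no  none           = contradiction
    (subst (suc k ≤_) count (injection⇒≤count f′ f′-injective f′∈U)) ℕ.1+n≰n
    where
    f′ : Fin (suc k) → ℤ
    f′ Fin.zero    = a
    f′ (Fin.suc j) = f (toℕ j)
    f′∈U : ∀ j → U (f′ j)
    f′∈U Fin.zero    = a∈U
    f′∈U (Fin.suc j) = f∈U (toℕ j)
    f′-injective : ∀ i j → f′ i ≡ f′ j [mod m ] → i ≡ j
    f′-injective Fin.zero    Fin.zero    _ = refl
    f′-injective Fin.zero    (Fin.suc j) e = contradiction (toℕ j , toℕ<n j , Mod.sym e) none
    f′-injective (Fin.suc i) Fin.zero    e = contradiction (toℕ i , toℕ<n i , e) none
    f′-injective (Fin.suc i) (Fin.suc j) e =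
      cong Fin.suc (toℕ-injective (f-injective (toℕ i) (toℕ j) (toℕ<n i) (toℕ<n j) e))

-- Euler's function at prime powers.

module _ {p : ℕ} (p-prime : Prime p) where
  private instance
    p≢0 : NonZero p
    p≢0 = prime⇒nonZero p-prime

  prime≢1 : p ≢ 1
  prime≢1 refl with () ← prime⇒nonTrivial p-prime

  prime≥2 : 2 ≤ p
  prime≥2 = nonTrivial⇒n>1 p {{prime⇒nonTrivial p-prime}}

  ∤⇒coprime-^ : ∀ {a} → p ∤ a → ∀ k → Coprime a (p ^ k)
  ∤⇒coprime-^ p∤a zero    (_ , d∣1)       = ℕ∣.∣1⇒≡1 d∣1
  ∤⇒coprime-^ {a} p∤a (suc k) {d} (d∣a , d∣p*pᵏ) =
    ∤⇒coprime-^ p∤a k (d∣a , coprime-divisor {d} {p} d-p-coprime d∣p*pᵏ)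
    where
    d-p-coprime : Coprime d p
    d-p-coprime (e∣d , e∣p) with prime⇒irreducible p-prime e∣p
    ... | inj₁ e≡1  = e≡1
    ... | inj₂ refl = contradiction (ℕ∣.∣-trans e∣d d∣a) p∤a

  -- Being coprime to a positive power of p and being a multiple of p are complementary, so the two
  -- indicators add up to 1. The additive form avoids truncated subtraction.
  φ-^ : ∀ k → φ (p ^ suc k) + p ^ k ≡ p ^ suc k
  φ-^ k = begin
    φ M + p ^ k
      -- `φ` filters 1, ..., M while `cyclicSum` runs over 0, ..., M - 1; the multiples of p are
      -- shifted by 1 so that the sums can be merged.
      ≡⟨ cong₂ _+_ (trans (cong (length ∘ filter (λ a → coprime? a M)) (map-applyUpTo id suc M)) (length-filter M suc))
           (trans (sym (trans (cong (λ z → cyclicSum z (multiple p)) (ℕ.*-comm p (p ^ k))) (multiple-sum (p ^ k) p)))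
             (sym (cyclicSum-affine M {{ℕ.m^n≢0 p (suc k)}} (multiple p) {1ℤ} {1ℤ} Mod.refl 1ℤ multiple-M-periodic))) ⟩
    sum {M} (λ j → 𝟙 (coprime? (suc (toℕ j)) M)) + cyclicSum M (λ a → multiple p (1ℤ ℤ.* a ℤ.+ 1ℤ))
      ≡⟨ ∑-distrib-+ {M} _ _ ⟨
    sum {M} (λ j → 𝟙 (coprime? (suc (toℕ j)) M) + multiple p (1ℤ ℤ.* + toℕ j ℤ.+ 1ℤ))
      ≡⟨ sum-cong-≗ {M} (λ j → trans (cong (λ z → 𝟙 (coprime? (suc (toℕ j)) M) + multiple p z) (lemma (toℕ j)))
           (complementary (suc (toℕ j)))) ⟩
    sum {M} (λ _ → 1)
      ≡⟨ trans (sum-const M 1) (ℕ.*-identityʳ M) ⟩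
    M ∎
    where
    open ≡.≡-Reasoning
    M = p ^ suc k
    multiple-M-periodic : Periodic M (multiple p)
    multiple-M-periodic a b a≡b = multiple-periodic p a b
      (mod-* {p ^ k} (subst (λ z → a ≡ b [mod z ]) (ℕ.*-comm p (p ^ k)) a≡b))
    length-filter : ∀ n (f : ℕ → ℕ) → length (filter (λ a → coprime? a M) (applyUpTo f n))
                                    ≡ sum {n} (λ j → 𝟙 (coprime? (f (toℕ j)) M))
    length-filter zero    f = refl
    length-filter (suc n) f with does (coprime? (f 0) M)
    ... | true  = cong suc (length-filter n (f ∘ suc))
    ... | false = length-filter n (f ∘ suc)
    lemma : ∀ j → 1ℤ ℤ.* + j ℤ.+ 1ℤ ≡ + suc j
    lemma j = trans (cong (λ z → z ℤ.+ 1ℤ) (ℤ.*-identityˡ (+ j))) (cong +_ (ℕ.+-comm j 1))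
    complementary : ∀ a → 𝟙 (coprime? a M) + multiple p (+ a) ≡ 1
    complementary a with ≡[mod]? (+ a) 0ℤ p
    ... | yes p∣a = cong₂ _+_
      (𝟙-false (coprime? a M) λ a⊥M → prime≢1 (a⊥M (proj₁ ≡0-mod⇔∣ p∣a , ℕ∣.m∣m*n (p ^ k))))
      (𝟙-true (≡[mod]? (+ a) 0ℤ p) p∣a)
    ... | no  p∤a = cong₂ _+_
      (𝟙-true (coprime? a M) (∤⇒coprime-^ (p∤a ∘ proj₂ ≡0-mod⇔∣) (suc k)))
      (𝟙-false (≡[mod]? (+ a) 0ℤ p) p∤a)

-- Multiplicative orders.

^-periodic : ∀ {m k d} → k ℤ.^ d ≡ 1ℤ [mod m ] → ∀ c → k ℤ.^ (d * c) ≡ 1ℤ [mod m ]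
^-periodic {m} {k} {d} kᵈ≡1 c = begin
  k ℤ.^ (d * c)      ≡⟨ ℤ.^-*-assoc k d c ⟨
  (k ℤ.^ d) ℤ.^ c    ≈⟨ ^-mod c kᵈ≡1 ⟩
  1ℤ ℤ.^ c           ≡⟨ ℤ.^-zeroˡ c ⟩
  1ℤ                 ∎
  where open SetoidReasoning (Mod.setoid {m})

module _ {m k d} (order : HasOrder m k d) where
  open HasOrder order

  private
    instance
      d≢0 : NonZero d
      d≢0 = >-nonZero positive

    -- k^(d - i) inverts k^i, so the two powers would differ by a factor k^(j - i) = 1 with 0 < j -
    -- i < d, against minimality.
    ^-injective-< : ∀ {i j} → i < j → j < d → ¬ k ℤ.^ i ≡ k ℤ.^ j [mod m ]
    ^-injective-< {i} {j} i<j j<d kⁱ≡kʲ =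
      contradiction (ℕ.≤-trans (minimal (j ∸ i) (ℕ.m<n⇒0<n∸m i<j) kʲ⁻ⁱ≡1) (ℕ.m∸n≤m j i)) (ℕ.<⇒≱ j<d)
      where
      open SetoidReasoning (Mod.setoid {m})
      d-i = d ∸ i
      j-i = j ∸ i
      kᵈ⁻ⁱkⁱ≡1 : k ℤ.^ d-i ℤ.* k ℤ.^ i ≡ 1ℤ [mod m ]
      kᵈ⁻ⁱkⁱ≡1 = Mod.trans (≡⇒≡[mod] (trans (sym (ℤ.^-distribˡ-+-* k d-i i))
        (cong (λ e → k ℤ.^ e) (ℕ.m∸n+n≡m (ℕ.<⇒≤ (ℕ.<-trans i<j j<d)))))) power≡1
      kʲ⁻ⁱ≡1 : k ℤ.^ j-i ≡ 1ℤ [mod m ]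
      kʲ⁻ⁱ≡1 = begin
        k ℤ.^ j-i
          ≡⟨ ℤ.*-identityˡ _ ⟨
        1ℤ ℤ.* k ℤ.^ j-i
          ≈⟨ *ʳ-mod (k ℤ.^ j-i) kᵈ⁻ⁱkⁱ≡1 ⟨
        k ℤ.^ d-i ℤ.* k ℤ.^ i ℤ.* k ℤ.^ j-i
          ≡⟨ ℤ.*-assoc (k ℤ.^ d-i) (k ℤ.^ i) (k ℤ.^ j-i) ⟩
        k ℤ.^ d-i ℤ.* (k ℤ.^ i ℤ.* k ℤ.^ j-i)
          ≡⟨ cong (λ z → k ℤ.^ d-i ℤ.* z) (trans (sym (ℤ.^-distribˡ-+-* k i j-i))
               (cong (λ e → k ℤ.^ e) (ℕ.m+[n∸m]≡n (ℕ.<⇒≤ i<j)))) ⟩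
        k ℤ.^ d-i ℤ.* k ℤ.^ j
          ≈⟨ *ˡ-mod (k ℤ.^ d-i) kⁱ≡kʲ ⟨
        k ℤ.^ d-i ℤ.* k ℤ.^ i
          ≈⟨ kᵈ⁻ⁱkⁱ≡1 ⟩
        1ℤ ∎

  ^-injective : ∀ i j → i < d → j < d → k ℤ.^ i ≡ k ℤ.^ j [mod m ] → i ≡ j
  ^-injective i j i<d j<d kⁱ≡kʲ with ℕ.<-cmp i j
  ... | tri< i<j _ _ = contradiction kⁱ≡kʲ (^-injective-< i<j j<d)
  ... | tri≈ _ i≡j _ = i≡j
  ... | tri> _ _ j<i = contradiction (Mod.sym kⁱ≡kʲ) (^-injective-< j<i i<d)

  order-∣ : ∀ e → k ℤ.^ e ≡ 1ℤ [mod m ] → d ∣ e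
  order-∣ e kᵉ≡1 with e % d ℕ.≟ 0
  ... | yes e%d≡0 = divides (e / d) (trans (m≡m%n+[m/n]*n e d) (cong (_+ (e / d) * d) e%d≡0))
  ... | no  e%d≢0 = contradiction (minimal (e % d) (ℕ.n≢0⇒n>0 e%d≢0) (begin
      k ℤ.^ (e % d)
        ≡⟨ ℤ.*-identityʳ _ ⟨
      k ℤ.^ (e % d) ℤ.* 1ℤ
        ≈⟨ *ˡ-mod (k ℤ.^ (e % d)) (^-periodic {m} {k} {d} power≡1 (e / d)) ⟨
      k ℤ.^ (e % d) ℤ.* k ℤ.^ (d * (e / d))
        ≡⟨ ℤ.^-distribˡ-+-* k (e % d) (d * (e / d)) ⟨
      k ℤ.^ (e % d + d * (e / d))
        ≡⟨ cong (λ z → k ℤ.^ (e % d + z)) (ℕ.*-comm d (e / d)) ⟩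
      k ℤ.^ (e % d + e / d * d)
        ≡⟨ cong (λ z → k ℤ.^ z) (m≡m%n+[m/n]*n e d) ⟨
      k ℤ.^ e
        ≈⟨ kᵉ≡1 ⟩
      1ℤ ∎)) (ℕ.<⇒≱ (m%n<n e d))
    where
    open SetoidReasoning (Mod.setoid {m})

-- Exponents are natural, so (d - 1) r plays the part of - r. Having the inverse among the powers of
-- k keeps it usable inside cosets.
power-inverse : ∀ {m k d} → HasOrder m k d → ∀ r → k ℤ.^ r ℤ.* k ℤ.^ ((d ∸ 1) * r) ≡ 1ℤ [mod m ]
power-inverse {m} {k} {d} order r = begin
  k ℤ.^ r ℤ.* k ℤ.^ ((d ∸ 1) * r)    ≡⟨ ℤ.^-distribˡ-+-* k r ((d ∸ 1) * r) ⟨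
  k ℤ.^ (suc (d ∸ 1) * r)            ≡⟨ cong (λ z → k ℤ.^ (z * r)) (ℕ.m+[n∸m]≡n (HasOrder.positive order)) ⟩
  k ℤ.^ (d * r)                      ≈⟨ ^-periodic {m} {k} {d} (HasOrder.power≡1 order) r ⟩
  1ℤ                                 ∎
  where open SetoidReasoning (Mod.setoid {m})

^-neg : ∀ k r → (ℤ.- k) ℤ.^ r ≡ k ℤ.^ r ⊎ (ℤ.- k) ℤ.^ r ≡ ℤ.- (k ℤ.^ r)
^-neg k zero    = inj₁ refl
^-neg k (suc r) with ^-neg k r
... | inj₁ e = inj₂ (trans (cong (λ z → ℤ.- k ℤ.* z) e) (sym (ℤ.neg-distribˡ-* k (k ℤ.^ r))))
... | inj₂ e = inj₁ (trans (cong (λ z → ℤ.- k ℤ.* z) e) (lemma k (k ℤ.^ r)))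
  where
  lemma : ∀ a b → ℤ.- a ℤ.* ℤ.- b ≡ a ℤ.* b
  lemma = solve-∀

^-neg-even : ∀ k r → (ℤ.- k) ℤ.^ (2 * r) ≡ k ℤ.^ (2 * r)
^-neg-even k r = trans (sym (ℤ.^-*-assoc (ℤ.- k) 2 r)) (trans (cong (λ z → z ℤ.^ r) (lemma k)) (ℤ.^-*-assoc k 2 r))
  where
  lemma : ∀ a → ℤ.- a ℤ.* (ℤ.- a ℤ.* 1ℤ) ≡ a ℤ.* (a ℤ.* 1ℤ)
  lemma = solve-∀

^-neg-odd : ∀ k r → (ℤ.- k) ℤ.^ suc (2 * r) ≡ ℤ.- (k ℤ.^ suc (2 * r))
^-neg-odd k r = trans (cong (λ z → ℤ.- k ℤ.* z) (^-neg-even k r)) (sym (ℤ.neg-distribˡ-* k (k ℤ.^ (2 * r))))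

-- From (- k)^e = 1 follows k^(2e) = 1, so the odd order h divides 2e and hence e. The case e = h is
-- excluded because (- k)^h = - 1.
order-neg : ∀ {m k r} → ¬ 1ℤ ≡ -1ℤ [mod m ] → HasOrder m k (suc (2 * r)) → HasOrder m (ℤ.- k) (2 * suc (2 * r))
order-neg {m} {k} {r} 1≢-1 order = record
  { positive = s≤s z≤n
  ; power≡1  = Mod.trans (≡⇒≡[mod] (^-neg-even k h)) (≡.subst (λ e → k ℤ.^ e ≡ 1ℤ [mod m ]) (ℕ.*-comm h 2) (^-periodic {m} {k} {h} power≡1 2))
  ; minimal  = λ e 0<e e≡1 → minimal-neg e 0<e e≡1 (coprime-divisor {h} {2} {e} h⊥2 (order-∣ order (2 * e)
      (Mod.trans (≡⇒≡[mod] (sym (^-neg-even k e)))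
        (subst (λ z → (ℤ.- k) ℤ.^ z ≡ 1ℤ [mod m ]) (ℕ.*-comm e 2) (^-periodic {m} {ℤ.- k} {e} e≡1 2)))))
  }
  where
  h = suc (2 * r)
  open HasOrder order
  h⊥2 : Coprime h 2
  h⊥2 {d} (d∣h , d∣2) = ℕ∣.∣1⇒≡1 (ℕ∣.∣m+n∣m⇒∣n (subst (d ∣_) (ℕ.+-comm 1 (2 * r)) d∣h) (ℕ∣.∣-trans d∣2 (ℕ∣.m∣m*n r)))
  minimal-neg : ∀ e → 0 < e → (ℤ.- k) ℤ.^ e ≡ 1ℤ [mod m ] → h ∣ e → 2 * h ≤ e
  minimal-neg _ () e≡1 (divides 0 refl)
  minimal-neg _ _  e≡1 (divides 1 refl) = contradiction (Mod.trans (Mod.sym e≡1) (Mod.trans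
    (≡⇒≡[mod] (trans (cong (λ z → (ℤ.- k) ℤ.^ z) (ℕ.+-identityʳ h)) (^-neg-odd k r))) (-mod power≡1))) 1≢-1
  minimal-neg _ _  e≡1 (divides (suc (suc c)) refl) = ℕ.*-monoˡ-≤ h (s≤s (s≤s (z≤n {c})))

-- Units and exact p-adic valuations.

^-mod-≤ : ∀ {p a b x y} → a ≤ b → x ≡ y [mod p ^ b ] → x ≡ y [mod p ^ a ]
^-mod-≤ {p} {a} {b} {x} {y} a≤b x≡y = mod-* {p ^ (b ∸ a)} (subst (λ m → x ≡ y [mod m ])
  (trans (cong (p ^_) (sym (ℕ.m∸n+n≡m a≤b))) (ℕ.^-distribˡ-+-* p (b ∸ a) a)) x≡y)

^-mod-base : ∀ {p} s {x y} → x ≡ y [mod p ^ suc s ] → x ≡ y [mod p ]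
^-mod-base {p} s {x} {y} x≡y = mod-* {p ^ s} (subst (λ m → x ≡ y [mod m ]) (ℕ.*-comm p (p ^ s)) x≡y)

-- Stated modulo p, which decides invertibility modulo every power of p.
Unit : ℕ → ℤ → Set
Unit p a = ¬ a ≡ 0ℤ [mod p ]

Exact : ℕ → ℕ → ℤ → Set
Exact p a u = u ≡ 0ℤ [mod p ^ a ] × ¬ u ≡ 0ℤ [mod p ^ suc a ]

module _ {p : ℕ} (p-prime : Prime p) where
  private instance
    p≢0 : NonZero p
    p≢0 = prime⇒nonZero p-prime

  1-unit : Unit p 1ℤ
  1-unit p∣1 = prime≢1 p-prime (ℕ∣.∣1⇒≡1 (proj₁ ≡0-mod⇔∣ p∣1))

  private
    abs-∣ : ∀ {a} → a ≡ 0ℤ [mod p ] → p ∣ ℤ.∣ a ∣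
    abs-∣ {a} (Quotient.mod (k RawMagma., e)) = subst (p ∣_) (cong ℤ.∣_∣ (ℤ.+-identityʳ a)) (Signed.∣⇒∣ᵤ (Signed.divides k (sym e)))

    ∣-abs : ∀ {a} → p ∣ ℤ.∣ a ∣ → a ≡ 0ℤ [mod p ]
    ∣-abs {a} p∣a with Signed.divides k e ← Signed.∣ᵤ⇒∣ {+ p} {a} p∣a = +multiple⇒≡[mod] k (trans e (sym (ℤ.+-identityˡ _)))

  *-unit : ∀ {a b} → Unit p a → Unit p b → Unit p (a ℤ.* b)
  *-unit {a} {b} a-unit b-unit ab≡0 with euclidsLemma ℤ.∣ a ∣ ℤ.∣ b ∣ p-prime (subst (p ∣_) (ℤ.abs-* a b) (abs-∣ ab≡0))
  ... | inj₁ p∣a = a-unit (∣-abs p∣a)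
  ... | inj₂ p∣b = b-unit (∣-abs p∣b)

  ^-unit : ∀ {a} → Unit p a → ∀ r → Unit p (a ℤ.^ r)
  ^-unit {a} a-unit zero    = 1-unit
  ^-unit {a} a-unit (suc r) = *-unit {a} {a ℤ.^ r} a-unit (^-unit {a} a-unit r)

  module _ {s : ℕ} where

    order⇒unit : ∀ {k d} → HasOrder (p ^ suc s) k d → Unit p k
    order⇒unit {k} {zero}  order _   with () ← HasOrder.positive order
    order⇒unit {k} {suc d} order k≡0 = 1-unit (Mod.trans
      (Mod.sym (^-mod-base s (HasOrder.power≡1 order)))
      (Mod.trans (*ʳ-mod (k ℤ.^ d) k≡0) (≡⇒≡[mod] (ℤ.*-zeroˡ (k ℤ.^ d)))))

    unit-count : cyclicSum (p ^ suc s) (λ u → 𝟙 (¬? (≡[mod]? u 0ℤ p))) ≡ φ (p ^ suc s)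
    unit-count = ℕ.+-cancelʳ-≡ (p ^ s) _ _ (begin
      cyclicSum M (λ u → 𝟙 (¬? (≡[mod]? u 0ℤ p))) + p ^ s
        ≡⟨ cong (λ z → cyclicSum M (λ u → 𝟙 (¬? (≡[mod]? u 0ℤ p))) + z)
             (trans (cong (λ z → cyclicSum z (multiple p)) (ℕ.*-comm p (p ^ s))) (multiple-sum (p ^ s) p)) ⟨
      cyclicSum M (λ u → 𝟙 (¬? (≡[mod]? u 0ℤ p))) + cyclicSum M (multiple p)
        ≡⟨ cyclicSum-+ M (λ u → 𝟙 (¬? (≡[mod]? u 0ℤ p))) (multiple p) ⟨
      cyclicSum M (λ u → 𝟙 (¬? (≡[mod]? u 0ℤ p)) + multiple p u)
        ≡⟨ cyclicSum-cong M (λ u → complementary (≡[mod]? u 0ℤ p)) ⟩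
      cyclicSum M (λ _ → 1)
        ≡⟨ trans (sum-const M 1) (ℕ.*-identityʳ M) ⟩
      M
        ≡⟨ φ-^ p-prime s ⟨
      φ M + p ^ s ∎)
      where
      open ≡.≡-Reasoning
      M = p ^ suc s
      complementary : ∀ {Q : Set} (Q? : Dec Q) → 𝟙 (¬? Q?) + 𝟙 Q? ≡ 1
      complementary (yes _) = refl
      complementary (no  _) = refl

  -- The order is a separate d, equal to φ only by a proof, because at p it is given as 2 * h.
  module PrimitiveRoot {s κ d} (d≡φ : d ≡ φ (p ^ suc s)) (κ-primitive : HasOrder (p ^ suc s) κ d) where
    private
      M = p ^ suc s
      instance
        M≢0 : NonZero M
        M≢0 = ℕ.m^n≢0 p (suc s)

    -- The powers of κ below its order are distinct units, as many as there are units at all.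
    generates : ∀ a → Unit p a → ∃ λ r → κ ℤ.^ r ≡ a [mod M ]
    generates = injection⇒surjection M {Unit p} (λ u → ¬? (≡[mod]? u 0ℤ p))
      (λ {a} {b} a≡b a-unit b≡0 → a-unit (Mod.trans (^-mod-base s a≡b) b≡0))
      {d} (λ r → κ ℤ.^ r) (^-injective κ-primitive) (^-unit {κ} (order⇒unit {s} {κ} κ-primitive)) (trans (unit-count {s}) (sym d≡φ))

    unit-inverse : ∀ {a} → Unit p a → ∃ λ a′ → a ℤ.* a′ ≡ 1ℤ [mod M ]
    unit-inverse {a} a-unit = κ ℤ.^ ((d ∸ 1) * r) ,
      Mod.trans (*ʳ-mod (κ ℤ.^ ((d ∸ 1) * r)) (Mod.sym (proj₂ (generates a a-unit)))) (power-inverse {M} {κ} {d} κ-primitive r)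
      where r = proj₁ (generates a a-unit)

    inverse-unit : ∀ {a a′} → a ℤ.* a′ ≡ 1ℤ [mod M ] → Unit p a′
    inverse-unit {a} {a′} aa′≡1 a′≡0 = 1-unit (Mod.trans (Mod.sym (^-mod-base s aa′≡1))
      (Mod.trans (*ˡ-mod a a′≡0) (≡⇒≡[mod] (ℤ.*-zeroʳ a))))

    unit⇒coset : ∀ {w v} → Unit p w → Unit p v → ∃ λ r → w ℤ.* κ ℤ.^ r ≡ v [mod M ]
    unit⇒coset {w} {v} w-unit v-unit = proj₁ generated , (begin
      w ℤ.* κ ℤ.^ proj₁ generated    ≈⟨ *ˡ-mod w (proj₂ generated) ⟩
      w ℤ.* (v ℤ.* w′)               ≡⟨ lemma w v w′ ⟩
      v ℤ.* (w ℤ.* w′)               ≈⟨ *ˡ-mod v ww′≡1 ⟩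
      v ℤ.* 1ℤ                       ≡⟨ ℤ.*-identityʳ v ⟩
      v                              ∎)
      where
      open SetoidReasoning (Mod.setoid {M})
      w′ : ℤ
      w′ = proj₁ (unit-inverse w-unit)
      ww′≡1 : w ℤ.* w′ ≡ 1ℤ [mod M ]
      ww′≡1 = proj₂ (unit-inverse w-unit)
      generated : ∃ λ r → κ ℤ.^ r ≡ v ℤ.* w′ [mod M ]
      generated = generates (v ℤ.* w′) (*-unit {v} {w′} v-unit (inverse-unit {w} {w′} ww′≡1))
      lemma : ∀ w v w′ → w ℤ.* (v ℤ.* w′) ≡ v ℤ.* (w ℤ.* w′)
      lemma = solve-∀

    -- u is p^a times a unit v, and the quotient of the units v and w is a power of κ.
    exact⇒coset : ∀ a {w u} → Unit p w → Exact p a u → ∃ λ r → + (p ^ a) ℤ.* w ℤ.* κ ℤ.^ r ≡ u [mod M ]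
    exact⇒coset a {w} {u} w-unit (pᵃ∣u , pᵃ⁺¹∤u) = r , (begin
      + (p ^ a) ℤ.* w ℤ.* κ ℤ.^ r      ≡⟨ ℤ.*-assoc (+ (p ^ a)) w (κ ℤ.^ r) ⟩
      + (p ^ a) ℤ.* (w ℤ.* κ ℤ.^ r)    ≈⟨ *ˡ-mod (+ (p ^ a)) (proj₂ (unit⇒coset {w} {v} w-unit v-unit)) ⟩
      + (p ^ a) ℤ.* v                  ≡⟨ u≡pᵃv ⟨
      u                                ∎)
      where
      open SetoidReasoning (Mod.setoid {M})
      v : ℤ
      v = proj₁ (≡0⇒multiple pᵃ∣u)
      u≡pᵃv : u ≡ + (p ^ a) ℤ.* v
      u≡pᵃv = proj₂ (≡0⇒multiple pᵃ∣u)
      v-unit : Unit p v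
      v-unit v≡0 = pᵃ⁺¹∤u (subst (λ m → u ≡ 0ℤ [mod m ]) (ℕ.*-comm (p ^ a) p)
        (Mod.trans (≡⇒≡[mod] u≡pᵃv) (Mod.trans (scale-mod (p ^ a) v≡0) (≡⇒≡[mod] (ℤ.*-zeroʳ (+ (p ^ a)))))))
      r : ℕ
      r = proj₁ (unit⇒coset {w} {v} w-unit v-unit)

  -- Since a < s, the congruence may be read modulo p^(a+1), where cancelling p^a leaves a product
  -- of units.
  coset⇒exact : ∀ {s a w k r u} → a < s → Unit p w → Unit p k →
                + (p ^ a) ℤ.* w ℤ.* k ℤ.^ r ≡ u [mod p ^ s ] → Exact p a u
  coset⇒exact {s} {a} {w} {k} {r} {u} a<s w-unit k-unit e =
    Mod.trans (Mod.sym (^-mod-≤ {p} {a} {s} (ℕ.<⇒≤ a<s) e))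
      (Mod.trans (≡⇒≡[mod] (ℤ.*-assoc (+ (p ^ a)) w (k ℤ.^ r))) (multiple≡0 (w ℤ.* k ℤ.^ r))) ,
    λ u≡0 → *-unit {w} {k ℤ.^ r} w-unit (^-unit {k} k-unit r) (unscale-mod (p ^ a) {{ℕ.m^n≢0 p a}}
      (subst (λ m → + (p ^ a) ℤ.* (w ℤ.* k ℤ.^ r) ≡ + (p ^ a) ℤ.* 0ℤ [mod m ]) (ℕ.*-comm p (p ^ a))
        (Mod.trans (≡⇒≡[mod] (sym (ℤ.*-assoc (+ (p ^ a)) w (k ℤ.^ r))))
          (Mod.trans (^-mod-≤ {p} {suc a} {s} a<s e) (Mod.trans u≡0 (≡⇒≡[mod] (sym (ℤ.*-zeroʳ (+ (p ^ a))))))))))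

-- Representations of c as a sum of two elements of a valuation layer.

cyclicSum-0 : ∀ n {f : ℤ → ℕ} → (∀ a → f a ≡ 0) → cyclicSum n f ≡ 0
cyclicSum-0 n f≡0 = trans (cyclicSum-cong n f≡0) (trans (sum-const n 0) (ℕ.*-zeroʳ n))

≡0-diff : ∀ {m} c u → c ≡ 0ℤ [mod m ] → c ℤ.- u ≡ ℤ.- u [mod m ]
≡0-diff c u c≡0 = Mod.trans (+ʳ-mod (ℤ.- u) c≡0) (≡⇒≡[mod] (ℤ.+-identityˡ (ℤ.- u)))

≡0-sum : ∀ {m} c u → u ≡ 0ℤ [mod m ] → c ℤ.- u ≡ 0ℤ [mod m ] → c ≡ 0ℤ [mod m ]
≡0-sum {m} c u u≡0 c-u≡0 = Mod.trans (≡⇒≡[mod] (lemma c u)) (Mod.+-cong {x = c ℤ.- u} c-u≡0 u≡0)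
  where
  lemma : ∀ c u → c ≡ (c ℤ.- u) ℤ.+ u
  lemma = solve-∀

≡0-neg : ∀ {m} u → ℤ.- u ≡ 0ℤ [mod m ] → u ≡ 0ℤ [mod m ]
≡0-neg u -u≡0 = Mod.trans (≡⇒≡[mod] (sym (ℤ.neg-involutive u))) (-mod -u≡0)

-- In the applications r is a prime, d the power of r defining the layer and e the number of
-- multiples of r d modulo M. V is known only through its two implications, so a coset or a union of
-- two half layers can take its place. Writing r = 2 + k lets r - 1 and r - 2 appear without
-- subtraction.
module ExactPairs {M e r d k : ℕ} .{{_ : NonZero M}} .{{_ : NonZero d}} (M≡erd : M ≡ e * (r * d)) (r≡2+k : r ≡ 2 + k)
  {V : ℤ → Set} (V? : ∀ u → Dec (V u))
  (V⇒ : ∀ {u} → V u → u ≡ 0ℤ [mod d ] × ¬ u ≡ 0ℤ [mod r * d ])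
  (⇒V : ∀ {u} → u ≡ 0ℤ [mod d ] → ¬ u ≡ 0ℤ [mod r * d ] → V u)
  where

  private
    d′ : ℕ
    d′ = r * d

    J : ℤ → ℕ
    J u = 𝟙 (V? u)

    d′⇒d : ∀ {a b} → a ≡ b [mod d′ ] → a ≡ b [mod d ]
    d′⇒d = mod-* {r}

    M⇒d′ : ∀ {a b} → a ≡ b [mod M ] → a ≡ b [mod d′ ]
    M⇒d′ {a} {b} a≡b = mod-* {e} (subst (λ m → a ≡ b [mod m ]) M≡erd a≡b)

    J-periodic : ∀ {a b} → a ≡ b [mod d′ ] → J a ≡ J b
    J-periodic {a} {b} a≡b = 𝟙-cong (V? a) (V? b) (resp a≡b) (resp (Mod.sym a≡b))
      where
      resp : ∀ {a b} → a ≡ b [mod d′ ] → V a → V b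
      resp a≡b a∈V = ⇒V (Mod.trans (Mod.sym (d′⇒d a≡b)) (proj₁ (V⇒ a∈V)))
        λ b≡0 → proj₂ (V⇒ a∈V) (Mod.trans a≡b b≡0)

    instance
      d′≢0 : NonZero d′
      d′≢0 = ℕ.m*n≢0 r d {{subst NonZero (sym r≡2+k) _}}

    sum-d : cyclicSum M (multiple d) ≡ e * r
    sum-d = trans (cong (λ m → cyclicSum m (multiple d)) (trans M≡erd (sym (ℕ.*-assoc e r d)))) (multiple-sum (e * r) d)

    sum-d′ : cyclicSum M (multiple d′) ≡ e
    sum-d′ = trans (cong (λ m → cyclicSum m (multiple d′)) M≡erd) (multiple-sum e d′)

  exact-split : ∀ u → J u + multiple d′ u ≡ multiple d u
  exact-split u = go (≡[mod]? u 0ℤ d) (≡[mod]? u 0ℤ d′)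
    where
    go : Dec (u ≡ 0ℤ [mod d ]) → Dec (u ≡ 0ℤ [mod d′ ]) → J u + multiple d′ u ≡ multiple d u
    go (yes d∣u) (yes d′∣u) = trans (cong₂ _+_ (𝟙-false (V? u) λ u∈V → proj₂ (V⇒ u∈V) d′∣u)
      (𝟙-true (≡[mod]? u 0ℤ d′) d′∣u)) (sym (𝟙-true (≡[mod]? u 0ℤ d) d∣u))
    go (yes d∣u) (no  d′∤u) = trans (cong₂ _+_ (𝟙-true (V? u) (⇒V d∣u d′∤u))
      (𝟙-false (≡[mod]? u 0ℤ d′) d′∤u)) (sym (𝟙-true (≡[mod]? u 0ℤ d) d∣u))
    go (no  d∤u) _          = trans (cong₂ _+_ (𝟙-false (V? u) (d∤u ∘ proj₁ ∘ V⇒))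
      (𝟙-false (≡[mod]? u 0ℤ d′) (d∤u ∘ d′⇒d))) (sym (𝟙-false (≡[mod]? u 0ℤ d) d∤u))

  exact-count : cyclicSum M J ≡ e * suc k
  exact-count = ℕ.+-cancelʳ-≡ e _ _ (begin
    cyclicSum M J + e                           ≡⟨ cong (λ z → cyclicSum M J + z) sum-d′ ⟨
    cyclicSum M J + cyclicSum M (multiple d′)   ≡⟨ cyclicSum-+ M J (multiple d′) ⟨
    cyclicSum M (λ u → J u + multiple d′ u)     ≡⟨ cyclicSum-cong M exact-split ⟩
    cyclicSum M (multiple d)                    ≡⟨ sum-d ⟩
    e * r                                       ≡⟨ trans (cong (λ z → e * z) r≡2+k) (lemma e k) ⟩
    e * suc k + e                               ∎)
    where
    open ≡.≡-Reasoning
    lemma : ∀ e k → e * suc (suc k) ≡ e * suc k + e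
    lemma = ℕ-Solver.solve-∀

  pairs : ℤ → ℕ
  pairs c = cyclicSum M λ u → J u * J (c ℤ.- u)

  private
    -- Inclusion-exclusion over the e r multiples u of d: for e of them r d divides u, for e others
    -- it divides c - u. It cannot divide both, or it would divide c, so e r - 2e = k e remain.
    pairs-exact : ∀ {c} → V c → pairs c ≡ k * e
    pairs-exact {c} c∈V = ℕ.+-cancelʳ-≡ (e + e) _ _ (begin
      pairs c + (e + e)
        ≡⟨ cong (λ z → pairs c + z) (cong₂ _+_ sum-d′ shifted) ⟨
      pairs c + (cyclicSum M (multiple d′) + cyclicSum M (λ u → multiple d′ (c ℤ.- u)))
        ≡⟨ cong (λ z → pairs c + z) (cyclicSum-+ M (multiple d′) (λ u → multiple d′ (c ℤ.- u))) ⟨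
      pairs c + cyclicSum M (λ u → multiple d′ u + multiple d′ (c ℤ.- u))
        ≡⟨ cyclicSum-+ M (λ u → J u * J (c ℤ.- u)) (λ u → multiple d′ u + multiple d′ (c ℤ.- u)) ⟨
      cyclicSum M (λ u → J u * J (c ℤ.- u) + (multiple d′ u + multiple d′ (c ℤ.- u)))
        ≡⟨ cyclicSum-cong M (λ u → pointwise u (≡[mod]? u 0ℤ d) (≡[mod]? u 0ℤ d′) (≡[mod]? (c ℤ.- u) 0ℤ d′)) ⟩
      cyclicSum M (multiple d)
        ≡⟨ sum-d ⟩
      e * r
        ≡⟨ trans (cong (λ z → e * z) r≡2+k) (lemma e k) ⟩
      k * e + (e + e) ∎)
      where
      open ≡.≡-Reasoning
      lemma : ∀ e k → e * suc (suc k) ≡ k * e + (e + e)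
      lemma = ℕ-Solver.solve-∀
      lemma₁ : ∀ c u → c ℤ.- u ≡ -1ℤ ℤ.* u ℤ.+ c
      lemma₁ = solve-∀
      shifted : cyclicSum M (λ u → multiple d′ (c ℤ.- u)) ≡ e
      shifted = begin
        cyclicSum M (λ u → multiple d′ (c ℤ.- u))
          ≡⟨ cyclicSum-cong M (λ u → cong (multiple d′) (lemma₁ c u)) ⟩
        cyclicSum M (λ u → multiple d′ (-1ℤ ℤ.* u ℤ.+ c))
          ≡⟨ cyclicSum-affine M (multiple d′) { -1ℤ} { -1ℤ} Mod.refl c (λ a b a≡b → multiple-periodic d′ a b (M⇒d′ a≡b)) ⟩
        cyclicSum M (multiple d′)
          ≡⟨ sum-d′ ⟩
        e ∎
      d∣c : c ≡ 0ℤ [mod d ]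
      d∣c = proj₁ (V⇒ c∈V)
      d∣c-u : ∀ u → u ≡ 0ℤ [mod d ] → c ℤ.- u ≡ 0ℤ [mod d ]
      d∣c-u u d∣u = Mod.trans (≡0-diff c u d∣c) (-mod d∣u)
      pointwise : ∀ u → Dec (u ≡ 0ℤ [mod d ]) → Dec (u ≡ 0ℤ [mod d′ ]) → Dec (c ℤ.- u ≡ 0ℤ [mod d′ ]) →
                  J u * J (c ℤ.- u) + (multiple d′ u + multiple d′ (c ℤ.- u)) ≡ multiple d u
      pointwise u (yes d∣u) (yes d′∣u) (yes d′∣c-u) = contradiction (≡0-sum c u d′∣u d′∣c-u) (proj₂ (V⇒ c∈V))
      pointwise u (yes d∣u) (yes d′∣u) (no  d′∤c-u) = trans (cong₂ _+_ (cong (λ z → z * J (c ℤ.- u)) (𝟙-false (V? u) λ u∈V → proj₂ (V⇒ u∈V) d′∣u))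
        (cong₂ _+_ (𝟙-true (≡[mod]? u 0ℤ d′) d′∣u) (𝟙-false (≡[mod]? (c ℤ.- u) 0ℤ d′) d′∤c-u))) (sym (𝟙-true (≡[mod]? u 0ℤ d) d∣u))
      pointwise u (yes d∣u) (no  d′∤u) (yes d′∣c-u) = trans (cong₂ _+_ (trans (cong (λ z → J u * z) (𝟙-false (V? (c ℤ.- u)) λ u∈V → proj₂ (V⇒ u∈V) d′∣c-u)) (ℕ.*-zeroʳ (J u)))
        (cong₂ _+_ (𝟙-false (≡[mod]? u 0ℤ d′) d′∤u) (𝟙-true (≡[mod]? (c ℤ.- u) 0ℤ d′) d′∣c-u))) (sym (𝟙-true (≡[mod]? u 0ℤ d) d∣u))
      pointwise u (yes d∣u) (no  d′∤u) (no  d′∤c-u) = trans (cong₂ _+_ (cong₂ _*_ (𝟙-true (V? u) (⇒V d∣u d′∤u)) (𝟙-true (V? (c ℤ.- u)) (⇒V (d∣c-u u d∣u) d′∤c-u)))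
        (cong₂ _+_ (𝟙-false (≡[mod]? u 0ℤ d′) d′∤u) (𝟙-false (≡[mod]? (c ℤ.- u) 0ℤ d′) d′∤c-u))) (sym (𝟙-true (≡[mod]? u 0ℤ d) d∣u))
      pointwise u (no  d∤u) _ _ = trans (cong₂ _+_ (cong (λ z → z * J (c ℤ.- u)) (𝟙-false (V? u) (d∤u ∘ proj₁ ∘ V⇒)))
        (cong₂ _+_ (𝟙-false (≡[mod]? u 0ℤ d′) (d∤u ∘ d′⇒d))
          (𝟙-false (≡[mod]? (c ℤ.- u) 0ℤ d′) (λ d′∣c-u → d∤u (≡0-neg u (Mod.trans (Mod.sym (≡0-diff c u d∣c)) (d′⇒d d′∣c-u)))))))
        (sym (𝟙-false (≡[mod]? u 0ℤ d) d∤u))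

    -- Here c - u ≡ - u modulo r d and V is closed under negation, so every u in V contributes.
    pairs-multiple : ∀ {c} → c ≡ 0ℤ [mod d′ ] → pairs c ≡ e * suc k
    pairs-multiple {c} d′∣c = trans (cyclicSum-cong M λ u → trans (cong (λ z → J u * z) (trans (J-periodic (≡0-diff c u d′∣c)) (J-neg u))) (𝟙-idem (V? u))) exact-count
      where
      V-neg : ∀ {u} → V u → V (ℤ.- u)
      V-neg {u} u∈V = ⇒V (-mod (proj₁ (V⇒ u∈V))) λ -u≡0 → proj₂ (V⇒ u∈V) (≡0-neg u -u≡0)
      J-neg : ∀ u → J (ℤ.- u) ≡ J u
      J-neg u = 𝟙-cong (V? (ℤ.- u)) (V? u) (λ v → subst V (ℤ.neg-involutive u) (V-neg v)) V-neg

    pairs-otherwise : ∀ {c} → ¬ c ≡ 0ℤ [mod d ] → pairs c ≡ 0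
    pairs-otherwise {c} d∤c = cyclicSum-0 M λ u → go u (V? u) (V? (c ℤ.- u))
      where
      go : ∀ u (v : Dec (V u)) (v′ : Dec (V (c ℤ.- u))) → 𝟙 v * 𝟙 v′ ≡ 0
      go u (yes v) (yes v′) = contradiction (≡0-sum c u (proj₁ (V⇒ v)) (proj₁ (V⇒ v′))) d∤c
      go u (yes v) (no  _)  = refl
      go u (no  _) _        = refl

  pairs-count : ∀ c → pairs c ≡ k * e * J c + e * suc k * multiple d′ c
  pairs-count c = go (V? c) (≡[mod]? c 0ℤ d′)
    where
    conclude : ∀ {x a b} → x ≡ k * e * a + e * suc k * b → J c ≡ a → multiple d′ c ≡ b →
               x ≡ k * e * J c + e * suc k * multiple d′ c
    conclude eq refl refl = eq
    lemma₁ : ∀ x y → x ≡ x * 1 + y * 0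
    lemma₁ = ℕ-Solver.solve-∀
    lemma₂ : ∀ x y → y ≡ x * 0 + y * 1
    lemma₂ = ℕ-Solver.solve-∀
    lemma₃ : ∀ x y → 0 ≡ x * 0 + y * 0
    lemma₃ = ℕ-Solver.solve-∀
    go : Dec (V c) → Dec (c ≡ 0ℤ [mod d′ ]) → pairs c ≡ k * e * J c + e * suc k * multiple d′ c
    go (yes v) _ = conclude (trans (pairs-exact v) (lemma₁ (k * e) (e * suc k))) (𝟙-true (V? c) v)
      (𝟙-false (≡[mod]? c 0ℤ d′) (proj₂ (V⇒ v)))
    go (no ¬v) (yes d′∣c) = conclude (trans (pairs-multiple d′∣c) (lemma₂ (k * e) (e * suc k))) (𝟙-false (V? c) ¬v)
      (𝟙-true (≡[mod]? c 0ℤ d′) d′∣c)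
    go (no ¬v) (no  d′∤c) = conclude (trans (pairs-otherwise (λ d∣c → ¬v (⇒V d∣c d′∤c))) (lemma₃ (k * e) (e * suc k)))
      (𝟙-false (V? c) ¬v) (𝟙-false (≡[mod]? c 0ℤ d′) d′∤c)

-- The layer d ∣ u, p d ∤ u of ℤ_{e p d} is split by P into two halves
-- exchanged by negation.  The number of representations of c as
-- a sum of one element of each half is constant on the layer, and the
-- constant is found by counting all pairs.
module HalfPairs {M e p d w : ℕ} .{{_ : NonZero M}} .{{_ : NonZero d}} .{{_ : NonZero e}} (M≡epd : M ≡ e * (p * d)) (p≡3+4w : p ≡ 3 + 4 * w)
  {P : ℤ → Set} (P? : ∀ u → Dec (P u))
  (P-resp : ∀ {a b} → a ≡ b [mod p * d ] → P a → P b)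
  (P⇒ : ∀ {u} → P u ⊎ P (ℤ.- u) → u ≡ 0ℤ [mod d ] × ¬ u ≡ 0ℤ [mod p * d ])
  (⇒P : ∀ {u} → u ≡ 0ℤ [mod d ] → ¬ u ≡ 0ℤ [mod p * d ] → P u ⊎ P (ℤ.- u))
  (disjoint : ∀ {u} → P u → ¬ P (ℤ.- u))
  {γ : ℤ}
  (transitive : ∀ {u} → P u → ∃₂ λ k k′ → k ℤ.* k′ ≡ 1ℤ [mod M ] × k ℤ.* γ ≡ u [mod M ] ×
                (∀ v → P v → P (k ℤ.* v)) × (∀ v → P (k ℤ.* v) → P v))
  where

  private
    d′ : ℕ
    d′ = p * d

    I : ℤ → ℕ
    I u = 𝟙 (P? u)

    I-periodic : ∀ {a b} → a ≡ b [mod d′ ] → I a ≡ I b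
    I-periodic {a} {b} a≡b = 𝟙-cong (P? a) (P? b) (P-resp a≡b) (P-resp (Mod.sym a≡b))

    I-M-periodic : Periodic M I
    I-M-periodic a b a≡b = I-periodic (mod-* {e} (subst (λ m → a ≡ b [mod m ]) M≡epd a≡b))

    -- Here r = p and k = 1 + 4w.
    module Layer = ExactPairs {e = e} M≡epd p≡3+4w {λ u → P u ⊎ P (ℤ.- u)} (λ u → P? u ⊎-dec P? (ℤ.- u)) P⇒ ⇒P

    layer : ∀ u → 𝟙 (P? u ⊎-dec P? (ℤ.- u)) ≡ I u + I (ℤ.- u)
    layer u = go (P? u) (P? (ℤ.- u))
      where
      go : (a : Dec (P u)) (b : Dec (P (ℤ.- u))) → 𝟙 (a ⊎-dec b) ≡ 𝟙 a + 𝟙 b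
      go (yes a) (yes b) = contradiction b (disjoint a)
      go (yes a) (no  _) = refl
      go (no  _) (yes b) = refl
      go (no  _) (no  _) = refl

  half-split : ∀ u → (I u + I (ℤ.- u)) + multiple d′ u ≡ multiple d u
  half-split u = trans (cong (λ z → z + multiple d′ u) (sym (layer u))) (Layer.exact-split u)

  private
    reflect : ∀ c → cyclicSum M (λ u → I (ℤ.- (u ℤ.- c))) ≡ cyclicSum M I
    reflect c = trans (cyclicSum-cong M (λ u → cong I (lemma u c))) (cyclicSum-affine M I { -1ℤ} { -1ℤ} Mod.refl c I-M-periodic)
      where
      lemma : ∀ u c → ℤ.- (u ℤ.- c) ≡ -1ℤ ℤ.* u ℤ.+ c
      lemma = solve-∀

    layer-count : cyclicSum M (λ u → I u + I (ℤ.- u)) ≡ cyclicSum M I + cyclicSum M I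
    layer-count = trans (cyclicSum-+ M I (λ u → I (ℤ.- u))) (cong (λ z → cyclicSum M I + z)
      (trans (cyclicSum-cong M (λ u → cong (λ z → I (ℤ.- z)) (sym (ℤ.+-identityʳ u)))) (reflect 0ℤ)))

  half-count : cyclicSum M I ≡ (1 + 2 * w) * e
  half-count = ℕ.*-cancelˡ-≡ _ _ 2 (begin
    2 * cyclicSum M I                      ≡⟨ cong (λ z → cyclicSum M I + z) (ℕ.+-identityʳ _) ⟩
    cyclicSum M I + cyclicSum M I          ≡⟨ layer-count ⟨
    cyclicSum M (λ u → I u + I (ℤ.- u))    ≡⟨ cyclicSum-cong M layer ⟨
    cyclicSum M (λ u → 𝟙 (P? u ⊎-dec P? (ℤ.- u))) ≡⟨ Layer.exact-count ⟩
    e * (2 + 4 * w)                        ≡⟨ lemma e w ⟩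
    2 * ((1 + 2 * w) * e)                  ∎)
    where
    open ≡.≡-Reasoning
    lemma : ∀ e w → e * (2 + 4 * w) ≡ 2 * ((1 + 2 * w) * e)
    lemma = ℕ-Solver.solve-∀

  -- The minus sign selects the opposite half: c is written as an element of P plus the negative of
  -- an element of P.
  pairs : ℤ → ℕ
  pairs c = cyclicSum M λ u → I u * I (ℤ.- (c ℤ.- u))

  private
    summand-periodic : ∀ c → Periodic M (λ u → I u * I (ℤ.- (c ℤ.- u)))
    summand-periodic c a b a≡b = cong₂ _*_ (I-M-periodic a b a≡b) (I-M-periodic _ _ (-mod (+ˡ-mod c (-mod a≡b))))

    pairs-periodic : ∀ {c c′} → c ≡ c′ [mod M ] → pairs c ≡ pairs c′
    pairs-periodic c≡c′ = cyclicSum-cong M λ u → cong (λ z → I u * z) (I-M-periodic _ _ (-mod (+ʳ-mod (ℤ.- u) c≡c′)))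

    -- u ↦ k u permutes ℤ_M and k c - k u = k (c - u), so representations of c and of k c
    -- correspond.
    pairs-scale : ∀ c k k′ → k ℤ.* k′ ≡ 1ℤ [mod M ] → (∀ v → P v → P (k ℤ.* v)) → (∀ v → P (k ℤ.* v) → P v) →
                  pairs (k ℤ.* c) ≡ pairs c
    pairs-scale c k k′ kk′≡1 P⇒kP kP⇒P = begin
      pairs (k ℤ.* c)
        ≡⟨ cyclicSum-affine M (λ u → I u * I (ℤ.- (k ℤ.* c ℤ.- u))) {k} {k′} kk′≡1 0ℤ (summand-periodic (k ℤ.* c)) ⟨
      cyclicSum M (λ u → I (k ℤ.* u ℤ.+ 0ℤ) * I (ℤ.- (k ℤ.* c ℤ.- (k ℤ.* u ℤ.+ 0ℤ))))
        ≡⟨ cyclicSum-cong M (λ u → cong₂ _*_ (trans (cong I (ℤ.+-identityʳ (k ℤ.* u))) (I-scale u))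
             (trans (cong I (lemma k c u)) (I-scale (ℤ.- (c ℤ.- u))))) ⟩
      pairs c ∎
      where
      open ≡.≡-Reasoning
      I-scale : ∀ v → I (k ℤ.* v) ≡ I v
      I-scale v = 𝟙-cong (P? (k ℤ.* v)) (P? v) (kP⇒P v) (P⇒kP v)
      lemma : ∀ k c u → ℤ.- (k ℤ.* c ℤ.- (k ℤ.* u ℤ.+ 0ℤ)) ≡ k ℤ.* ℤ.- (c ℤ.- u)
      lemma = solve-∀

    -- If c = u + v with u and - v in P, then - c = (- v) + (- u) has the same shape. This makes the
    -- counts on the two halves equal.
    pairs-neg : ∀ c → pairs (ℤ.- c) ≡ pairs c
    pairs-neg c = begin
      pairs (ℤ.- c)
        ≡⟨ cyclicSum-affine M (λ u → I u * I (ℤ.- (ℤ.- c ℤ.- u))) {1ℤ} {1ℤ} Mod.refl (ℤ.- c) (summand-periodic (ℤ.- c)) ⟨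
      cyclicSum M (λ u → I (1ℤ ℤ.* u ℤ.+ ℤ.- c) * I (ℤ.- (ℤ.- c ℤ.- (1ℤ ℤ.* u ℤ.+ ℤ.- c))))
        ≡⟨ cyclicSum-cong M (λ u → trans (cong₂ _*_ (cong I (lemma₁ c u)) (cong I (lemma₂ c u))) (ℕ.*-comm (I (ℤ.- (c ℤ.- u))) (I u))) ⟩
      pairs c ∎
      where
      open ≡.≡-Reasoning
      lemma₁ : ∀ c u → 1ℤ ℤ.* u ℤ.+ ℤ.- c ≡ ℤ.- (c ℤ.- u)
      lemma₁ = solve-∀
      lemma₂ : ∀ c u → ℤ.- (ℤ.- c ℤ.- (1ℤ ℤ.* u ℤ.+ ℤ.- c)) ≡ u
      lemma₂ = solve-∀

    pairs-half : ∀ {c} → P c → pairs c ≡ pairs γ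
    pairs-half c∈P with k , k′ , kk′≡1 , kγ≡c , P⇒kP , kP⇒P ← transitive c∈P =
      trans (pairs-periodic (Mod.sym kγ≡c)) (pairs-scale γ k k′ kk′≡1 P⇒kP kP⇒P)

    pairs-multiple : ∀ {c} → c ≡ 0ℤ [mod d′ ] → pairs c ≡ cyclicSum M I
    pairs-multiple {c} d′∣c = cyclicSum-cong M λ u →
      trans (cong (λ z → I u * z) (I-periodic (Mod.trans (-mod (≡0-diff c u d′∣c)) (≡⇒≡[mod] (ℤ.neg-involutive u))))) (𝟙-idem (P? u))

    pairs-otherwise : ∀ {c} → ¬ c ≡ 0ℤ [mod d ] → pairs c ≡ 0
    pairs-otherwise {c} d∤c = cyclicSum-0 M λ u → go u (P? u) (P? (ℤ.- (c ℤ.- u)))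
      where
      go : ∀ u (a : Dec (P u)) (b : Dec (P (ℤ.- (c ℤ.- u)))) → 𝟙 a * 𝟙 b ≡ 0
      go u (yes a) (yes b) = contradiction (≡0-sum c u (proj₁ (P⇒ (inj₁ a))) (proj₁ (P⇒ (inj₂ b)))) d∤c
      go u (yes _) (no  _) = refl
      go u (no  _) _       = refl

    pairs-by-layer : ∀ c → pairs c ≡ pairs γ * (I c + I (ℤ.- c)) + cyclicSum M I * multiple d′ c
    pairs-by-layer c = go (P? c) (P? (ℤ.- c)) (≡[mod]? c 0ℤ d′)
      where
      N H : ℕ
      N = pairs γ
      H = cyclicSum M I
      conclude : ∀ {x a a′ b} → x ≡ N * (a + a′) + H * b → I c ≡ a → I (ℤ.- c) ≡ a′ → multiple d′ c ≡ b →
                 x ≡ N * (I c + I (ℤ.- c)) + H * multiple d′ c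
      conclude eq refl refl refl = eq
      lemma₁ : ∀ x y → x ≡ x * 1 + y * 0
      lemma₁ = ℕ-Solver.solve-∀
      lemma₂ : ∀ x y → y ≡ x * 0 + y * 1
      lemma₂ = ℕ-Solver.solve-∀
      lemma₃ : ∀ x y → 0 ≡ x * 0 + y * 0
      lemma₃ = ℕ-Solver.solve-∀
      go : Dec (P c) → Dec (P (ℤ.- c)) → Dec (c ≡ 0ℤ [mod d′ ]) → pairs c ≡ N * (I c + I (ℤ.- c)) + H * multiple d′ c
      go (yes a) _ _ = conclude {a = 1} {0} (trans (pairs-half a) (lemma₁ N H)) (𝟙-true (P? c) a) (𝟙-false (P? (ℤ.- c)) (disjoint a))
        (𝟙-false (≡[mod]? c 0ℤ d′) (proj₂ (P⇒ (inj₁ a))))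
      go (no ¬a) (yes b) _ = conclude {a = 0} {1} (trans (sym (pairs-neg c)) (trans (pairs-half b) (lemma₁ N H))) (𝟙-false (P? c) ¬a) (𝟙-true (P? (ℤ.- c)) b)
        (𝟙-false (≡[mod]? c 0ℤ d′) (proj₂ (P⇒ (inj₂ b))))
      go (no ¬a) (no ¬b) (yes d′∣c) = conclude {a = 0} {0} (trans (pairs-multiple d′∣c) (lemma₂ N H)) (𝟙-false (P? c) ¬a) (𝟙-false (P? (ℤ.- c)) ¬b)
        (𝟙-true (≡[mod]? c 0ℤ d′) d′∣c)
      go (no ¬a) (no ¬b) (no  d′∤c) = conclude {a = 0} {0} (trans (pairs-otherwise (λ d∣c → [ ¬a , ¬b ]′ (⇒P d∣c d′∤c))) (lemma₃ N H))
        (𝟙-false (P? c) ¬a) (𝟙-false (P? (ℤ.- c)) ¬b) (𝟙-false (≡[mod]? c 0ℤ d′) d′∤c)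

    all-pairs : cyclicSum M pairs ≡ cyclicSum M I * cyclicSum M I
    all-pairs = begin
      cyclicSum M pairs
        ≡⟨ ∑-comm {M} {M} (λ c u → I (+ toℕ u) * I (ℤ.- (+ toℕ c ℤ.- + toℕ u))) ⟩
      (cyclicSum M λ u → cyclicSum M λ c → I u * I (ℤ.- (c ℤ.- u)))
        ≡⟨ cyclicSum-cong M (λ u → trans (cyclicSum-const*ˡ M (I u) (λ c → I (ℤ.- (c ℤ.- u)))) (trans (cong (λ z → I u * z) (reflect u)) (ℕ.*-comm (I u) _))) ⟩
      (cyclicSum M λ u → cyclicSum M I * I u)
        ≡⟨ cyclicSum-const*ˡ M (cyclicSum M I) I ⟩
      cyclicSum M I * cyclicSum M I ∎
      where open ≡.≡-Reasoning

    -- The sum of all counts is H². By layers it is N times the 2H residues of the layer plus H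
    -- times the e multiples of p d. Cancelling H gives 2N + e = (1 + 2w) e.
    pairs-γ : pairs γ ≡ w * e
    pairs-γ = ℕ.*-cancelˡ-≡ _ _ 2 (ℕ.+-cancelʳ-≡ e _ _ (ℕ.*-cancelˡ-≡ _ _ H {{H≢0}} (begin
      H * (2 * N + e)
        ≡⟨ lemma₁ H N e ⟩
      N * (H + H) + H * e
        ≡⟨ cong₂ (λ x y → N * x + H * y) layer-count (trans (cong (λ m → cyclicSum m (multiple d′)) M≡epd) (multiple-sum e d′ {{d′≢0}})) ⟨
      N * cyclicSum M (λ c → I c + I (ℤ.- c)) + H * cyclicSum M (multiple d′)
        ≡⟨ cong₂ _+_ (cyclicSum-const*ˡ M N (λ c → I c + I (ℤ.- c))) (cyclicSum-const*ˡ M H (multiple d′)) ⟨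
      cyclicSum M (λ c → N * (I c + I (ℤ.- c))) + cyclicSum M (λ c → H * multiple d′ c)
        ≡⟨ cyclicSum-+ M (λ c → N * (I c + I (ℤ.- c))) (λ c → H * multiple d′ c) ⟨
      cyclicSum M (λ c → N * (I c + I (ℤ.- c)) + H * multiple d′ c)
        ≡⟨ cyclicSum-cong M pairs-by-layer ⟨
      cyclicSum M pairs
        ≡⟨ all-pairs ⟩
      H * H
        ≡⟨ cong (λ z → H * z) half-count ⟩
      H * ((1 + 2 * w) * e)
        ≡⟨ cong (λ z → H * z) (lemma₂ w e) ⟩
      H * (2 * (w * e) + e) ∎)))
      where
      open ≡.≡-Reasoning
      N H : ℕ
      N = pairs γ
      H = cyclicSum M I
      d′≢0 : NonZero d′
      d′≢0 = ℕ.m*n≢0 p d {{subst NonZero (sym p≡3+4w) _}}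
      H≢0 : NonZero H
      H≢0 = subst NonZero (sym half-count) (ℕ.m*n≢0 (1 + 2 * w) e)
      lemma₁ : ∀ H N e → H * (2 * N + e) ≡ N * (H + H) + H * e
      lemma₁ = ℕ-Solver.solve-∀
      lemma₂ : ∀ w e → (1 + 2 * w) * e ≡ 2 * (w * e) + e
      lemma₂ = ℕ-Solver.solve-∀

  pairs-count : ∀ c → pairs c ≡ w * e * (I c + I (ℤ.- c)) + (1 + 2 * w) * e * multiple d′ c
  pairs-count c = trans (pairs-by-layer c) (cong₂ (λ x y → x * (I c + I (ℤ.- c)) + y * multiple d′ c) pairs-γ half-count)

-- `InCoset` with an integer in place of a `Fin`, so that negatives and differences can be tested
-- for membership.
Coset : ℤ → ℕ → ℤ → ℤ → Set
Coset k m γ u = ∃ λ r → γ ℤ.* k ℤ.^ r ≡ u [mod m ]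

Coset-resp : ∀ k {m} γ {a b} → a ≡ b [mod m ] → Coset k m γ a → Coset k m γ b
Coset-resp k γ a≡b (r , e) = r , Mod.trans e a≡b

coset? : ∀ l m .{{_ : NonZero m}} γ u → Dec (Coset (+ l) m γ u)
coset? l m γ u = map′ (Coset-resp (+ l) γ (residue-≡ m u)) (Coset-resp (+ l) γ (Mod.sym (residue-≡ m u)))
  (inCoset? l m γ (residue m u))

-- Half of φ(p^e) when p ≡ 3 mod 4.

odd-^ : ∀ {p x} → p ≡ suc (2 * x) → ∀ k → ∃ λ y → p ^ k ≡ suc (2 * y)
odd-^ refl zero = 0 , refl
odd-^ {p} {x} refl (suc k) with y , e ← odd-^ {p} {x} refl k =
  x + y + 2 * (x * y) , trans (cong (λ z → p * z) e) (lemma x y)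
  where
  lemma : ∀ x y → suc (2 * x) * suc (2 * y) ≡ suc (2 * (x + y + 2 * (x * y)))
  lemma = ℕ-Solver.solve-∀

module _ {p w : ℕ} (p-prime : Prime p) (p≡3+4w : p ≡ 3 + 4 * w) where

  φ-half : ∀ e → φ (p ^ suc e) / 2 ≡ (1 + 2 * w) * p ^ e
  φ-half e = trans (cong (_/ 2) φ≡) (m*n/n≡m ((1 + 2 * w) * p ^ e) 2)
    where
    lemma : ∀ w x → (3 + 4 * w) * x ≡ (1 + 2 * w) * x * 2 + x
    lemma = ℕ-Solver.solve-∀
    φ≡ : φ (p ^ suc e) ≡ (1 + 2 * w) * p ^ e * 2
    φ≡ = ℕ.+-cancelʳ-≡ (p ^ e) _ _ (trans (φ-^ p-prime e)
      (trans (cong (λ z → z * p ^ e) p≡3+4w) (lemma w (p ^ e))))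

  -- (p - 1)/2 = 1 + 2w is odd by the residue of p modulo 4, and so is every power of p.
  φ-half-odd : ∀ e → ∃ λ r → φ (p ^ suc e) / 2 ≡ suc (2 * r)
  φ-half-odd e = w + y + 2 * (w * y) ,
    trans (φ-half e) (trans (cong (λ z → (1 + 2 * w) * z) (proj₂ p^e-odd)) (lemma₂ w y))
    where
    lemma₁ : ∀ w → 3 + 4 * w ≡ suc (2 * (1 + 2 * w))
    lemma₁ = ℕ-Solver.solve-∀
    lemma₂ : ∀ x y → (1 + 2 * x) * suc (2 * y) ≡ suc (2 * (x + y + 2 * (x * y)))
    lemma₂ = ℕ-Solver.solve-∀
    p^e-odd : ∃ λ y → p ^ e ≡ suc (2 * y)
    p^e-odd = odd-^ {p} {1 + 2 * w} (trans p≡3+4w (lemma₁ w)) e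
    y = proj₁ p^e-odd

  φ-double : ∀ e → 2 * (φ (p ^ suc e) / 2) ≡ φ (p ^ suc e)
  φ-double e = trans (cong (λ z → 2 * z) (φ-half e)) (ℕ.+-cancelʳ-≡ (p ^ e) _ _
    (trans (lemma w (p ^ e)) (sym (trans (φ-^ p-prime e) (cong (λ z → z * p ^ e) p≡3+4w)))))
    where
    lemma : ∀ w x → 2 * ((1 + 2 * w) * x) + x ≡ (3 + 4 * w) * x
    lemma = ℕ-Solver.solve-∀

-- The p-component: l of odd order h.

module HalfOrder {p w s h r : ℕ} {l : ℤ} (p-prime : Prime p) (p≡3+4w : p ≡ 3 + 4 * w)
  (2h≡φ : 2 * h ≡ φ (p ^ suc s)) (h≡1+2r : h ≡ suc (2 * r)) (order : HasOrder (p ^ suc s) l h) where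

  private
    M : ℕ
    M = p ^ suc s

    instance
      p≢0 : NonZero p
      p≢0 = prime⇒nonZero p-prime

    lʰ≡1 : l ℤ.^ h ≡ 1ℤ [mod M ]
    lʰ≡1 = HasOrder.power≡1 order

  1≢-1 : ¬ 1ℤ ≡ -1ℤ [mod p ]
  1≢-1 1≡-1 = contradiction (ℕ∣.∣⇒≤ (proj₁ (≡0-mod⇔∣ {p} {2}) (+ˡ-mod 1ℤ 1≡-1))) (ℕ.<⇒≱ (subst (2 <_) (sym p≡3+4w) (s≤s (s≤s (s≤s z≤n)))))

  -l-order : HasOrder M (ℤ.- l) (2 * h)
  -l-order = subst (λ h → HasOrder M (ℤ.- l) (2 * h)) (sym h≡1+2r)
    (order-neg {M} {l} {r} (λ 1≡-1 → 1≢-1 (^-mod-base s 1≡-1)) (subst (HasOrder M l) h≡1+2r order))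

  module Primitive = PrimitiveRoot p-prime {s} { ℤ.- l} {2 * h} 2h≡φ -l-order

  l-unit : Unit p l
  l-unit = order⇒unit p-prime {s} {l} {h} order

  -- Raised to the power h, both powers of l become 1 while the sign survives, h being odd. That
  -- this happens modulo p itself serves every layer at once.
  l-opposite-powers : ∀ a b → ¬ l ℤ.^ a ≡ ℤ.- (l ℤ.^ b) [mod p ]
  l-opposite-powers a b lᵃ≡-lᵇ = 1≢-1 (begin
    1ℤ                        ≈⟨ power-h a ⟨
    (l ℤ.^ a) ℤ.^ h           ≈⟨ ^-mod h lᵃ≡-lᵇ ⟩
    (ℤ.- (l ℤ.^ b)) ℤ.^ h     ≡⟨ trans (cong (λ h → (ℤ.- (l ℤ.^ b)) ℤ.^ h) h≡1+2r)
                                   (trans (^-neg-odd (l ℤ.^ b) r) (cong (λ h → ℤ.- ((l ℤ.^ b) ℤ.^ h)) (sym h≡1+2r))) ⟩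
    ℤ.- ((l ℤ.^ b) ℤ.^ h)     ≈⟨ -mod (power-h b) ⟩
    -1ℤ                       ∎)
    where
    open SetoidReasoning (Mod.setoid {p})
    power-h : ∀ a → (l ℤ.^ a) ℤ.^ h ≡ 1ℤ [mod p ]
    power-h a = Mod.trans (≡⇒≡[mod] (trans (ℤ.^-*-assoc l a h) (cong (λ e → l ℤ.^ e) (ℕ.*-comm a h))))
      (^-mod-base s (^-periodic {M} {l} {h} lʰ≡1 a))

  ±-power : ∀ v → Unit p v → ∃ λ k → l ℤ.^ k ≡ v [mod M ] ⊎ ℤ.- (l ℤ.^ k) ≡ v [mod M ]
  ±-power v v-unit = proj₁ power , [ (λ e → inj₁ (Mod.trans (≡⇒≡[mod] (sym e)) (proj₂ power))) ,
    (λ e → inj₂ (Mod.trans (≡⇒≡[mod] (sym e)) (proj₂ power))) ]′ (^-neg l (proj₁ power))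
    where
    power : ∃ λ k → (ℤ.- l) ℤ.^ k ≡ v [mod M ]
    power = Primitive.generates v v-unit

  -- A positive power of sign, g ≡ l^k, would give g^h = 1 with h smaller than the order 2h of g.
  primitiveRoot≡-power : ∀ {g} → HasOrder M g (2 * h) → ∃ λ k → ℤ.- (l ℤ.^ k) ≡ g [mod M ]
  primitiveRoot≡-power {g} g-order = go (±-power g (order⇒unit p-prime {s} {g} {2 * h} g-order))
    where
    go : (∃ λ k → l ℤ.^ k ≡ g [mod M ] ⊎ ℤ.- (l ℤ.^ k) ≡ g [mod M ]) → ∃ λ k → ℤ.- (l ℤ.^ k) ≡ g [mod M ]
    go (k , inj₂ e) = k , e
    go (k , inj₁ lᵏ≡g) = contradiction (HasOrder.minimal g-order h (HasOrder.positive order)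
      (Mod.trans (^-mod h (Mod.sym lᵏ≡g)) (Mod.trans (≡⇒≡[mod] (trans (ℤ.^-*-assoc l k h) (cong (λ e → l ℤ.^ e) (ℕ.*-comm k h))))
        (^-periodic {M} {l} {h} lʰ≡1 k))))
      (ℕ.<⇒≱ (ℕ.m<m+n h (ℕ.<-≤-trans (HasOrder.positive order) (ℕ.m≤m+n h 0))))

  private
    *-^-+ : ∀ a i j → a ℤ.* l ℤ.^ i ℤ.* l ℤ.^ j ≡ a ℤ.* l ℤ.^ (i + j)
    *-^-+ a i j = trans (ℤ.*-assoc a (l ℤ.^ i) (l ℤ.^ j)) (cong (λ z → a ℤ.* z) (sym (ℤ.^-distribˡ-+-* l i j)))

  module _ {γ : ℤ} where

    coset-scale : ∀ k {u} → Coset l M γ u → Coset l M γ (l ℤ.^ k ℤ.* u)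
    coset-scale k {u} (m , e) = m + k , Mod.trans (≡⇒≡[mod] (sym (*-^-+ γ m k)))
      (Mod.trans (*ʳ-mod (l ℤ.^ k) e) (≡⇒≡[mod] (ℤ.*-comm u (l ℤ.^ k))))

    coset-unscale : ∀ k {u} → Coset l M γ (l ℤ.^ k ℤ.* u) → Coset l M γ u
    coset-unscale k {u} lᵏu∈C = Coset-resp l γ (Mod.trans (≡⇒≡[mod] (lemma (l ℤ.^ ((h ∸ 1) * k)) (l ℤ.^ k) u))
      (Mod.trans (*ʳ-mod u (power-inverse {M} {l} {h} order k)) (≡⇒≡[mod] (ℤ.*-identityˡ u)))) (coset-scale ((h ∸ 1) * k) {l ℤ.^ k ℤ.* u} lᵏu∈C)
      where
      lemma : ∀ a b u → a ℤ.* (b ℤ.* u) ≡ b ℤ.* a ℤ.* u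
      lemma = solve-∀

    -- γ g l^m is - γ l^(k + m). In the converse direction the surplus l^k is undone by its inverse,
    -- the power l^((h - 1) k).
    coset-neg : ∀ {g} k → ℤ.- (l ℤ.^ k) ≡ g [mod M ] → ∀ {u} →
                (Coset l M (γ ℤ.* g) u → Coset l M γ (ℤ.- u)) × (Coset l M γ (ℤ.- u) → Coset l M (γ ℤ.* g) u)
    coset-neg {g} k -lᵏ≡g {u} = to , from
      where
      open SetoidReasoning (Mod.setoid {M})
      γg-power : ∀ m → γ ℤ.* g ℤ.* l ℤ.^ m ≡ ℤ.- (γ ℤ.* l ℤ.^ (k + m)) [mod M ]
      γg-power m = begin
        γ ℤ.* g ℤ.* l ℤ.^ m                    ≈⟨ *ʳ-mod (l ℤ.^ m) (*ˡ-mod γ -lᵏ≡g) ⟨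
        γ ℤ.* ℤ.- (l ℤ.^ k) ℤ.* l ℤ.^ m        ≡⟨ lemma γ (l ℤ.^ k) (l ℤ.^ m) ⟩
        ℤ.- (γ ℤ.* l ℤ.^ k ℤ.* l ℤ.^ m)        ≡⟨ cong ℤ.-_ (*-^-+ γ k m) ⟩
        ℤ.- (γ ℤ.* l ℤ.^ (k + m))              ∎
        where
        lemma : ∀ γ a b → γ ℤ.* ℤ.- a ℤ.* b ≡ ℤ.- (γ ℤ.* a ℤ.* b)
        lemma = solve-∀
      to : Coset l M (γ ℤ.* g) u → Coset l M γ (ℤ.- u)
      to (m , e) = k + m , (begin
        γ ℤ.* l ℤ.^ (k + m)                    ≡⟨ ℤ.neg-involutive _ ⟨
        ℤ.- ℤ.- (γ ℤ.* l ℤ.^ (k + m))          ≈⟨ -mod (Mod.trans (Mod.sym (γg-power m)) e) ⟩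
        ℤ.- u                                  ∎)
      from : Coset l M γ (ℤ.- u) → Coset l M (γ ℤ.* g) u
      from -u∈C = m , (begin
        γ ℤ.* g ℤ.* l ℤ.^ m                    ≈⟨ γg-power m ⟩
        ℤ.- (γ ℤ.* l ℤ.^ (k + m))              ≡⟨ cong (λ z → ℤ.- (γ ℤ.* l ℤ.^ z)) (ℕ.+-comm k m) ⟩
        ℤ.- (γ ℤ.* l ℤ.^ (m + k))              ≡⟨ cong ℤ.-_ (*-^-+ γ m k) ⟨
        ℤ.- (γ ℤ.* l ℤ.^ m ℤ.* l ℤ.^ k)        ≈⟨ -mod (*ʳ-mod (l ℤ.^ k) (proj₂ -u∈C′)) ⟩
        ℤ.- (l′ ℤ.* ℤ.- u ℤ.* l ℤ.^ k)         ≡⟨ lemma l′ u (l ℤ.^ k) ⟩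
        l ℤ.^ k ℤ.* l′ ℤ.* u                   ≈⟨ *ʳ-mod u (power-inverse {M} {l} {h} order k) ⟩
        1ℤ ℤ.* u                               ≡⟨ ℤ.*-identityˡ u ⟩
        u                                      ∎)
        where
        l′ = l ℤ.^ ((h ∸ 1) * k)
        -u∈C′ : Coset l M γ (l′ ℤ.* ℤ.- u)
        -u∈C′ = coset-scale ((h ∸ 1) * k) { ℤ.- u} -u∈C
        m = proj₁ -u∈C′
        lemma : ∀ a u b → ℤ.- (a ℤ.* ℤ.- u ℤ.* b) ≡ b ℤ.* a ℤ.* u
        lemma = solve-∀

  module Half {a : ℕ} (a≤s : a ≤ s) {γ v : ℤ} (γ≡pᵃv : γ ≡ + (p ^ a) ℤ.* v) (v-unit : Unit p v)
    (C? : ∀ u → Dec (Coset l M γ u)) where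

    private
      C : ℤ → Set
      C = Coset l M γ

      pᵃv∈C : ∀ m {u} → γ ℤ.* l ℤ.^ m ≡ u [mod M ] → + (p ^ a) ℤ.* v ℤ.* l ℤ.^ m ≡ u [mod M ]
      pᵃv∈C m {u} = subst (λ γ → γ ℤ.* l ℤ.^ m ≡ u [mod M ]) γ≡pᵃv

      half⇒exact : ∀ {u} → C u → Exact p a u
      half⇒exact {u} (m , e) = coset⇒exact p-prime {suc s} {a} {v} {l} {m} {u} (s≤s a≤s) v-unit l-unit (pᵃv∈C m e)

      exact-neg : ∀ {u} → Exact p a (ℤ.- u) → Exact p a u
      exact-neg {u} (pᵃ∣-u , pᵃ⁺¹∤-u) = ≡0-neg u pᵃ∣-u , λ pᵃ⁺¹∣u → pᵃ⁺¹∤-u (-mod pᵃ⁺¹∣u)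

      halves⇒exact : ∀ {u} → C u ⊎ C (ℤ.- u) → Exact p a u
      halves⇒exact (inj₁ u∈C)  = half⇒exact u∈C
      halves⇒exact {u} (inj₂ -u∈C) = exact-neg {u} (half⇒exact { ℤ.- u} -u∈C)

      exact⇒halves : ∀ {u} → u ≡ 0ℤ [mod p ^ a ] → ¬ u ≡ 0ℤ [mod p ^ suc a ] → C u ⊎ C (ℤ.- u)
      exact⇒halves {u} pᵃ∣u pᵃ⁺¹∤u = halves (^-neg l m)
        where
        open SetoidReasoning (Mod.setoid {M})
        generated : ∃ λ m → + (p ^ a) ℤ.* v ℤ.* (ℤ.- l) ℤ.^ m ≡ u [mod M ]
        generated = Primitive.exact⇒coset a {v} {u} v-unit (pᵃ∣u , pᵃ⁺¹∤u)
        m : ℕ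
        m = proj₁ generated
        via : ∀ {x} → (ℤ.- l) ℤ.^ m ≡ x → γ ℤ.* x ≡ u [mod M ]
        via {x} e = subst₂ (λ γ x → γ ℤ.* x ≡ u [mod M ]) (sym γ≡pᵃv) e (proj₂ generated)
        lemma : ∀ a b → a ℤ.* b ≡ ℤ.- (a ℤ.* ℤ.- b)
        lemma = solve-∀
        halves : (ℤ.- l) ℤ.^ m ≡ l ℤ.^ m ⊎ (ℤ.- l) ℤ.^ m ≡ ℤ.- (l ℤ.^ m) → C u ⊎ C (ℤ.- u)
        halves (inj₁ e) = inj₁ (m , via e)
        halves (inj₂ e) = inj₂ (m , (begin
          γ ℤ.* l ℤ.^ m                        ≡⟨ lemma γ (l ℤ.^ m) ⟩
          ℤ.- (γ ℤ.* ℤ.- (l ℤ.^ m))            ≈⟨ -mod (via e) ⟩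
          ℤ.- u                                ∎))

      -- Cancelling p^a and the unit v leaves l^m ≡ - l^n modulo p. The weaker assumption x ≡ y mod
      -- p^(a+1), instead of x = y, is what `C-resp` rests on.
      opposite-halves : ∀ {x y} → x ≡ y [mod p ^ suc a ] → C x → ¬ C (ℤ.- y)
      opposite-halves {x} {y} x≡y (m , γlᵐ≡x) (n , γlⁿ≡-y) = l-opposite-powers m n (begin
        l ℤ.^ m                                ≡⟨ ℤ.*-identityˡ _ ⟨
        1ℤ ℤ.* l ℤ.^ m                         ≈⟨ *ʳ-mod (l ℤ.^ m) v′v≡1 ⟨
        v′ ℤ.* v ℤ.* l ℤ.^ m                   ≡⟨ ℤ.*-assoc v′ v (l ℤ.^ m) ⟩
        v′ ℤ.* (v ℤ.* l ℤ.^ m)                 ≈⟨ *ˡ-mod v′ vlᵐ≡-vlⁿ ⟩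
        v′ ℤ.* ℤ.- (v ℤ.* l ℤ.^ n)             ≡⟨ lemma₁ v′ v (l ℤ.^ n) ⟩
        v′ ℤ.* v ℤ.* ℤ.- (l ℤ.^ n)             ≈⟨ *ʳ-mod (ℤ.- (l ℤ.^ n)) v′v≡1 ⟩
        1ℤ ℤ.* ℤ.- (l ℤ.^ n)                   ≡⟨ ℤ.*-identityˡ _ ⟩
        ℤ.- (l ℤ.^ n)                          ∎)
        where
        open SetoidReasoning (Mod.setoid {p})
        v′ : ℤ
        v′ = proj₁ (Primitive.unit-inverse v-unit)
        v′v≡1 : v′ ℤ.* v ≡ 1ℤ [mod p ]
        v′v≡1 = Mod.trans (≡⇒≡[mod] (ℤ.*-comm v′ v)) (^-mod-base s (proj₂ (Primitive.unit-inverse v-unit)))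
        lemma₁ : ∀ a b c → a ℤ.* ℤ.- (b ℤ.* c) ≡ a ℤ.* b ℤ.* ℤ.- c
        lemma₁ = solve-∀
        lemma₂ : ∀ a b c → ℤ.- (a ℤ.* b ℤ.* c) ≡ a ℤ.* ℤ.- (b ℤ.* c)
        lemma₂ = solve-∀
        reduce : ∀ {x y} → x ≡ y [mod M ] → x ≡ y [mod p ^ suc a ]
        reduce = ^-mod-≤ {p} {suc a} {suc s} (s≤s a≤s)
        pᵃvlᵐ≡-pᵃvlⁿ : + (p ^ a) ℤ.* v ℤ.* l ℤ.^ m ≡ ℤ.- (+ (p ^ a) ℤ.* v ℤ.* l ℤ.^ n) [mod p ^ suc a ]
        pᵃvlᵐ≡-pᵃvlⁿ = Mod.trans (reduce (pᵃv∈C m γlᵐ≡x)) (Mod.trans x≡y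
          (Mod.trans (≡⇒≡[mod] (sym (ℤ.neg-involutive y))) (-mod (Mod.sym (reduce (pᵃv∈C n γlⁿ≡-y))))))
        vlᵐ≡-vlⁿ : v ℤ.* l ℤ.^ m ≡ ℤ.- (v ℤ.* l ℤ.^ n) [mod p ]
        vlᵐ≡-vlⁿ = unscale-mod (p ^ a) {{ℕ.m^n≢0 p a}} (subst₂ (λ x y → x ≡ y [mod p ^ a * p ])
          (ℤ.*-assoc (+ (p ^ a)) v (l ℤ.^ m)) (lemma₂ (+ (p ^ a)) v (l ℤ.^ n))
          (subst (λ k → + (p ^ a) ℤ.* v ℤ.* l ℤ.^ m ≡ ℤ.- (+ (p ^ a) ℤ.* v ℤ.* l ℤ.^ n) [mod k ]) (ℕ.*-comm p (p ^ a)) pᵃvlᵐ≡-pᵃvlⁿ))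

      -- A coset modulo p^(s+1) is thus a union of classes modulo p^(a+1): y has valuation a like x,
      -- so it lies in one of the two halves, and the opposite one is ruled out.
      C-resp : ∀ {x y} → x ≡ y [mod p ^ suc a ] → C x → C y
      C-resp {x} {y} x≡y x∈C with C? y
      ... | yes y∈C = y∈C
      ... | no  y∉C = [ id , (λ -y∈C → contradiction -y∈C (opposite-halves {x} {y} x≡y x∈C)) ]′
        (exact⇒halves {y} (Mod.trans (Mod.sym (mod-* {p} x≡y)) (proj₁ (half⇒exact {x} x∈C)))
          (λ y≡0 → proj₂ (half⇒exact {x} x∈C) (Mod.trans x≡y y≡0)))

      transitive : ∀ {u} → C u → ∃₂ λ k k′ → k ℤ.* k′ ≡ 1ℤ [mod M ] × k ℤ.* γ ≡ u [mod M ] ×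
                   (∀ v → C v → C (k ℤ.* v)) × (∀ v → C (k ℤ.* v) → C v)
      transitive (m , e) = l ℤ.^ m , l ℤ.^ ((h ∸ 1) * m) , power-inverse {M} {l} {h} order m ,
        Mod.trans (≡⇒≡[mod] (ℤ.*-comm (l ℤ.^ m) γ)) e ,
        (λ v → coset-scale {γ} m {v}) , (λ v → coset-unscale {γ} m {v})

      M≡ : M ≡ p ^ (s ∸ a) * p ^ suc a
      M≡ = trans (cong (λ e → p ^ e) (trans (cong suc (sym (ℕ.m∸n+n≡m a≤s))) (sym (ℕ.+-suc (s ∸ a) a))))
        (ℕ.^-distribˡ-+-* p (s ∸ a) (suc a))

      instance
        M≢0 : NonZero M
        M≢0 = ℕ.m^n≢0 p (suc s)
        pᵃ≢0 : NonZero (p ^ a)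
        pᵃ≢0 = ℕ.m^n≢0 p a
        pˢ⁻ᵃ≢0 : NonZero (p ^ (s ∸ a))
        pˢ⁻ᵃ≢0 = ℕ.m^n≢0 p (s ∸ a)

    open HalfPairs {M} {p ^ (s ∸ a)} {p} {p ^ a} {w} M≡ p≡3+4w {C} C? (λ {x} {y} → C-resp {x} {y})
      (λ {u} → halves⇒exact {u}) (λ {u} → exact⇒halves {u}) (λ {u} → opposite-halves {u} {u} Mod.refl) {γ}
      (λ {u} → transitive {u}) public
      using (half-split; pairs; pairs-count)

-- At the top index γ vanishes modulo m, and its orbit is the single residue 0.
top-coset : ∀ {k m γ} v → γ ≡ + m ℤ.* v → ∀ {u} →
            (Coset k m γ u → u ≡ 0ℤ [mod m ]) × (u ≡ 0ℤ [mod m ] → Coset k m γ u)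
top-coset {k} {m} {γ} v γ≡mv {u} =
  (λ (r , e) → Mod.trans (Mod.sym e) (γkʳ≡0 r)) , λ u≡0 → 0 , Mod.trans (γkʳ≡0 0) (Mod.sym u≡0)
  where
  γkʳ≡0 : ∀ r → γ ℤ.* k ℤ.^ r ≡ 0ℤ [mod m ]
  γkʳ≡0 r = Mod.trans (≡⇒≡[mod] (trans (cong (λ z → z ℤ.* k ℤ.^ r) γ≡mv) (ℤ.*-assoc (+ m) v (k ℤ.^ r)))) (multiple≡0 (v ℤ.* k ℤ.^ r))

-- Gluing cosets modulo m and modulo n.

SeparatingExponent : ℤ → ℕ → ℕ → Set
SeparatingExponent l m n = ∃ λ e → l ℤ.^ e ≡ 1ℤ [mod m ] × l ℤ.^ e ≡ l [mod n ]

-- Bézout in ℕ reads 1 + y f = x h or 1 + x h = y f. The right-hand side is the exponent, and the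
-- case decides which modulus sees 1 and which sees l.
separating-exponent : ∀ {m n l h f} → Coprime h f → l ℤ.^ h ≡ 1ℤ [mod m ] → l ℤ.^ f ≡ 1ℤ [mod n ] →
                      SeparatingExponent l m n ⊎ SeparatingExponent l n m
separating-exponent {m} {n} {l} {h} {f} h⊥f lʰ≡1 lᶠ≡1 = go (coprime-Bézout h⊥f)
  where
  multiple≡1 : ∀ m h x → l ℤ.^ h ≡ 1ℤ [mod m ] → l ℤ.^ (x * h) ≡ 1ℤ [mod m ]
  multiple≡1 m h x lʰ≡1 = subst (λ e → l ℤ.^ e ≡ 1ℤ [mod m ]) (ℕ.*-comm h x) (^-periodic {m} {l} {h} lʰ≡1 x)
  successor≡l : ∀ m h x → l ℤ.^ h ≡ 1ℤ [mod m ] → l ℤ.^ (1 + x * h) ≡ l [mod m ]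
  successor≡l m h x lʰ≡1 = Mod.trans (*ˡ-mod l (multiple≡1 m h x lʰ≡1)) (≡⇒≡[mod] (ℤ.*-identityʳ l))
  go : Bézout.Identity 1 h f → SeparatingExponent l m n ⊎ SeparatingExponent l n m
  go (Bézout.+- x y eq) = inj₁ (x * h , multiple≡1 m h x lʰ≡1 ,
    subst (λ e → l ℤ.^ e ≡ l [mod n ]) eq (successor≡l n f y lᶠ≡1))
  go (Bézout.-+ x y eq) = inj₂ (y * f , multiple≡1 n f y lᶠ≡1 ,
    subst (λ e → l ℤ.^ e ≡ l [mod m ]) eq (successor≡l m h x lʰ≡1))

-- Adding e r to an exponent changes nothing modulo m and multiplies by l^r modulo n, so r₁ + e (r₂
-- - r₁) serves both.
coset-pair : ∀ {m n l f} e γ {u} → HasOrder n l f → l ℤ.^ e ≡ 1ℤ [mod m ] → l ℤ.^ e ≡ l [mod n ] →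
             Coset l m γ u → Coset l n γ u → ∃ λ r → γ ℤ.* l ℤ.^ r ≡ u [mod m ] × γ ℤ.* l ℤ.^ r ≡ u [mod n ]
coset-pair {m} {n} {l} {f} e γ {u} order lᵉ≡1 lᵉ≡l (r₁ , γlʳ¹≡u) (r₂ , γlʳ²≡u) =
  r₁ + e * r , Mod.trans (*ˡ-mod γ at-m) γlʳ¹≡u , Mod.trans (*ˡ-mod γ at-n) γlʳ²≡u
  where
  r : ℕ
  -- r₂ - r₁ modulo f, with (f - 1) r₁ for - r₁.
  r = r₂ + (f ∸ 1) * r₁
  expand : l ℤ.^ (r₁ + e * r) ≡ l ℤ.^ r₁ ℤ.* (l ℤ.^ e) ℤ.^ r
  expand = trans (ℤ.^-distribˡ-+-* l r₁ (e * r)) (cong (λ z → l ℤ.^ r₁ ℤ.* z) (sym (ℤ.^-*-assoc l e r)))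
  at-m : l ℤ.^ (r₁ + e * r) ≡ l ℤ.^ r₁ [mod m ]
  at-m = begin
    l ℤ.^ (r₁ + e * r)                 ≡⟨ expand ⟩
    l ℤ.^ r₁ ℤ.* (l ℤ.^ e) ℤ.^ r       ≈⟨ *ˡ-mod (l ℤ.^ r₁) (^-mod r lᵉ≡1) ⟩
    l ℤ.^ r₁ ℤ.* 1ℤ ℤ.^ r              ≡⟨ cong (λ z → l ℤ.^ r₁ ℤ.* z) (ℤ.^-zeroˡ r) ⟩
    l ℤ.^ r₁ ℤ.* 1ℤ                    ≡⟨ ℤ.*-identityʳ _ ⟩
    l ℤ.^ r₁                           ∎
    where open SetoidReasoning (Mod.setoid {m})
  at-n : l ℤ.^ (r₁ + e * r) ≡ l ℤ.^ r₂ [mod n ]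
  at-n = begin
    l ℤ.^ (r₁ + e * r)                                       ≡⟨ expand ⟩
    l ℤ.^ r₁ ℤ.* (l ℤ.^ e) ℤ.^ r                             ≈⟨ *ˡ-mod (l ℤ.^ r₁) (^-mod r lᵉ≡l) ⟩
    l ℤ.^ r₁ ℤ.* l ℤ.^ r                                     ≡⟨ cong (λ z → l ℤ.^ r₁ ℤ.* z) (ℤ.^-distribˡ-+-* l r₂ ((f ∸ 1) * r₁)) ⟩
    l ℤ.^ r₁ ℤ.* (l ℤ.^ r₂ ℤ.* l ℤ.^ ((f ∸ 1) * r₁))         ≡⟨ lemma (l ℤ.^ r₁) (l ℤ.^ r₂) (l ℤ.^ ((f ∸ 1) * r₁)) ⟩
    l ℤ.^ r₂ ℤ.* (l ℤ.^ r₁ ℤ.* l ℤ.^ ((f ∸ 1) * r₁))         ≈⟨ *ˡ-mod (l ℤ.^ r₂) (power-inverse {n} {l} {f} order r₁) ⟩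
    l ℤ.^ r₂ ℤ.* 1ℤ                                          ≡⟨ ℤ.*-identityʳ _ ⟩
    l ℤ.^ r₂                                                 ∎
    where
    open SetoidReasoning (Mod.setoid {n})
    lemma : ∀ a b c → a ℤ.* (b ℤ.* c) ≡ b ℤ.* (a ℤ.* c)
    lemma = solve-∀

module _ {m n l h f} {m′ : ℤ} (mm′≡1 : + m ℤ.* m′ ≡ 1ℤ [mod n ]) (h⊥f : Coprime h f)
  (m-order : HasOrder m l h) (n-order : HasOrder n l f) where

  coset-crt : ∀ γ {u} → Coset l m γ u → Coset l n γ u → Coset l (m * n) γ u
  coset-crt γ {u} u∈Cₘ u∈Cₙ = go (separating-exponent {m} {n} {l} {h} {f} h⊥f (HasOrder.power≡1 m-order) (HasOrder.power≡1 n-order))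
    where
    conclude : ∀ r → γ ℤ.* l ℤ.^ r ≡ u [mod m ] → γ ℤ.* l ℤ.^ r ≡ u [mod n ] → Coset l (m * n) γ u
    conclude r eₘ eₙ = r , crt m n {m′} mm′≡1 eₘ eₙ
    go : SeparatingExponent l m n ⊎ SeparatingExponent l n m → Coset l (m * n) γ u
    go (inj₁ (e , lᵉ≡1 , lᵉ≡l)) =
      let r , eₘ , eₙ = coset-pair {m} {n} {l} {f} e γ {u} n-order lᵉ≡1 lᵉ≡l u∈Cₘ u∈Cₙ in conclude r eₘ eₙ
    go (inj₂ (e , lᵉ≡1 , lᵉ≡l)) =
      let r , eₙ , eₘ = coset-pair {n} {m} {l} {h} e γ {u} m-order lᵉ≡1 lᵉ≡l u∈Cₙ u∈Cₘ in conclude r eₘ eₙ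

coset-reduce : ∀ {m n k} γ {u} → Coset k (m * n) γ u → Coset k m γ u × Coset k n γ u
coset-reduce {m} {n} {k} γ {u} (r , e) =
  (r , mod-* {n} (subst (λ d → γ ℤ.* k ℤ.^ r ≡ u [mod d ]) (ℕ.*-comm m n) e)) , (r , mod-* {m} e)

-- A common divisor of h and f divides gcd(2h, f) = 2, and h is odd.
halves-coprime : ∀ {h f} r → h ≡ suc (2 * r) → gcd (2 * h) f ≡ 2 → Coprime h f
halves-coprime {h} {f} r refl gcd≡2 {d} (d∣h , d∣f) = ℕ∣.∣1⇒≡1
  (ℕ∣.∣m+n∣m⇒∣n (subst (d ∣_) (ℕ.+-comm 1 (2 * r)) d∣h) (ℕ∣.∣-trans d∣2 (ℕ∣.m∣m*n r)))
  where
  d∣2 : d ∣ 2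
  d∣2 = subst (d ∣_) gcd≡2 (gcd-greatest (ℕ∣.∣-trans d∣h (ℕ∣.n∣m*n 2)) d∣f)

-- The q-component: l generates all units.

module FullOrder {q t f : ℕ} {l : ℤ} (q-prime : Prime q) (f≡φ : f ≡ φ (q ^ suc t)) (order : HasOrder (q ^ suc t) l f) where

  private
    M : ℕ
    M = q ^ suc t

    instance
      q≢0 : NonZero q
      q≢0 = prime⇒nonZero q-prime
      M≢0 : NonZero M
      M≢0 = ℕ.m^n≢0 q (suc t)

  l-unit : Unit q l
  l-unit = order⇒unit q-prime {t} {l} {f} order

  module Primitive = PrimitiveRoot q-prime {t} {l} {f} f≡φ order

  module Layer {b : ℕ} (b≤t : b ≤ t) {γ v : ℤ} (γ≡qᵇv : γ ≡ + (q ^ b) ℤ.* v) (v-unit : Unit q v) where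

    coset⇒layer : ∀ {u} → Coset l M γ u → Exact q b u
    coset⇒layer {u} (m , e) = coset⇒exact q-prime {suc t} {b} {v} {l} {m} {u} (s≤s b≤t) v-unit l-unit
      (subst (λ γ → γ ℤ.* l ℤ.^ m ≡ u [mod M ]) γ≡qᵇv e)

    -- The condition on u does not involve the unit v, which is why γ and γ g have the same
    -- q-component.
    layer⇒coset : ∀ {u} → u ≡ 0ℤ [mod q ^ b ] → ¬ u ≡ 0ℤ [mod q ^ suc b ] → Coset l M γ u
    layer⇒coset {u} qᵇ∣u qᵇ⁺¹∤u = subst (λ γ → Coset l M γ u) (sym γ≡qᵇv) (Primitive.exact⇒coset b {v} {u} v-unit (qᵇ∣u , qᵇ⁺¹∤u))

    module Count (C? : ∀ u → Dec (Coset l M γ u)) where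
      private
        M≡ : M ≡ q ^ (t ∸ b) * q ^ suc b
        M≡ = trans (cong (λ e → q ^ e) (trans (cong suc (sym (ℕ.m∸n+n≡m b≤t))) (sym (ℕ.+-suc (t ∸ b) b))))
          (ℕ.^-distribˡ-+-* q (t ∸ b) (suc b))
        instance
          qᵇ≢0 : NonZero (q ^ b)
          qᵇ≢0 = ℕ.m^n≢0 q b

      open ExactPairs {M} {q ^ (t ∸ b)} {q} {q ^ b} {q ∸ 2} M≡ (sym (ℕ.m+[n∸m]≡n (prime≥2 q-prime))) {Coset l M γ} C?
        (λ {u} → coset⇒layer {u}) (λ {u} → layer⇒coset {u}) public
        using (exact-split; pairs; pairs-count)

-- Decomposition by exact valuation.

ℕ-sumOver-cong : ∀ a b {f g} → (∀ k → k ≤ b → f k ≡ g k) → ℕ-sumOver a b f ≡ ℕ-sumOver a b g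
ℕ-sumOver-cong a b {f} {g} f≡g = sum-cong-≗ {b ∸ a} λ k → f≡g (suc a + toℕ k) (bound (toℕ<n k))
  where
  bound : ∀ {k} → k < b ∸ a → suc a + k ≤ b
  bound {k} k<b∸a = subst (_≤ b) (ℕ.+-suc a k) (ℕ.≤-trans (ℕ.+-monoʳ-≤ a k<b∸a)
    (ℕ.≤-reflexive (ℕ.m+[n∸m]≡n {a} {b} (ℕ.<⇒≤ (ℕ.m∸n≢0⇒n<m λ b∸a≡0 → ℕ.n≮0 (subst (k <_) b∸a≡0 k<b∸a))))))

ℕ-sumOver-telescope : ∀ {a b} (f D : ℕ → ℕ) → a ≤ b → (∀ k → k ≤ b → f k + D (suc k) ≡ D k) →
                    ℕ-sumOver a b f + D (suc b) ≡ D (suc a)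
ℕ-sumOver-telescope {a} {b} f D a≤b step = subst (λ e → ℕ-sumOver a b f + D (suc e) ≡ D (suc a)) (ℕ.m+[n∸m]≡n a≤b)
  (go (b ∸ a) a (ℕ.≤-reflexive (ℕ.m+[n∸m]≡n a≤b)))
  where
  go : ∀ n a → a + n ≤ b → sum {n} (λ k → f (suc a + toℕ k)) + D (suc (a + n)) ≡ D (suc a)
  go zero    a a+n≤b = cong (λ e → D (suc e)) (ℕ.+-identityʳ a)
  go (suc n) a a+n≤b = begin
    f (suc a + 0) + sum {n} (λ k → f (suc a + suc (toℕ k))) + D (suc (a + suc n))
      ≡⟨ ℕ.+-assoc (f (suc a + 0)) _ _ ⟩
    f (suc a + 0) + (sum {n} (λ k → f (suc a + suc (toℕ k))) + D (suc (a + suc n)))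
      ≡⟨ cong₂ _+_ (cong f (ℕ.+-identityʳ (suc a)))
           (cong₂ _+_ (sum-cong-≗ {n} (λ k → cong f (ℕ.+-suc (suc a) (toℕ k)))) (cong (λ e → D (suc e)) (ℕ.+-suc a n))) ⟩
    f (suc a) + (sum {n} (λ k → f (suc (suc a) + toℕ k)) + D (suc (suc a + n)))
      ≡⟨ cong (λ z → f (suc a) + z) (go n (suc a) a+n≤b′) ⟩
    f (suc a) + D (suc (suc a))
      ≡⟨ step (suc a) (ℕ.≤-trans (ℕ.m≤m+n (suc a) n) a+n≤b′) ⟩
    D (suc a) ∎
    where
    open ≡.≡-Reasoning
    a+n≤b′ : suc a + n ≤ b
    a+n≤b′ = subst (_≤ b) (ℕ.+-suc a n) a+n≤b

ℕ-sumOver-*ˡ : ∀ a b c f → ℕ-sumOver a b (λ k → c * f k) ≡ c * ℕ-sumOver a b f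
ℕ-sumOver-*ˡ a b c f = sym (*-distribˡ-sum {b ∸ a} c (λ k → f (suc a + toℕ k)))

ℕ-sumOver-*ʳ : ∀ a b c f → ℕ-sumOver a b (λ k → f k * c) ≡ ℕ-sumOver a b f * c
ℕ-sumOver-*ʳ a b c f = sym (ℕ∑.*-distribʳ-sum {b ∸ a} c (λ k → f (suc a + toℕ k)))

-- The values at a fixed c of the coefficient functions: A k m and A* k m for
-- the p-components of C_{km} and C*_{km}, B k m and B* k m for the
-- q-components, D k for p^k ∣ c, and T m for q^m ∣ c (cut off above t).
module LayerIdentity {s t i j : ℕ} (i≤s : i ≤ s) (j≤t : j ≤ t) (A A* B B* : ℕ → ℕ → ℕ) (D T : ℕ → ℕ)
  (A-split : ∀ k m → k ≤ s → (A k m + A* k m) + D (suc k) ≡ D k)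
  (A-top : ∀ m → A (suc s) m ≡ D (suc s))
  (B-split : ∀ k m → m ≤ t → B k m + T (suc m) ≡ T m)
  (B*-split : ∀ k m → m ≤ t → B* k m + T (suc m) ≡ T m)
  (T-end : T (suc t) ≡ 0) where

  private
    -- Indicators of single layers; the truncated subtraction loses nothing because of `A-split` and
    -- `B-split`.
    Lp Lq : ℕ → ℕ
    Lp k = D k ∸ D (suc k)
    Lq m = T m ∸ T (suc m)

    difference : ∀ {a b c} → a + b ≡ c → a ≡ c ∸ b
    difference {a} {b} refl = sym (ℕ.m+n∸n≡m a b)

    X Y : ℕ → ℕ → ℕ
    X k m = A k m * B k m
    Y k m = A k m * B k m + A* k m * B* k m

    -- The two q-components have the common value `Lq m`. It factors out, and the two p-halves add
    -- up to a full layer.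
    Y≡ : ∀ k m → k ≤ s → m ≤ t → Y k m ≡ Lp k * Lq m
    Y≡ k m k≤s m≤t = begin
      A k m * B k m + A* k m * B* k m  ≡⟨ cong₂ (λ x y → A k m * x + A* k m * y) (difference (B-split k m m≤t)) (difference (B*-split k m m≤t)) ⟩
      A k m * Lq m + A* k m * Lq m     ≡⟨ ℕ.*-distribʳ-+ (Lq m) (A k m) (A* k m) ⟨
      (A k m + A* k m) * Lq m          ≡⟨ cong (_* Lq m) (difference {A k m + A* k m} (A-split k m k≤s)) ⟩
      Lp k * Lq m                      ∎
      where open ≡.≡-Reasoning

    X-top : ∀ m → m ≤ t → X (suc s) m ≡ D (suc s) * Lq m
    X-top m m≤t = cong₂ _*_ (A-top m) (difference (B-split (suc s) m m≤t))

    sum-Lq : ℕ-sumOver j t Lq ≡ T (suc j)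
    sum-Lq = begin
      ℕ-sumOver j t Lq                 ≡⟨ ℕ.+-identityʳ _ ⟨
      ℕ-sumOver j t Lq + 0             ≡⟨ cong (λ z → ℕ-sumOver j t Lq + z) T-end ⟨
      ℕ-sumOver j t Lq + T (suc t)     ≡⟨ ℕ-sumOver-telescope {j} {t} Lq T j≤t (λ m m≤t → trans (cong (_+ T (suc m)) (sym (difference (B-split 0 m m≤t)))) (B-split 0 m m≤t)) ⟩
      T (suc j)                      ∎
      where open ≡.≡-Reasoning

    -- Unlike `sum-Lq`, this stops below the top index. The remainder `D (suc s)` produces the terms
    -- in which `X (suc s)` stands alone.
    sum-Lp : ℕ-sumOver i s Lp + D (suc s) ≡ D (suc i)
    sum-Lp = ℕ-sumOver-telescope {i} {s} Lp D i≤s λ k k≤s →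
      trans (cong (_+ D (suc k)) (sym (difference {A k 0 + A* k 0} (A-split k 0 k≤s)))) (A-split k 0 k≤s)

    sum-Y : ∀ k → k ≤ s → ℕ-sumOver j t (λ m → Y k m) ≡ Lp k * T (suc j)
    sum-Y k k≤s = trans (ℕ-sumOver-cong j t (λ m m≤t → Y≡ k m k≤s m≤t))
      (trans (ℕ-sumOver-*ˡ j t (Lp k) Lq) (cong (λ z → Lp k * z) sum-Lq))

  -- Splitting p^(i+1) ∣ c into the layers up to s and the top gives three p-terms against two
  -- q-terms; the six products are the six summands.
  layer-identity : ∀ K H L F →
    (K * (A i j + A* i j) + H * D (suc i)) * (L * B i j + F * T (suc j)) ≡
      K * L * Y i j + K * F * ℕ-sumOver j t (λ m → Y i m)
      + H * F * ℕ-sumOver i s (λ k → ℕ-sumOver j t (λ m → Y k m))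
      + H * L * X (suc s) j + H * F * ℕ-sumOver j t (λ m → X (suc s) m)
      + H * L * ℕ-sumOver i s (λ k → Y k j)
  layer-identity K H L F = begin
    (K * (A i j + A* i j) + H * D (suc i)) * (L * B i j + F * T (suc j))
      ≡⟨ cong₂ _*_ (cong₂ (λ x y → K * x + H * y) (difference {A i j + A* i j} (A-split i j i≤s)) (sym sum-Lp))
           (cong (λ x → L * x + F * T (suc j)) (difference (B-split i j j≤t))) ⟩
    (K * Lp i + H * (ℕ-sumOver i s Lp + D (suc s))) * (L * Lq j + F * T (suc j))
      ≡⟨ lemma K H L F (Lp i) (ℕ-sumOver i s Lp) (D (suc s)) (Lq j) (T (suc j)) ⟩
    K * L * (Lp i * Lq j) + K * F * (Lp i * T (suc j)) + H * F * (ℕ-sumOver i s Lp * T (suc j))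
      + H * L * (D (suc s) * Lq j) + H * F * (D (suc s) * T (suc j)) + H * L * (ℕ-sumOver i s Lp * Lq j)
      ≡⟨ cong₂ _+_ (cong₂ _+_ (cong₂ _+_ (cong₂ _+_ (cong₂ _+_
           (cong (λ z → K * L * z) (Y≡ i j i≤s j≤t))
           (cong (λ z → K * F * z) (sum-Y i i≤s)))
           (cong (λ z → H * F * z) (trans (ℕ-sumOver-cong i s sum-Y) (ℕ-sumOver-*ʳ i s (T (suc j)) Lp))))
           (cong (λ z → H * L * z) (X-top j j≤t)))
           (cong (λ z → H * F * z) (trans (ℕ-sumOver-cong j t X-top) (trans (ℕ-sumOver-*ˡ j t (D (suc s)) Lq) (cong (λ z → D (suc s) * z) sum-Lq)))))
           (cong (λ z → H * L * z) (trans (ℕ-sumOver-cong i s (λ k k≤s → Y≡ k j k≤s j≤t)) (ℕ-sumOver-*ʳ i s (Lq j) Lp))) ⟨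
    K * L * Y i j + K * F * ℕ-sumOver j t (λ m → Y i m)
      + H * F * ℕ-sumOver i s (λ k → ℕ-sumOver j t (λ m → Y k m))
      + H * L * X (suc s) j + H * F * ℕ-sumOver j t (λ m → X (suc s) m)
      + H * L * ℕ-sumOver i s (λ k → Y k j) ∎
    where
    open ≡.≡-Reasoning
    lemma : ∀ K H L F a b c d e → (K * a + H * (b + c)) * (L * d + F * e) ≡
      K * L * (a * d) + K * F * (a * e) + H * F * (b * e) + H * L * (c * d) + H * F * (c * e) + H * L * (b * d)
    lemma = ℕ-Solver.solve-∀

-- Coefficients of the coset sums from their p- and q-components.

distinct-prime-unit : ∀ {p q} → Prime p → Prime q → p ≢ q → ∀ b → Unit p (+ (q ^ b))
distinct-prime-unit p-prime q-prime p≢q zero = 1-unit p-prime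
distinct-prime-unit {p} {q} p-prime q-prime p≢q (suc b) =
  subst (Unit p) (sym (ℤ.pos-* q (q ^ b))) (*-unit p-prime {+ q} {+ (q ^ b)} q-unit (distinct-prime-unit p-prime q-prime p≢q b))
  where
  q-unit : Unit p (+ q)
  q-unit q≡0 = [ prime≢1 p-prime , p≢q ]′ (prime⇒irreducible q-prime (proj₁ ≡0-mod⇔∣ q≡0))

module Components {p q s t l w h r f : ℕ} {g : ℤ}
  (p-prime : Prime p) (q-prime : Prime q) (p≢q : p ≢ q) (p≡3+4w : p ≡ 3 + 4 * w)
  (2h≡φ : 2 * h ≡ φ (p ^ suc s)) (h≡1+2r : h ≡ suc (2 * r)) (f≡φ : f ≡ φ (q ^ suc t))
  (l-p-order : HasOrder (p ^ suc s) (+ l) h) (l-q-order : HasOrder (q ^ suc t) (+ l) f)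
  (gcd≡2 : gcd (2 * h) f ≡ 2)
  (g-p-order : HasOrder (p ^ suc s) g (2 * h)) (g-q-order : HasOrder (q ^ suc t) g f) where

  Mp Mq n : ℕ
  Mp = p ^ suc s
  Mq = q ^ suc t
  n = Mp * Mq

  instance
    p≢0 : NonZero p
    p≢0 = prime⇒nonZero p-prime
    q≢0 : NonZero q
    q≢0 = prime⇒nonZero q-prime
    Mp≢0 : NonZero Mp
    Mp≢0 = ℕ.m^n≢0 p (suc s)
    Mq≢0 : NonZero Mq
    Mq≢0 = ℕ.m^n≢0 q (suc t)
    n≢0 : NonZero n
    n≢0 = ℕ.m*n≢0 Mp Mq

  private
    module P = HalfOrder {p} {w} {s} {h} {r} {+ l} p-prime p≡3+4w 2h≡φ h≡1+2r l-p-order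
    module Q = FullOrder {q} {t} {f} {+ l} q-prime f≡φ l-q-order

  γ γ* : ℕ → ℕ → ℤ
  γ a b = + (p ^ a * q ^ b)
  γ* a b = γ a b ℤ.* g

  private
    p-unit : ∀ b → Unit p (+ (q ^ b))
    p-unit = distinct-prime-unit p-prime q-prime p≢q

    q-unit : ∀ a → Unit q (+ (p ^ a))
    q-unit = distinct-prime-unit q-prime p-prime (p≢q ∘ sym)

    γ-at-p : ∀ a b → γ a b ≡ + (p ^ a) ℤ.* + (q ^ b)
    γ-at-p a b = ℤ.pos-* (p ^ a) (q ^ b)

    γ-at-q : ∀ a b → γ a b ≡ + (q ^ b) ℤ.* + (p ^ a)
    γ-at-q a b = trans (γ-at-p a b) (ℤ.*-comm (+ (p ^ a)) (+ (q ^ b)))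

    γ*-at-q : ∀ a b → γ* a b ≡ + (q ^ b) ℤ.* (+ (p ^ a) ℤ.* g)
    γ*-at-q a b = trans (cong (λ z → z ℤ.* g) (γ-at-q a b)) (ℤ.*-assoc (+ (q ^ b)) (+ (p ^ a)) g)

    q-unit* : ∀ a → Unit q (+ (p ^ a) ℤ.* g)
    q-unit* a = *-unit q-prime {+ (p ^ a)} {g} (q-unit a) (order⇒unit q-prime {t} {g} {f} g-q-order)

    Mp-inverse : ∃ λ m → + Mp ℤ.* m ≡ 1ℤ [mod Mq ]
    Mp-inverse = Q.Primitive.unit-inverse {+ Mp} (q-unit (suc s))

    Mq-inverse : ∃ λ m → + Mq ℤ.* m ≡ 1ℤ [mod Mp ]
    Mq-inverse = P.Primitive.unit-inverse {+ Mq} (p-unit (suc t))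

  indicator : (m : ℕ) .{{_ : NonZero m}} → ℤ → ℤ → ℕ
  indicator m γ u = 𝟙 (coset? l m γ u)

  indicator-periodic : ∀ m .{{_ : NonZero m}} γ → Periodic m (indicator m γ)
  indicator-periodic m γ a b a≡b = 𝟙-cong (coset? l m γ a) (coset? l m γ b)
    (Coset-resp (+ l) γ a≡b) (Coset-resp (+ l) γ (Mod.sym a≡b))

  coefficient : ℤ → ℤ → ℕ
  coefficient γ u = indicator Mp γ u * indicator Mq γ u

  coefficient-periodic : ∀ γ → Periodic n (coefficient γ)
  coefficient-periodic γ a b a≡b = cong₂ _*_
    (indicator-periodic Mp γ a b (mod-* {Mq} (subst (λ m → a ≡ b [mod m ]) (ℕ.*-comm Mp Mq) a≡b)))
    (indicator-periodic Mq γ a b (mod-* {Mp} a≡b))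

  -- One direction reads a single exponent modulo both factors; the other must merge two exponents
  -- into one.
  inCoset-indicator : ∀ γ k → 𝟙 (inCoset? l n γ k) ≡ coefficient γ (+ toℕ k)
  inCoset-indicator γ k = trans
    (𝟙-cong (inCoset? l n γ k) (coset? l Mp γ u ×-dec coset? l Mq γ u) (coset-reduce {Mp} {Mq} {+ l} γ {u})
      (λ (cp , cq) → coset-crt {Mp} {Mq} {+ l} {h} {f} {proj₁ Mp-inverse} (proj₂ Mp-inverse) (halves-coprime {h} {f} r h≡1+2r gcd≡2) l-p-order l-q-order γ {u} cp cq))
    (𝟙-× (coset? l Mp γ u) (coset? l Mq γ u))
    where
    u = + toℕ k

  private
    indicator-neg : ∀ a b u → indicator Mp (γ* a b) u ≡ indicator Mp (γ a b) (ℤ.- u)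
    indicator-neg a b u = 𝟙-cong (coset? l Mp (γ* a b) u) (coset? l Mp (γ a b) (ℤ.- u))
      (proj₁ (P.coset-neg {γ a b} {g} (proj₁ g-power) (proj₂ g-power) {u}))
      (proj₂ (P.coset-neg {γ a b} {g} (proj₁ g-power) (proj₂ g-power) {u}))
      where
      g-power = P.primitiveRoot≡-power {g} g-p-order

  module _ {i j : ℕ} (i≤s : i ≤ s) (j≤t : j ≤ t) where

    private
      module PH {a} (a≤s : a ≤ s) b = P.Half {a} a≤s {γ a b} {+ (q ^ b)} (γ-at-p a b) (p-unit b) (coset? l Mp (γ a b))
      module QL {b} (b≤t : b ≤ t) a = Q.Layer {b} b≤t {γ a b} {+ (p ^ a)} (γ-at-q a b) (q-unit a)
      module QL* {b} (b≤t : b ≤ t) a = Q.Layer {b} b≤t {γ* a b} {+ (p ^ a) ℤ.* g} (γ*-at-q a b) (q-unit* a)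
      module QC {b} (b≤t : b ≤ t) a = QL.Count b≤t a (coset? l Mq (γ a b))

      -- The top coset is all of c ≡ 0 mod q^(t+1), so for `q-split` to hold at m = `suc t` nothing
      -- may remain beyond, even when q^(t+2) divides c.
      T : ℤ → ℕ → ℕ
      T c m = if does (m ℕ.≤? suc t) then multiple (q ^ m) c else 0

      T-≤ : ∀ c m → m ≤ suc t → T c m ≡ multiple (q ^ m) c
      T-≤ c m m≤ = cong (if_then multiple (q ^ m) c else 0) (dec-true (m ℕ.≤? suc t) m≤)

      T-> : ∀ c m → suc t < m → T c m ≡ 0
      T-> c m t<m = cong (if_then multiple (q ^ m) c else 0) (dec-false (m ℕ.≤? suc t) (ℕ.<⇒≱ t<m))

      q-split : ∀ c a m → m ≤ suc t → indicator Mq (γ a m) c + T c (suc m) ≡ T c m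
      q-split c a m m≤1+t = go (ℕ.m≤n⇒m<n∨m≡n m≤1+t)
        where
        go : m < suc t ⊎ m ≡ suc t → indicator Mq (γ a m) c + T c (suc m) ≡ T c m
        go (inj₁ (s≤s m≤t)) = trans (cong (λ z → indicator Mq (γ a m) c + z) (T-≤ c (suc m) (s≤s m≤t)))
          (trans (QC.exact-split m≤t a c) (sym (T-≤ c m m≤1+t)))
        go (inj₂ refl) = trans (cong₂ _+_
          (𝟙-cong (coset? l Mq (γ a (suc t)) c) (≡[mod]? c 0ℤ Mq)
            (proj₁ (top-coset {+ l} {Mq} (+ (p ^ a)) (γ-at-q a (suc t)) {c})) (proj₂ (top-coset {+ l} {Mq} (+ (p ^ a)) (γ-at-q a (suc t)) {c})))
          (T-> c (suc (suc t)) ℕ.≤-refl)) (trans (ℕ.+-identityʳ _) (sym (T-≤ c (suc t) m≤1+t)))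

      q-same : ∀ c a m → m ≤ suc t → indicator Mq (γ* a m) c ≡ indicator Mq (γ a m) c
      q-same c a m m≤1+t = go (ℕ.m≤n⇒m<n∨m≡n m≤1+t)
        where
        go : m < suc t ⊎ m ≡ suc t → indicator Mq (γ* a m) c ≡ indicator Mq (γ a m) c
        go (inj₁ (s≤s m≤t)) = 𝟙-cong (coset? l Mq (γ* a m) c) (coset? l Mq (γ a m) c)
          (λ x → let y , z = QL*.coset⇒layer m≤t a {c} x in QL.layer⇒coset m≤t a {c} y z)
          (λ x → let y , z = QL.coset⇒layer m≤t a {c} x in QL*.layer⇒coset m≤t a {c} y z)
        go (inj₂ refl) = 𝟙-cong (coset? l Mq (γ* a (suc t)) c) (coset? l Mq (γ a (suc t)) c)
          (λ x → proj₂ (top-coset {+ l} {Mq} (+ (p ^ a)) (γ-at-q a (suc t)) {c}) (proj₁ (top-coset {+ l} {Mq} (+ (p ^ a) ℤ.* g) (γ*-at-q a (suc t)) {c}) x))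
          (λ x → proj₂ (top-coset {+ l} {Mq} (+ (p ^ a) ℤ.* g) (γ*-at-q a (suc t)) {c}) (proj₁ (top-coset {+ l} {Mq} (+ (p ^ a)) (γ-at-q a (suc t)) {c}) x))

      p-split : ∀ c a b → a ≤ s → (indicator Mp (γ a b) c + indicator Mp (γ* a b) c) + multiple (p ^ suc a) c ≡ multiple (p ^ a) c
      p-split c a b a≤s = trans (cong (λ z → (indicator Mp (γ a b) c + z) + multiple (p ^ suc a) c) (indicator-neg a b c))
        (PH.half-split a≤s b c)

      p-top : ∀ c b → indicator Mp (γ (suc s) b) c ≡ multiple (p ^ suc s) c
      p-top c b = 𝟙-cong (coset? l Mp (γ (suc s) b) c) (≡[mod]? c 0ℤ Mp)
        (proj₁ (top-coset {+ l} {Mp} (+ (q ^ b)) (γ-at-p (suc s) b) {c})) (proj₂ (top-coset {+ l} {Mp} (+ (q ^ b)) (γ-at-p (suc s) b) {c}))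

    -- The values of `pairs-count`: K and L for c in the layer, H and F for c of larger valuation,
    -- with e = p^(s - i) for the first two names and e = q^(t - j) for the others.
    K H L F : ℕ
    K = w * p ^ (s ∸ i)
    H = (1 + 2 * w) * p ^ (s ∸ i)
    L = (q ∸ 2) * q ^ (t ∸ j)
    F = q ^ (t ∸ j) * suc (q ∸ 2)

    -- Regrouped by modulus, the summand is a function on ℤ_{p^(s+1)} times one on ℤ_{q^(t+1)}. The
    -- starred p-factor has become a negation and the starred q-factor has lost its star.
    convolution : ∀ c → cyclicSum n (λ u → coefficient (γ i j) u * coefficient (γ* i j) (c ℤ.- u)) ≡
      (K * (indicator Mp (γ i j) c + indicator Mp (γ* i j) c) + H * multiple (p ^ suc i) c) *
      (L * indicator Mq (γ i j) c + F * T c (suc j))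
    convolution c = begin
      cyclicSum n (λ u → coefficient (γ i j) u * coefficient (γ* i j) (c ℤ.- u))
        ≡⟨ cyclicSum-cong n regroup ⟩
      cyclicSum n (λ u → G u * G′ u)
        ≡⟨ cyclicSum-crt Mp Mq {proj₁ Mq-inverse} {G} {G′} (proj₂ Mq-inverse) G-periodic G′-periodic ⟩
      PH.pairs i≤s j c * QC.pairs j≤t i c
        ≡⟨ cong₂ _*_ (trans (PH.pairs-count i≤s j c)
             (cong (λ z → K * (indicator Mp (γ i j) c + z) + H * multiple (p ^ suc i) c) (sym (indicator-neg i j c))))
             (trans (QC.pairs-count j≤t i c) (cong (λ z → L * indicator Mq (γ i j) c + F * z) (sym (T-≤ c (suc j) (s≤s j≤t))))) ⟩
      _ ∎
      where
      open ≡.≡-Reasoning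
      G G′ : ℤ → ℕ
      G u = indicator Mp (γ i j) u * indicator Mp (γ i j) (ℤ.- (c ℤ.- u))
      G′ u = indicator Mq (γ i j) u * indicator Mq (γ i j) (c ℤ.- u)
      G-periodic : Periodic Mp G
      G-periodic a b a≡b = cong₂ _*_ (indicator-periodic Mp (γ i j) a b a≡b)
        (indicator-periodic Mp (γ i j) (ℤ.- (c ℤ.- a)) (ℤ.- (c ℤ.- b)) (-mod (+ˡ-mod c (-mod a≡b))))
      G′-periodic : Periodic Mq G′
      G′-periodic a b a≡b = cong₂ _*_ (indicator-periodic Mq (γ i j) a b a≡b)
        (indicator-periodic Mq (γ i j) (c ℤ.- a) (c ℤ.- b) (+ˡ-mod c (-mod a≡b)))
      lemma : ∀ a b c d → a * b * (c * d) ≡ a * c * (b * d)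
      lemma = ℕ-Solver.solve-∀
      regroup : ∀ u → coefficient (γ i j) u * coefficient (γ* i j) (c ℤ.- u) ≡ G u * G′ u
      regroup u = trans
        (cong (λ z → coefficient (γ i j) u * z) (cong₂ _*_ (indicator-neg i j (c ℤ.- u)) (q-same (c ℤ.- u) i j (ℕ.m≤n⇒m≤1+n j≤t))))
        (lemma (indicator Mp (γ i j) u) (indicator Mq (γ i j) u) (indicator Mp (γ i j) (ℤ.- (c ℤ.- u))) (indicator Mq (γ i j) (c ℤ.- u)))

    -- The constants are variables with equations, so that the expressions in φ of the statement can
    -- be replaced by matching on `refl`.
    coefficients : ∀ {K′ H′ L′ F′} → K′ ≡ K → H′ ≡ H → L′ ≡ L → F′ ≡ F → ∀ c →
      cyclicSum n (λ u → coefficient (γ i j) u * coefficient (γ* i j) (c ℤ.- u)) ≡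
      K′ * L′ * (coefficient (γ i j) c + coefficient (γ* i j) c)
      + K′ * F′ * ℕ-sumOver j (suc t) (λ m → coefficient (γ i m) c + coefficient (γ* i m) c)
      + H′ * F′ * ℕ-sumOver i s (λ k → ℕ-sumOver j (suc t) (λ m → coefficient (γ k m) c + coefficient (γ* k m) c))
      + H′ * L′ * coefficient (γ (suc s) j) c + H′ * F′ * ℕ-sumOver j (suc t) (λ m → coefficient (γ (suc s) m) c)
      + H′ * L′ * ℕ-sumOver i s (λ k → coefficient (γ k j) c + coefficient (γ* k j) c)
    coefficients refl refl refl refl c = trans (convolution c) (LayerIdentity.layer-identity {s} {suc t} {i} {j} i≤s (ℕ.m≤n⇒m≤1+n j≤t)
      (λ a b → indicator Mp (γ a b) c) (λ a b → indicator Mp (γ* a b) c)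
      (λ a b → indicator Mq (γ a b) c) (λ a b → indicator Mq (γ* a b) c)
      (λ k → multiple (p ^ k) c) (T c) (p-split c) (p-top c) (q-split c)
      (λ a m m≤ → trans (cong (_+ T c (suc m)) (q-same c a m m≤)) (q-split c a m m≤)) (T-> c (suc (suc t)) ℕ.≤-refl) K H L F)

-- The constants of the statement, and the theorem.

quarter : ∀ {p} w → p ≡ 3 + 4 * w → (p ∸ 3) / 4 ≡ w
quarter w refl = trans (cong (_/ 4) (ℕ.*-comm 4 w)) (m*n/n≡m w 4)

3-mod-4 : ∀ p → p % 4 ≡ 3 → p ≡ 3 + 4 * (p / 4)
3-mod-4 p p%4≡3 = trans (m≡m%n+[m/n]*n p 4) (cong₂ _+_ p%4≡3 (ℕ.*-comm (p / 4) 4))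

φ-prime-power : ∀ {q} → Prime q → ∀ e → φ (q ^ suc e) ≡ q ^ e * suc (q ∸ 2)
φ-prime-power {q} q-prime e = ℕ.+-cancelʳ-≡ (q ^ e) _ _ (trans (φ-^ q-prime e)
  (trans (cong (_* q ^ e) (sym (ℕ.m+[n∸m]≡n (prime≥2 q-prime)))) (lemma (q ∸ 2) (q ^ e))))
  where
  lemma : ∀ k e → (2 + k) * e ≡ e * suc k + e
  lemma = ℕ-Solver.solve-∀

theorem4p3 :
    ∀ (s t p q l : ℕ) →
    1 ≤ s → 1 ≤ t →
    Prime p → Prime q → Prime l →
    p ≢ q → p ≢ l → q ≢ l →
    2 ∤ p → 2 ∤ q → p % 4 ≡ 3 →
    HasOrder (p ^ s) (+ l) (φ (p ^ s) / 2) →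
    HasOrder (q ^ t) (+ l) (φ (q ^ t)) →
    gcd (φ (p ^ s)) (φ (q ^ t)) ≡ 2 →
    ∀ (g : ℤ) → IsPrimitiveRoot (p ^ s) g → IsPrimitiveRoot (q ^ t) g →
    ∀ (i j : ℕ) → i ≤ s ∸ 1 → j ≤ t ∸ 1 →
    let
      open CyclicAlgebra l (p ^ s * q ^ t)
      χ  = λ (a b : ℕ) → cosetSum (+ (p ^ a * q ^ b))
      χ* = λ (a b : ℕ) → cosetSum (+ (p ^ a * q ^ b) ℤ.* g)
    in
    χ i j *ᴿ χ* i j ≈ᴿ
      ((p ∸ 3) / 4 * p ^ (s ∸ i ∸ 1) * ((q ∸ 2) * q ^ (t ∸ j ∸ 1))) · (χ i j +ᴿ χ* i j)
      +ᴿ ((p ∸ 3) / 4 * p ^ (s ∸ i ∸ 1) * φ (q ^ (t ∸ j))) · (∑[ j < m ≤ t ] (χ i m +ᴿ χ* i m))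
      +ᴿ (φ (p ^ (s ∸ i)) / 2 * φ (q ^ (t ∸ j))) · (∑[ i < k ≤ s ∸ 1 ] ∑[ j < m ≤ t ] (χ k m +ᴿ χ* k m))
      +ᴿ (φ (p ^ (s ∸ i)) / 2 * ((q ∸ 2) * q ^ (t ∸ j ∸ 1))) · χ s j
      +ᴿ (φ (p ^ (s ∸ i)) / 2 * φ (q ^ (t ∸ j))) · (∑[ j < m ≤ t ] χ s m)
      +ᴿ (φ (p ^ (s ∸ i)) / 2 * ((q ∸ 2) * q ^ (t ∸ j ∸ 1))) · (∑[ i < k ≤ s ∸ 1 ] (χ k j +ᴿ χ* k j))
-- From here s and t are one less than in the statement: the layers of exact valuation have indices
-- up to s and t, and the top indices are `suc s` and `suc t`.
theorem4p3 (suc s) (suc t) p q l (s≤s _) (s≤s _) p-prime q-prime _ p≢q _ _ _ _ p%4≡3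
  l-p-order l-q-order gcd≡2 g g-p-order g-q-order i j i≤s j≤t =
  PowerSums.product-expansion ring C.n x xⁿ≈1
    (λ a b → cosetSum (C.γ a b)) (λ a b → cosetSum (C.γ* a b))
    (λ a b → C.coefficient (C.γ a b)) (λ a b → C.coefficient (C.γ* a b))
    (λ a b → cosetSum≈combination (C.γ a b) (C.coefficient (C.γ a b)) (C.inCoset-indicator (C.γ a b)))
    (λ a b → cosetSum≈combination (C.γ* a b) (C.coefficient (C.γ* a b)) (C.inCoset-indicator (C.γ* a b)))
    (λ a b → C.coefficient-periodic (C.γ* a b))
    (suc s) (suc t) i j (K * L) (K * F) (H * F) (H * L) (H * F) (H * L)
    (C.coefficients i≤s j≤t K≡ H≡ L≡ F≡)
  where
  w = p / 4
  p≡3+4w : p ≡ 3 + 4 * w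
  p≡3+4w = 3-mod-4 p p%4≡3
  h = φ (p ^ suc s) / 2
  2h≡φ : 2 * h ≡ φ (p ^ suc s)
  2h≡φ = φ-double {w = w} p-prime p≡3+4w s
  h-odd : ∃ λ r → h ≡ suc (2 * r)
  h-odd = φ-half-odd {w = w} p-prime p≡3+4w s
  module C = Components {p} {q} {s} {t} {l} {w} {h} {proj₁ h-odd} {φ (q ^ suc t)} {g} p-prime q-prime p≢q p≡3+4w
    2h≡φ (proj₂ h-odd) refl l-p-order l-q-order (trans (cong (λ z → gcd z (φ (q ^ suc t))) 2h≡φ) gcd≡2)
    (subst (HasOrder (p ^ suc s) g) (sym 2h≡φ) g-p-order) g-q-order
  open CyclicAlgebra l C.n using (ring; x; cosetSum)
  open CosetSums l C.n
  s-i : suc s ∸ i ≡ suc (s ∸ i)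
  s-i = ℕ.+-∸-assoc 1 i≤s
  t-j : suc t ∸ j ≡ suc (t ∸ j)
  t-j = ℕ.+-∸-assoc 1 j≤t
  K H L F : ℕ
  K = (p ∸ 3) / 4 * p ^ (suc s ∸ i ∸ 1)
  H = φ (p ^ (suc s ∸ i)) / 2
  L = (q ∸ 2) * q ^ (suc t ∸ j ∸ 1)
  F = φ (q ^ (suc t ∸ j))
  K≡ : K ≡ w * p ^ (s ∸ i)
  K≡ = cong₂ (λ x e → x * p ^ (e ∸ 1)) (quarter w p≡3+4w) s-i
  H≡ : H ≡ (1 + 2 * w) * p ^ (s ∸ i)
  H≡ = trans (cong (λ e → φ (p ^ e) / 2) s-i) (φ-half {w = w} p-prime p≡3+4w (s ∸ i))
  L≡ : L ≡ (q ∸ 2) * q ^ (t ∸ j)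
  L≡ = cong (λ e → (q ∸ 2) * q ^ (e ∸ 1)) t-j
  F≡ : F ≡ q ^ (t ∸ j) * suc (q ∸ 2)
  F≡ = trans (cong (λ e → φ (q ^ e)) t-j) (φ-prime-power q-prime (t ∸ j))
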